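{- Let $n\ge 2$. For $s,t\in\{2,3,\ldots,n\}$ and $i\in\{1,2,\ldots,n\}$, $$ \overline{\overline{\underline{A_{n,s,i,t}}}} = |\overline{A}|_{n,s+1,i,t} + |\overline{A}|_{n,s+1,i,t+1} + |\overline{A}|_{n,s,i+1,t} - |\overline{A}|_{n,s+1,i+1,t} - |\overline{A}|_{n,s,i,t+1} - |\overline{A}|_{n,s+1,i-1,t+1}, $$ where by convention $|\overline{A}|_{n,n+1,i,t} = |\overline{A}|_{n,s,i,n+1} = |\overline{A}|_{n,s,0,t} = |\overline{A}|_{n,s,n+1,t}=0$.
   Context: An $n\times n$ alternating sign matrix is a square matrix with entries in $\{1,-1,0\}$ such that in every row and every column the entries sum to $1$ and the non-zero entries alternate in sign. For $s,i,t\in\{1,\ldots,n\}$, $|\overline{A}|_{n,s,i,t}$ denotes the number of $n\times n$ alternating sign matrices having a $1$ in position $(s,1)$, a $1$ in position $(1,i)$ and a $1$ in position $(t,n)$ (row index first). Let $E_x$ denote the shift operator $E_x p(x)=p(x+1)$ and $\mathrm{id}$ the identity operator. For integers $k_1,\ldots,k_n$ define $$\alpha(n;k_1,\ldots,k_n)=\prod_{1\le p<q\le n}(\mathrm{id}-E_{k_p}+E_{k_p}E_{k_q})\prod_{1\le i<j\le n}\frac{k_j-k_i}{j-i},$$ a polynomial in $k_1,\ldots,k_n$ of degree at most $n-1$ in each variable (for strictly increasing $k_1<\dots<k_n$ it equals the number of monotone triangles with bottom row $(k_1,\ldots,k_n)$). The numbers $\overline{\overline{\underline{A_{n,s,i,t}}}}$,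 $s,i,t\in\{1,\ldots,n\}$, are defined as the unique coefficients in the polynomial expansion $$\alpha(n;k_1,2,3,\ldots,n-2,k_{n-1},k_n)=\sum_{s=1}^n\sum_{i=1}^n\sum_{t=1}^n \overline{\overline{\underline{A_{n,s,i,t}}}}\,(-1)^{s+1}\binom{k_1-2}{s-1}\binom{k_{n-1}-n+i}{i-1}\binom{k_n-n+t}{t-1},$$ where $\binom{x}{m}=x(x-1)\cdots(x-m+1)/m!$ as a polynomial in $x$. (For $i<t$ these numbers count $n\times n$ alternating sign matrices with respect to prescribed two top rows and bottom row; the identity is asserted for all $s,i,t$ in the stated ranges, including $i\ge t$.) -}

module Defs where

open import Data.Bool.Base using (if_then_else_)
open import Data.Fin.Base as Fin using (Fin; toℕ)
import Data.Fin.Properties as Fin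
open import Data.Integer.Base as ℤ using (ℤ; +_; 0ℤ; 1ℤ; -1ℤ)
import Data.Integer.Properties as ℤ
open import Data.List.Base as List using (List; []; _∷_)
open import Data.List.Membership.DecPropositional ℤ._≟_ using (_∈_; _∈?_)
open import Data.List.Relation.Unary.Linked as Linked using (Linked)
import Data.Maybe.Base as Maybe
open import Data.Nat.Base as ℕ using (ℕ; zero; suc; _!)
import Data.Nat.Properties as ℕ
open import Data.Product.Base using (_×_; _,_; ∃₂)
open import Data.Rational.Base as ℚ using (ℚ; 1ℚ)
import Data.Rational.Properties as ℚ
open import Data.Vec.Base as Vec using (Vec; []; _∷_)
open import Data.Vec.Functional using (Vector; updateAt)
open import Data.Vec.Relation.Unary.All as All using (All)
open import Relation.Binary.PropositionalEquality using (_≡_)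
open import Relation.Nullary.Decidable using (does; ¬?; _×-dec_; dec⇒maybe)
open import Relation.Unary using (Decidable)

open import Algebra.Properties.CommutativeMonoid.Sum ℚ.+-0-commutativeMonoid
  using (sum-syntax)

-- The 1-based position of an index.
pos : ∀ {n} → Fin n → ℕ
pos p = suc (toℕ p)

fromℤ : ℤ → ℚ
fromℤ x = x ℚ./ 1

------------------------------------------------------------------------
-- Alternating sign matrices

Matrix : ℕ → Set
Matrix n = Vec (Vec ℤ n) n

signs : List ℤ
signs = 1ℤ ∷ -1ℤ ∷ 0ℤ ∷ []

nonZeros : ∀ {n} → Vec ℤ n → List ℤ
nonZeros v = List.filter (λ x → ¬? (x ℤ.≟ 0ℤ)) (Vec.toList v)

-- For entries in {1,-1,0}, the non-zero entries alternate in sign iff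
-- each is the negative of the next.
IsAltLine : ∀ {n} → Vec ℤ n → Set
IsAltLine v =
    All (_∈ signs) v
  × Vec.foldr _ ℤ._+_ 0ℤ v ≡ 1ℤ
  × Linked (λ x y → x ≡ ℤ.- y) (nonZeros v)

isAltLine? : ∀ {n} → Decidable (IsAltLine {n})
isAltLine? v =
        All.all? (_∈? signs) v
  ×-dec (Vec.foldr _ ℤ._+_ 0ℤ v ℤ.≟ 1ℤ)
  ×-dec Linked.linked? (λ x y → x ℤ.≟ ℤ.- y) (nonZeros v)

IsASM : ∀ {n} → Matrix n → Set
IsASM M = All IsAltLine M × All IsAltLine (Vec.transpose M)

isASM? : ∀ {n} → Decidable (IsASM {n})
isASM? M = All.all? isAltLine? M ×-dec All.all? isAltLine? (Vec.transpose M)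

-- Row r and column c are 1-based; there is no one at a position outside
-- the matrix.
OneAt : ∀ {n} → ℕ → ℕ → Matrix n → Set
OneAt {n} r c M = ∃₂ λ (p q : Fin n) →
  pos p ≡ r × pos q ≡ c × Vec.lookup (Vec.lookup M p) q ≡ 1ℤ

oneAt? : ∀ {n} r c → Decidable (OneAt {n} r c)
oneAt? r c M = Fin.any? λ p → Fin.any? λ q →
  (pos p ℕ.≟ r) ×-dec (pos q ℕ.≟ c) ×-dec
  (Vec.lookup (Vec.lookup M p) q ℤ.≟ 1ℤ)

allVecs : ∀ {A : Set} → List A → ∀ n → List (Vec A n)
allVecs xs zero    = [] ∷ []
allVecs xs (suc n) = List.cartesianProductWith _∷_ xs (allVecs xs n)

-- Every n × n matrix with entries in {1,-1,0}, listed exactly once.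
signMatrices : ∀ n → List (Matrix n)
signMatrices n = allVecs (allVecs signs n) n

IsRefinedASM : ∀ {n} → ℕ → ℕ → ℕ → Matrix n → Set
IsRefinedASM {n} s i t M =
  IsASM M × OneAt s 1 M × OneAt 1 i M × OneAt t n M

isRefinedASM? : ∀ {n} s i t → Decidable (IsRefinedASM {n} s i t)
isRefinedASM? {n} s i t M =
  isASM? M ×-dec oneAt? s 1 M ×-dec oneAt? 1 i M ×-dec oneAt? t n M

-- Because of OneAt, this is 0 as soon as one of s, i, t is not in {1,…,n}.
#ASM : (n s i t : ℕ) → ℕ
#ASM n s i t = List.length (List.filter (isRefinedASM? s i t) (signMatrices n))

------------------------------------------------------------------------
-- The operator formula

-- Polynomials in n variables over ℚ are represented by their values on ℤⁿ,
-- which determine them; shift operators act on arbitrary such functions.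
PolyFun : ℕ → Set
PolyFun n = Vector ℤ n → ℚ

E : ∀ {n} → Fin n → PolyFun n → PolyFun n
E p f k = f (updateAt k p ℤ.suc)

-- id - E_p + E_p E_q
shiftFactor : ∀ {n} → Fin n → Fin n → PolyFun n → PolyFun n
shiftFactor p q f k = (f k ℚ.- E p f k) ℚ.+ E p (E q f) k

pairs : ∀ n → List (∃₂ λ (p q : Fin n) → p Fin.< q)
pairs n = List.mapMaybe
  (λ (p , q) → Maybe.map (λ p<q → p , q , p<q) (dec⇒maybe (p Fin.<? q)))
  (List.cartesianProduct (List.allFin n) (List.allFin n))

differenceQuotient : ∀ {n} → Vector ℤ n → (∃₂ λ (i j : Fin n) → i Fin.< j) → ℚ
differenceQuotient k (i , j , i<j) =
  ℚ._/_ (k j ℤ.- k i) (toℕ j ℕ.∸ toℕ i)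
    {{ℕ.>-nonZero (ℕ.m<n⇒0<n∸m i<j)}}

∏differenceQuotients : ∀ n → PolyFun n
∏differenceQuotients n k =
  List.foldr (λ ij r → differenceQuotient k ij ℚ.* r) 1ℚ (pairs n)

-- The operators shiftFactor p q commute, so the order of composition is
-- immaterial.
α : ∀ n → PolyFun n
α n = List.foldr (λ (p , q , _) → shiftFactor p q) (∏differenceQuotients n) (pairs n)

fallingFactorial : ℤ → ℕ → ℤ
fallingFactorial x zero    = 1ℤ
fallingFactorial x (suc m) = fallingFactorial x m ℤ.* (x ℤ.- + m)

binomial : ℤ → ℕ → ℚ
binomial x m = ℚ._/_ (fallingFactorial x m) (m !) {{m ℕ.!≢0}}

-- (k₁ , 2 , 3 , … , n-2 , kₙ₋₁ , kₙ).  For n = 2 the entries k₁ and kₙ₋₁ share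
-- a position; then kₙ₋₁ is dropped and the tuple is (k₁ , kₙ).
bottomRow : ∀ n (k₁ kₙ₋₁ kₙ : ℤ) → Vector ℤ n
bottomRow n k₁ kₙ₋₁ kₙ p =
  if does (pos p ℕ.≟ 1) then k₁ else
  if does (pos p ℕ.≟ n) then kₙ else
  if does (suc (pos p) ℕ.≟ n) then kₙ₋₁ else
  + pos p

Coefficients : ℕ → Set
Coefficients n = (s i t : Fin n) → ℚ

-- A is the family of coefficients in the expansion of
-- α(n; k₁, 2, …, n-2, kₙ₋₁, kₙ), regarded as a polynomial in the independent
-- variables k₁, kₙ₋₁, kₙ.  The products of binomials are linearly independent,
-- so at most one family satisfies this.
IsExpansion : ∀ n → Coefficients n → Set
IsExpansion n A = ∀ (k₁ kₙ₋₁ kₙ : ℤ) →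
  α n (bottomRow n k₁ kₙ₋₁ kₙ) ≡
  ∑[ s < n ] ∑[ i < n ] ∑[ t < n ]
    ( A s i t
      ℚ.* fromℤ (-1ℤ ℤ.^ (pos s ℕ.+ 1))
      ℚ.* binomial (k₁ ℤ.- + 2) (pos s ℕ.∸ 1)
      ℚ.* binomial (kₙ₋₁ ℤ.- + n ℤ.+ + pos i) (pos i ℕ.∸ 1)
      ℚ.* binomial (kₙ ℤ.- + n ℤ.+ + pos t) (pos t ℕ.∸ 1) )

{-# OPTIONS --safe #-}
module Submission where

-- Write D = id - E for k₁ and ∇ = id - E⁻¹ for the other variables.  As the operator
-- in the definition of α is symmetric up to the factors id - E_p + E_p E_q, the
-- function α inherits from the antisymmetry of the Vandermonde product W the rules
--   α(…, a, a, …) + α(…, a + 1, a + 1, …) = α(…, a, a + 1, …),   α(…, a, a, a, …) = 0,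
-- and ∇₂⋯∇ₙ W(k₁, …, kₙ) = W(k₂, …, kₙ) gives ∇₂⋯∇ₙ α(k₁, …, kₙ) = α(k₂, …, kₙ).
-- These rules determine α and have three consequences.
-- (1) Reading two successive rows of a monotone triangle from left to right, α counts
--     monotone triangles, and with Gᵢ(k₁, kₙ) = α(k₁, 2, …, i - 1, i + 1, …, n - 1, kₙ)
--     one gets |A|_{n,s,i,t} = Dˢ⁻² ∇ᵗ⁻² Gᵢ at (2, n - 1) for s, t ≥ 2.
-- (2) ∏ⱼ (v + (1 - v) Eⱼ) α = α for an indeterminate v.
-- (3) Applying D ∇ₙ and the factors of (2) for the entries 2, …, n - 2 to
--     α(k₁, 2, …, n - 1, kₙ) yields ∑ᵢ vⁱ⁻² Gᵢ(k₁, kₙ).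
-- Comparing coefficients in (2), the value of D ∇ₙ ∇ⁱ⁻¹ α(k₁, 2, …, n - 2, x, kₙ) at
-- x = n - 2, with ∇ⁱ⁻¹ acting on x, is the coefficient of vⁱ⁻¹ in
-- (v + (1 - v) E₁)(v + (1 - v) Eₙ) ∑ⱼ vʲ⁻² Gⱼ.  Expanded in D and ∇ₙ, this has the six
-- terms of the theorem; its left side is the coefficient of the expansion because
-- the binomials form Appell sequences for D and ∇.

open import Defs

open import Data.Bool.Base using (Bool; true; false; if_then_else_; _∧_; T)
import Data.Bool.Properties as Bool
open import Data.Empty using (⊥-elim)
open import Data.Fin.Base as Fin using (Fin; zero; suc; toℕ; inject₁; fromℕ)
import Data.Fin.Properties as Fin
open import Data.Fin.Relation.Unary.Top using (view; ‵fromℕ; ‵inject₁)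
open import Data.Integer.Base as ℤ using (ℤ; +_; -[1+_]; 0ℤ; 1ℤ; -1ℤ)
import Data.Integer.Properties as ℤ
import Data.Integer.Solver as ℤ
open import Data.List.Base as List using (List; []; _∷_; _++_; map; length; foldr)
open import Data.List.Membership.Propositional using (_∈_)
import Data.List.Properties as List
open import Data.List.Relation.Binary.Pointwise as Pointwise using (Pointwise; []; _∷_)
open import Data.List.Relation.Unary.Any using (here; there)
open import Data.List.Relation.Unary.Linked using (Linked; []; [-]; _∷_)
import Data.Maybe.Base as Maybe
open import Data.Nat.Base as ℕ using (ℕ; zero; suc; pred; _!; _≤_; s≤s)
import Data.Nat.Properties as ℕ
open import Data.Product.Base using (_×_; _,_; ∃; ∃₂; proj₁; proj₂)
open import Data.Rational.Base as ℚ using (ℚ; 0ℚ; 1ℚ; _+_; _*_; _-_; -_)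
import Data.Rational.Properties as ℚ
open import Data.Rational.Solver using (module +-*-Solver)
import Data.Rational.Unnormalised.Base as ℚᵘ
import Data.Rational.Unnormalised.Properties as ℚᵘ
open import Data.Unit.Base using (tt)
open import Data.Vec.Base as Vec using (Vec; []; _∷_; lookup)
open import Data.Vec.Functional using (Vector; updateAt)
import Data.Vec.Properties as Vec
open import Data.Vec.Relation.Unary.All as All using (All; []; _∷_)
import Data.Vec.Relation.Unary.All.Properties as All
open import Function.Base using (_∘_)
open import Relation.Binary.PropositionalEquality
open import Relation.Nullary.Decidable using (Dec; does; yes; no; dec⇒maybe; dec-true; dec-false)
open import Relation.Nullary.Negation using (¬_)

open import Algebra.Properties.AbelianGroup ℤ.+-0-abelianGroup using (∙-cancelˡ)
open import Algebra.Properties.CommutativeMonoid.Sum ℚ.+-0-commutativeMonoid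
  using (sum-syntax; sum-cong-≗)
open +-*-Solver using (Polynomial; solve; con; _:+_; _:*_; _:-_; :-_; _:=_)
open ≡-Reasoning

-- Shift operators

-- No polynomials occur: α is a function on lists of integers, and all operators act on arbitrary
-- functions. In place of arguments by degree or by polynomial identity stands `vanishes`, where the
-- rule for two equal entries fixes the constant that differences leave open. The rules for equal
-- entries are needed under ∇, behind fixed leading entries and inside the factors of (2); so they
-- are proved for the class `Rep` of all images of antisymmetric functions, which is closed under
-- these operations. The rule for three equal entries is needed because the factors of (2) create
-- descents such as (a + 1, a); with ∇ taken in a following entry a + 1 these reduce to three equal
-- entries and vanish. The point n - 2 has two roles: there the binomials in the last two variables
-- vanish except for the constant one, and one step above it the variable x equals n - 1, the entry
-- that continues 2, ..., n - 2, which is where (3) applies. For n = 2 the variables k₁ and kₙ₋₁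
-- share a position; there both sides are zero.

data Shift : Set where
  dn st up : Shift

sh : Shift → ℤ → ℤ
sh dn = ℤ.pred
sh st x = x
sh up = ℤ.suc

sh-comm : ∀ i j x → sh i (sh j x) ≡ sh j (sh i x)
sh-comm dn dn x = refl
sh-comm dn st x = refl
sh-comm dn up x = trans (ℤ.pred-suc x) (sym (ℤ.suc-pred x))
sh-comm st dn x = refl
sh-comm st st x = refl
sh-comm st up x = refl
sh-comm up dn x = trans (ℤ.suc-pred x) (sym (ℤ.pred-suc x))
sh-comm up st x = refl
sh-comm up up x = refl

Terms : Set
Terms = List (ℚ × Shift × Shift)

comb : Terms → (Shift → Shift → ℚ) → ℚ
comb [] φ = 0ℚ
comb ((c , i , j) ∷ T) φ = c * φ i j + comb T φ

comb-cong : ∀ T {φ ψ} → (∀ i j → φ i j ≡ ψ i j) → comb T φ ≡ comb T ψ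
comb-cong [] e = refl
comb-cong ((c , i , j) ∷ T) e = cong₂ (λ x y → c * x + y) (e i j) (comb-cong T e)

comb-lin : ∀ T a (φ ψ : Shift → Shift → ℚ) →
           comb T (λ i j → a * φ i j + ψ i j) ≡ a * comb T φ + comb T ψ
comb-lin [] a φ ψ = solve 1 (λ a → con 0ℚ := a :* con 0ℚ :+ con 0ℚ) refl a
comb-lin ((c , i , j) ∷ T) a φ ψ = trans
  (cong (λ z → c * (a * φ i j + ψ i j) + z) (comb-lin T a φ ψ))
  (solve 6 (λ c a x y X Y →
      c :* (a :* x :+ y) :+ (a :* X :+ Y) := a :* (c :* x :+ X) :+ (c :* y :+ Y))
    refl c a (φ i j) (ψ i j) (comb T φ) (comb T ψ))

-- Each operator proves extensionality and the single law for `a * f + g` by recursion; zero,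
-- negation, sums and finite combinations then follow uniformly.
module Linear
  {A : Set} (L : (A → ℚ) → ℚ)
  (L-cong : ∀ {f g} → (∀ x → f x ≡ g x) → L f ≡ L g)
  (L-lin : ∀ a f g → L (λ x → a * f x + g x) ≡ a * L f + L g)
  where

  L-zero : L (λ _ → 0ℚ) ≡ 0ℚ
  L-zero = begin
    L (λ _ → 0ℚ)                          ≡⟨ L-lin (- 1ℚ) (λ _ → 0ℚ) (λ _ → 0ℚ) ⟩
    - 1ℚ * L (λ _ → 0ℚ) + L (λ _ → 0ℚ)    ≡⟨ solve 1 (λ x → con (- 1ℚ) :* x :+ x := con 0ℚ) refl (L (λ _ → 0ℚ)) ⟩
    0ℚ                                    ∎

  L-comb : ∀ T (f : Shift → Shift → A → ℚ) →
           L (λ x → comb T (λ i j → f i j x)) ≡ comb T (λ i j → L (f i j))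
  L-comb [] f = L-zero
  L-comb ((c , i , j) ∷ T) f =
    trans (L-lin c (f i j) _) (cong (λ z → c * L (f i j) + z) (L-comb T f))

  L-neg : ∀ f → L (λ x → - f x) ≡ - L f
  L-neg f = begin
    L (λ x → - f x)               ≡⟨ L-cong (λ x → solve 1 (λ x → :- x := con (- 1ℚ) :* x :+ con 0ℚ) refl (f x)) ⟩
    L (λ x → - 1ℚ * f x + 0ℚ)     ≡⟨ L-lin (- 1ℚ) f (λ _ → 0ℚ) ⟩
    - 1ℚ * L f + L (λ _ → 0ℚ)     ≡⟨ cong (λ z → - 1ℚ * L f + z) L-zero ⟩
    - 1ℚ * L f + 0ℚ               ≡⟨ solve 1 (λ x → con (- 1ℚ) :* x :+ con 0ℚ := :- x) refl (L f) ⟩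
    - L f                         ∎

  L-add : ∀ f g → L (λ x → f x + g x) ≡ L f + L g
  L-add f g = begin
    L (λ x → f x + g x)           ≡⟨ L-cong (λ x → cong (_+ g x) (sym (ℚ.*-identityˡ (f x)))) ⟩
    L (λ x → 1ℚ * f x + g x)      ≡⟨ L-lin 1ℚ f g ⟩
    1ℚ * L f + L g                ≡⟨ cong (_+ L g) (ℚ.*-identityˡ (L f)) ⟩
    L f + L g                     ∎

  L-sub : ∀ f g → L (λ x → f x - g x) ≡ L f - L g
  L-sub f g = trans (L-add f (λ x → - g x)) (cong (λ z → L f + z) (L-neg g))

  L-scale : ∀ a f → L (λ x → a * f x) ≡ a * L f
  L-scale a f = begin
    L (λ x → a * f x)            ≡⟨ L-cong (λ x → sym (ℚ.+-identityʳ _)) ⟩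
    L (λ x → a * f x + 0ℚ)       ≡⟨ L-lin a f (λ _ → 0ℚ) ⟩
    a * L f + L (λ _ → 0ℚ)       ≡⟨ cong (λ z → a * L f + z) L-zero ⟩
    a * L f + 0ℚ                 ≡⟨ ℚ.+-identityʳ _ ⟩
    a * L f                      ∎

module comb-Linear (T : Terms) = Linear {Shift × Shift} (λ f → comb T (λ i j → f (i , j)))
  (λ e → comb-cong T (λ i j → e (i , j))) (λ a f g → comb-lin T a _ _)

comb-swap : ∀ T T' (φ : Shift → Shift → Shift → Shift → ℚ) →
            comb T (λ i j → comb T' (φ i j)) ≡ comb T' (λ k l → comb T (λ i j → φ i j k l))
comb-swap T T' φ = comb-Linear.L-comb T T' (λ k l (i , j) → φ i j k l)

comb-neg : ∀ T φ → comb T (λ i j → - φ i j) ≡ - comb T φ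
comb-neg T φ = comb-Linear.L-neg T (λ (i , j) → φ i j)

comb-sub : ∀ T φ ψ → comb T (λ i j → φ i j - ψ i j) ≡ comb T φ - comb T ψ
comb-sub T φ ψ = comb-Linear.L-sub T (λ (i , j) → φ i j) (λ (i , j) → ψ i j)

-- The operator ∏ₓ (Σ c Eₖⁱ Eₓʲ), where x ranges over the entries of the list and
-- k is an additional variable.
M : Terms → (ℤ → List ℤ → ℚ) → ℤ → List ℤ → ℚ
M T g k [] = g k []
M T g k (x ∷ xs) = comb T λ i j → M T (λ l ys → g l (sh j x ∷ ys)) (sh i k) xs

M-cong : ∀ T {g h} k xs → (∀ l ys → g l ys ≡ h l ys) → M T g k xs ≡ M T h k xs
M-cong T k [] e = e k []
M-cong T k (x ∷ xs) e = comb-cong T λ i j → M-cong T (sh i k) xs (λ l ys → e l (sh j x ∷ ys))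

M-lin : ∀ T k xs a g h →
        M T (λ l ys → a * g l ys + h l ys) k xs ≡ a * M T g k xs + M T h k xs
M-lin T k [] a g h = refl
M-lin T k (x ∷ xs) a g h = trans
  (comb-cong T λ i j → M-lin T (sh i k) xs a _ _) (comb-lin T a _ _)

module M-Linear T k xs = Linear {ℤ × List ℤ} (λ f → M T (λ l ys → f (l , ys)) k xs)
  (λ e → M-cong T k xs (λ l ys → e (l , ys))) (λ a f g → M-lin T k xs a _ _)

M-comb : ∀ T k xs T' (g : Shift → Shift → ℤ → List ℤ → ℚ) →
         M T (λ l ys → comb T' (λ i j → g i j l ys)) k xs ≡ comb T' (λ i j → M T (g i j) k xs)
M-comb T k xs T' g = M-Linear.L-comb T k xs T' (λ i j (l , ys) → g i j l ys)

M-neg : ∀ T k xs g → M T (λ l ys → - g l ys) k xs ≡ - M T g k xs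
M-neg T k xs g = M-Linear.L-neg T k xs (λ (l , ys) → g l ys)

M-shift : ∀ T i g k xs → M T (λ l → g (sh i l)) k xs ≡ M T g (sh i k) xs
M-shift T i g k [] = refl
M-shift T i g k (x ∷ xs) = comb-cong T λ i' j →
  trans (M-shift T i (λ l ys → g l (sh j x ∷ ys)) (sh i' k) xs)
        (cong (λ l → M T _ l xs) (sh-comm i i' k))

-- Both operators are combinations of shifts, and shifts commute. Entry by entry, two finite
-- combinations are interchanged and `sh-comm` reorders the two shifts of x.
M-comm : ∀ T T' (g : ℤ → ℤ → List ℤ → ℚ) k k' xs →
         M T (λ l ys → M T' (g l) k' ys) k xs ≡ M T' (λ l' ys → M T (λ l → g l l') k ys) k' xs
M-comm T T' g k k' [] = refl
M-comm T T' g k k' (x ∷ xs) = begin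
  comb T (λ i j → M T (λ l ys → comb T' λ i' j' →
    M T' (λ l' zs → g l l' (sh j' (sh j x) ∷ zs)) (sh i' k') ys) (sh i k) xs)
    ≡⟨ comb-cong T (λ i j → M-comb T (sh i k) xs T' _) ⟩
  comb T (λ i j → comb T' (λ i' j' → M T (λ l ys →
    M T' (λ l' zs → g l l' (sh j' (sh j x) ∷ zs)) (sh i' k') ys) (sh i k) xs))
    ≡⟨ comb-cong T (λ i j → comb-cong T' (λ i' j' →
         M-comm T T' (λ l l' zs → g l l' (sh j' (sh j x) ∷ zs)) (sh i k) (sh i' k') xs)) ⟩
  comb T (λ i j → comb T' (λ i' j' → M T' (λ l' ys →
    M T (λ l zs → g l l' (sh j' (sh j x) ∷ zs)) (sh i k) ys) (sh i' k') xs))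
    ≡⟨ comb-swap T T' _ ⟩
  comb T' (λ i' j' → comb T (λ i j → M T' (λ l' ys →
    M T (λ l zs → g l l' (sh j' (sh j x) ∷ zs)) (sh i k) ys) (sh i' k') xs))
    ≡⟨ comb-cong T' (λ i' j' → comb-cong T (λ i j → cong
         (λ y → M T' (λ l' ys → M T (λ l zs → g l l' (y ∷ zs)) (sh i k) ys) (sh i' k') xs)
         (sh-comm j' j x))) ⟩
  comb T' (λ i' j' → comb T (λ i j → M T' (λ l' ys →
    M T (λ l zs → g l l' (sh j (sh j' x) ∷ zs)) (sh i k) ys) (sh i' k') xs))
    ≡⟨ comb-cong T' (λ i' j' → sym (M-comb T' (sh i' k') xs T _)) ⟩
  comb T' (λ i' j' → M T' (λ l' ys → comb T λ i j →
    M T (λ l zs → g l l' (sh j (sh j' x) ∷ zs)) (sh i k) ys) (sh i' k') xs) ∎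

-- id - Eₖ + Eₖ Eₓ
TR : Terms
TR = (1ℚ , st , st) ∷ (- 1ℚ , up , st) ∷ (1ℚ , up , up) ∷ []

-- The product of id - E_p + E_p E_q over all pairs p < q of positions. The factors that contain the
-- first position are applied to `f` first, those among later positions by the recursion.
P : (List ℤ → ℚ) → List ℤ → ℚ
P f [] = f []
P f (k ∷ ks) = P (λ ys → M TR (λ l zs → f (l ∷ zs)) k ys) ks

P-cong : ∀ {f g} xs → (∀ ys → f ys ≡ g ys) → P f xs ≡ P g xs
P-cong [] e = e []
P-cong (x ∷ xs) e = P-cong xs λ ys → M-cong TR x ys (λ l zs → e (l ∷ zs))

P-lin : ∀ xs a f g → P (λ ys → a * f ys + g ys) xs ≡ a * P f xs + P g xs
P-lin [] a f g = refl
P-lin (x ∷ xs) a f g = trans (P-cong xs λ ys → M-lin TR x ys a _ _) (P-lin xs a _ _)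

module P-Linear xs = Linear (λ f → P f xs) (P-cong xs) (P-lin xs)

-- A product that treats all entries alike commutes with every factor of `P`. For the first entry,
-- `M-shift` moves its shift outwards and `M-comm` exchanges the remaining operators.
P-M : ∀ T (g : ℤ → List ℤ → ℚ) k xs → P (M T g k) xs ≡ M T (λ l → P (g l)) k xs
P-M T g k [] = refl
P-M T g k (x ∷ xs) = begin
  P (λ ys → M TR (λ y zs → comb T λ i j → M T (λ l ws → g l (sh j y ∷ ws)) (sh i k) zs) x ys) xs
    ≡⟨ P-cong xs (λ ys → M-comb TR x ys T _) ⟩
  P (λ ys → comb T λ i j → M TR (λ y zs → M T (λ l ws → g l (sh j y ∷ ws)) (sh i k) zs) x ys) xs
    ≡⟨ P-Linear.L-comb xs T _ ⟩
  comb T (λ i j → P (λ ys → M TR (λ y zs → M T (λ l ws → g l (sh j y ∷ ws)) (sh i k) zs) x ys) xs)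
    ≡⟨ comb-cong T (λ i j → P-cong xs λ ys → begin
         M TR (λ y zs → M T (λ l ws → g l (sh j y ∷ ws)) (sh i k) zs) x ys
           ≡⟨ M-shift TR j (λ y zs → M T (λ l ws → g l (y ∷ ws)) (sh i k) zs) x ys ⟩
         M TR (λ y zs → M T (λ l ws → g l (y ∷ ws)) (sh i k) zs) (sh j x) ys
           ≡⟨ M-comm TR T (λ y l ws → g l (y ∷ ws)) (sh j x) (sh i k) ys ⟩
         M T (λ l zs → M TR (λ y ws → g l (y ∷ ws)) (sh j x) zs) (sh i k) ys ∎) ⟩
  comb T (λ i j → P (M T (λ l zs → M TR (λ y ws → g l (y ∷ ws)) (sh j x) zs) (sh i k)) xs)
    ≡⟨ comb-cong T (λ i j → P-M T _ (sh i k) xs) ⟩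
  comb T (λ i j → M T (λ l → P (λ zs → M TR (λ y ws → g l (y ∷ ws)) (sh j x) zs)) (sh i k) xs) ∎

-- Antisymmetric functions and their images under `P`

Alt : (List ℤ → ℚ) → Set
Alt f = ∀ pre a b suf → f (pre ++ a ∷ b ∷ suf) ≡ - f (pre ++ b ∷ a ∷ suf)

-- Every entry carries the same factor, so the operator is symmetric in the entries. When the first
-- two are swapped, this is the interchange of their two combinations.
M-Alt : ∀ T {g} → (∀ l → Alt (g l)) → ∀ k → Alt (M T g k)
M-Alt T {g} A k (x ∷ pre) a b suf = trans
  (comb-cong T λ i j → M-Alt T (λ l pre' → A l (sh j x ∷ pre')) (sh i k) pre a b suf)
  (comb-neg T _)
M-Alt T {g} A k [] a b suf = begin
  comb T (λ i j → comb T (λ i' j' → m (sh j a) (sh j' b) (sh i' (sh i k))))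
    ≡⟨ comb-swap T T _ ⟩
  comb T (λ i' j' → comb T (λ i j → m (sh j a) (sh j' b) (sh i' (sh i k))))
    ≡⟨ comb-cong T (λ i' j' → comb-cong T (λ i j → trans
         (M-cong T (sh i' (sh i k)) suf (λ l ys → A l [] (sh j a) (sh j' b) ys))
         (trans (M-neg T (sh i' (sh i k)) suf _)
                (cong (λ z → - m (sh j' b) (sh j a) z) (sh-comm i' i k))))) ⟩
  comb T (λ i' j' → comb T (λ i j → - m (sh j' b) (sh j a) (sh i (sh i' k))))
    ≡⟨ comb-cong T (λ i' j' → comb-neg T _) ⟩
  comb T (λ i' j' → - comb T (λ i j → m (sh j' b) (sh j a) (sh i (sh i' k))))
    ≡⟨ comb-neg T _ ⟩
  - comb T (λ i' j' → comb T (λ i j → m (sh j' b) (sh j a) (sh i (sh i' k)))) ∎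
  where
  m : ℤ → ℤ → ℤ → ℚ
  m a b l = M T (λ l ys → g l (a ∷ b ∷ ys)) l suf

x≡-x⇒x≡0 : ∀ {x} → x ≡ - x → x ≡ 0ℚ
x≡-x⇒x≡0 {x} e = begin
  x                ≡⟨ solve 1 (λ x → x := con ℚ.½ :* (x :+ x)) refl x ⟩
  ℚ.½ * (x + x)    ≡⟨ cong (λ y → ℚ.½ * (x + y)) e ⟩
  ℚ.½ * (x + - x)  ≡⟨ solve 1 (λ x → con ℚ.½ :* (x :+ :- x) := con 0ℚ) refl x ⟩
  0ℚ               ∎

-- The factors that join the first two entries to all later ones. Their product is symmetric in
-- these two entries, so antisymmetry is broken only by the factor joining the two to each other.
R₂ : (ℤ → ℤ → List ℤ → ℚ) → ℤ → ℤ → List ℤ → ℚ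
R₂ F a b = M TR (λ l zs → M TR (λ l' ws → F l' l ws) a zs) b

R₂-anti : ∀ F → (∀ a b ws → F a b ws ≡ - F b a ws) → ∀ a b ys → R₂ F a b ys ≡ - R₂ F b a ys
R₂-anti F A a b ys = begin
  M TR (λ l zs → M TR (λ l' ws → F l' l ws) a zs) b ys
    ≡⟨ M-comm TR TR (λ l l' ws → F l' l ws) b a ys ⟩
  M TR (λ l' zs → M TR (λ l ws → F l' l ws) b zs) a ys
    ≡⟨ M-cong TR a ys (λ l' zs → trans
         (M-cong TR b zs (λ l ws → A l' l ws)) (M-neg TR b zs (λ l ws → F l l' ws))) ⟩
  M TR (λ l' zs → - M TR (λ l ws → F l l' ws) b zs) a ys
    ≡⟨ M-neg TR a ys (λ l' zs → M TR (λ l ws → F l l' ws) b zs) ⟩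
  - R₂ F b a ys ∎

R₂-comb : ∀ F a b ys →
  M TR (λ l zs → comb TR (λ i j → M TR (λ l' ws → F l' (sh j l) ws) (sh i a) zs)) b ys ≡
  comb TR (λ i j → R₂ F (sh i a) (sh j b) ys)
R₂-comb F a b ys = trans
  (M-comb TR b ys TR (λ i j l → M TR (λ l' ws → F l' (sh j l) ws) (sh i a)))
  (comb-cong TR λ i j → M-shift TR j (λ l zs → M TR (λ l' ws → F l' l ws) (sh i a) zs) b ys)

P-comb : ∀ xs T (f : Shift → Shift → List ℤ → ℚ) →
         P (λ ys → comb T (λ i j → f i j ys)) xs ≡ comb T (λ i j → P (f i j) xs)
P-comb xs = P-Linear.L-comb xs

P-neg : ∀ xs f → P (λ ys → - f ys) xs ≡ - P f xs
P-neg xs = P-Linear.L-neg xs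

P-two : ∀ f a b ks →
  P f (a ∷ b ∷ ks) ≡ comb TR (λ i j → P (R₂ (λ x y ws → f (x ∷ y ∷ ws)) (sh i a) (sh j b)) ks)
P-two f a b ks = trans (P-cong ks (R₂-comb (λ x y ws → f (x ∷ y ∷ ws)) a b))
  (P-comb ks TR (λ i j → R₂ (λ x y ws → f (x ∷ y ∷ ws)) (sh i a) (sh j b)))

module Pair (f : List ℤ → ℚ) (A : Alt f) (ks : List ℤ) where

  Q : ℤ → ℤ → ℚ
  Q a b = P (R₂ (λ x y ws → f (x ∷ y ∷ ws)) a b) ks

  Q-comb : ∀ a b → P f (a ∷ b ∷ ks) ≡ comb TR (λ i j → Q (sh i a) (sh j b))
  Q-comb a b = P-two f a b ks

  Q-anti : ∀ a b → Q a b ≡ - Q b a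
  Q-anti a b = trans (P-cong ks (R₂-anti (λ x y ws → f (x ∷ y ∷ ws)) (A []) a b))
                     (P-neg ks (R₂ (λ x y ws → f (x ∷ y ∷ ws)) b a))

  Q-diag : ∀ a → Q a a ≡ 0ℚ
  Q-diag a = x≡-x⇒x≡0 (Q-anti a a)

-- With the antisymmetric `Q` of `Pair`, the value at (a, b) is Q(a, b) - Q(a + 1, b) + Q(a + 1, b +
-- 1). At (a, a) only -Q(a + 1, a) = Q(a, a + 1) survives, while (a, a + 1) gives Q(a, a + 1) + Q(a
-- + 1, a + 2).
P-pair : ∀ f → Alt f → ∀ a xs →
         P f (a ∷ a ∷ xs) + P f (ℤ.suc a ∷ ℤ.suc a ∷ xs) ≡ P f (a ∷ ℤ.suc a ∷ xs)
P-pair f A a xs = begin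
  P f (a ∷ a ∷ xs) + P f (b ∷ b ∷ xs)
    ≡⟨ cong₂ _+_ (Q-comb a a) (Q-comb b b) ⟩
  comb TR (λ i j → Q (sh i a) (sh j a)) + comb TR (λ i j → Q (sh i b) (sh j b))
    ≡⟨ solve 6 (λ aa ba bb bb' cb cc →
         (con 1ℚ :* aa :+ (con (- 1ℚ) :* ba :+ (con 1ℚ :* bb :+ con 0ℚ)))
         :+ (con 1ℚ :* bb :+ (con (- 1ℚ) :* cb :+ (con 1ℚ :* cc :+ con 0ℚ)))
         := aa :- ba :+ bb :+ (bb :- cb :+ cc)) refl
         (Q a a) (Q b a) (Q b b) 0ℚ (Q c b) (Q c c) ⟩
  Q a a - Q b a + Q b b + (Q b b - Q c b + Q c c)
    ≡⟨ cong₂ (λ x y → x + Q b b + y)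
         (cong₂ _-_ (Q-diag a) (Q-anti b a))
         (cong₂ (λ x y → x + y) (cong₂ _-_ (Q-diag b) (Q-anti c b)) (Q-diag c)) ⟩
  0ℚ - - Q a b + Q b b + (0ℚ - - Q b c + 0ℚ)
    ≡⟨ cong (λ x → 0ℚ - - Q a b + x + (0ℚ - - Q b c + 0ℚ)) (Q-diag b) ⟩
  0ℚ - - Q a b + 0ℚ + (0ℚ - - Q b c + 0ℚ)
    ≡⟨ solve 2 (λ ab bc → con 0ℚ :- (:- ab) :+ con 0ℚ :+ (con 0ℚ :- (:- bc) :+ con 0ℚ)
         := con 1ℚ :* ab :+ (con (- 1ℚ) :* con 0ℚ :+ (con 1ℚ :* bc :+ con 0ℚ))) refl (Q a b) (Q b c) ⟩
  1ℚ * Q a b + (- 1ℚ * 0ℚ + (1ℚ * Q b c + 0ℚ))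
    ≡⟨ cong (λ x → 1ℚ * Q a b + (- 1ℚ * x + (1ℚ * Q b c + 0ℚ))) (sym (Q-diag b)) ⟩
  comb TR (λ i j → Q (sh i a) (sh j b))
    ≡⟨ sym (Q-comb a b) ⟩
  P f (a ∷ b ∷ xs) ∎
  where
  open Pair f A xs
  b = ℤ.suc a
  c = ℤ.suc b

-- The same separation for three entries: `Q` absorbs all factors that involve a later entry and
-- stays antisymmetric; `Q-comb` applies the three factors among a, b, c.
module Triple (f : List ℤ → ℚ) (A : Alt f) (ks : List ℤ) where

  F : ℤ → ℤ → ℤ → List ℤ → ℚ
  F c a b ws = f (a ∷ b ∷ c ∷ ws)

  Q : ℤ → ℤ → ℤ → ℚ
  Q a b c = P (M TR (λ l → R₂ (F l) a b) c) ks

  Q-anti₁ : ∀ a b c → Q a b c ≡ - Q b a c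
  Q-anti₁ a b c = trans
    (P-cong ks λ ys → trans
      (M-cong TR c ys λ l zs → R₂-anti (F l) (λ a b ws → A [] a b (l ∷ ws)) a b zs)
      (M-neg TR c ys (λ l → R₂ (F l) b a)))
    (P-neg ks (M TR (λ l → R₂ (F l) b a) c))

  Q-anti₂ : ∀ a b c → Q a b c ≡ - Q a c b
  Q-anti₂ a b c = trans
    (P-cong ks (R₂-anti G (λ y z ws → trans
      (M-cong TR a ws λ x vs → A (x ∷ []) y z vs)
      (M-neg TR a ws (λ x vs → f (x ∷ z ∷ y ∷ vs)))) b c))
    (P-neg ks (R₂ G c b))
    where
    G : ℤ → ℤ → List ℤ → ℚ
    G y z = M TR (λ x vs → f (x ∷ y ∷ z ∷ vs)) a

  M-R₂ : ∀ a b l zs → R₂ (λ x y ws → f (x ∷ y ∷ ws)) a b (l ∷ zs) ≡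
        comb TR (λ i j → comb TR (λ i' j' → R₂ (F (sh j' (sh j l))) (sh i' a) (sh i b) zs))
  M-R₂ a b l zs = comb-cong TR λ i j →
    M-comb TR (sh i b) zs TR (λ i' j' y ws → M TR (λ x vs → F (sh j' (sh j l)) x y vs) (sh i' a) ws)

  Q-comb₃ : ∀ a b c → P (R₂ (λ x y ws → f (x ∷ y ∷ ws)) a b) (c ∷ ks) ≡
            comb TR (λ i j → comb TR (λ i' j' → Q (sh i' a) (sh i b) (sh j' (sh j c))))
  Q-comb₃ a b c = trans
    (P-cong ks λ ys → begin
      M TR (λ l zs → R₂ (λ x y ws → f (x ∷ y ∷ ws)) a b (l ∷ zs)) c ys
        ≡⟨ M-cong TR c ys (M-R₂ a b) ⟩
      M TR (λ l zs → comb TR (λ i j → comb TR (λ i' j' → g i j i' j' (sh j' (sh j l)) zs))) c ys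
        ≡⟨ M-comb TR c ys TR (λ i j l zs → comb TR (λ i' j' → g i j i' j' (sh j' (sh j l)) zs)) ⟩
      comb TR (λ i j → M TR (λ l zs → comb TR (λ i' j' → g i j i' j' (sh j' (sh j l)) zs)) c ys)
        ≡⟨ comb-cong TR (λ i j → M-comb TR c ys TR (λ i' j' l zs → g i j i' j' (sh j' (sh j l)) zs)) ⟩
      comb TR (λ i j → comb TR (λ i' j' → M TR (λ l → g i j i' j' (sh j' (sh j l))) c ys))
        ≡⟨ comb-cong TR (λ i j → comb-cong TR (λ i' j' → trans
             (M-shift TR j (λ l → g i j i' j' (sh j' l)) c ys)
             (M-shift TR j' (g i j i' j') (sh j c) ys))) ⟩
      comb TR (λ i j → comb TR (λ i' j' → M TR (g i j i' j') (sh j' (sh j c)) ys)) ∎)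
    (trans (P-comb ks TR (λ i j ys → comb TR (λ i' j' → M TR (g i j i' j') (sh j' (sh j c)) ys)))
      (comb-cong TR λ i j → P-comb ks TR (λ i' j' ys → M TR (g i j i' j') (sh j' (sh j c)) ys)))
    where
    g : Shift → Shift → Shift → Shift → ℤ → List ℤ → ℚ
    g i j i' j' l zs = R₂ (F l) (sh i' a) (sh i b) zs

  Q-comb : ∀ a b c → P f (a ∷ b ∷ c ∷ ks) ≡
           comb TR (λ i j → comb TR (λ i' j' → comb TR (λ i″ j″ →
             Q (sh i″ (sh i a)) (sh i' (sh j b)) (sh j″ (sh j' c)))))
  Q-comb a b c = trans (P-two f a b (c ∷ ks)) (comb-cong TR λ i j → Q-comb₃ (sh i a) (sh j b) c)

-- The antisymmetrisation of (1 - x + xy)(1 - x + xz)(1 - y + yz) vanishes.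
module _ (Q : ℤ → ℤ → ℤ → ℚ)
  (A₁ : ∀ a b c → Q a b c ≡ - Q b a c) (A₂ : ∀ a b c → Q a b c ≡ - Q a c b) where

  private
    rep₁ : ∀ x y → Q x x y ≡ 0ℚ
    rep₁ x y = x≡-x⇒x≡0 (A₁ x x y)

    rep₂ : ∀ x y → Q y x x ≡ 0ℚ
    rep₂ x y = x≡-x⇒x≡0 (A₂ y x x)

    rep₃ : ∀ x y → Q x y x ≡ 0ℚ
    rep₃ x y = trans (A₁ x y x) (cong -_ (rep₂ x y))

    cyc : ∀ x y z → Q y z x ≡ Q x y z
    cyc x y z = trans (A₂ y z x) (trans (cong -_ (A₁ y x z))
      (solve 1 (λ q → :- (:- q) := q) refl (Q x y z)))

    congTR : ∀ φ ψ → φ st st ≡ ψ st st → φ up st ≡ ψ up st → φ up up ≡ ψ up up →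
             comb TR φ ≡ comb TR ψ
    congTR φ ψ e₁ e₂ e₃ = cong₂ (λ x y → 1ℚ * x + y) e₁
      (cong₂ (λ x y → - 1ℚ * x + (1ℚ * y + 0ℚ)) e₂ e₃)

    -- At a shift of (a, a, a) by exponents in {0, 1, 2}, an antisymmetric function vanishes unless
    -- the exponents permute 0, 1, 2; the sign of the permutation selects `p` or `m`. The arbitrary
    -- codomain lets one table serve for rationals and for solver polynomials.
    table : {A : Set} → A → A → A → ℕ → ℕ → ℕ → A
    table z p m 0 1 2 = p
    table z p m 1 2 0 = p
    table z p m 2 0 1 = p
    table z p m 0 2 1 = m
    table z p m 1 0 2 = m
    table z p m 2 1 0 = m
    table z p m _ _ _ = z

    ♯ : Shift → ℕ
    ♯ dn = 0
    ♯ st = 0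
    ♯ up = 1

    combP : Terms → (Shift → Shift → Polynomial 1) → Polynomial 1
    combP [] φ = con 0ℚ
    combP ((c , i , j) ∷ T) φ = con c :* φ i j :+ combP T φ

    table-sum : ∀ q → comb TR (λ i j → comb TR (λ i' j' → comb TR (λ i″ j″ →
      table 0ℚ q (- q) (♯ i ℕ.+ ♯ i″) (♯ j ℕ.+ ♯ i') (♯ j' ℕ.+ ♯ j″)))) ≡ 0ℚ
    table-sum = solve 1 (λ q → combP TR (λ i j → combP TR (λ i' j' → combP TR (λ i″ j″ →
      table (con 0ℚ) q (:- q) (♯ i ℕ.+ ♯ i″) (♯ j ℕ.+ ♯ i') (♯ j' ℕ.+ ♯ j″)))) := con 0ℚ) refl

  triple-vanishes : ∀ a → comb TR (λ i j → comb TR (λ i' j' → comb TR (λ i″ j″ →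
    Q (sh i″ (sh i a)) (sh i' (sh j a)) (sh j″ (sh j' a))))) ≡ 0ℚ
  triple-vanishes a = trans
    (congTR (λ i j → comb TR (λ i' j' → comb TR (φ i j i' j')))
            (λ i j → comb TR (λ i' j' → comb TR (ψ i j i' j')))
      (congTR (λ i' j' → comb TR (φ st st i' j')) (λ i' j' → comb TR (ψ st st i' j'))
        (congTR (φ st st st st) (ψ st st st st) (rep₁ a a) (rep₂ a b) (rep₃ b a))
        (congTR (φ st st up st) (ψ st st up st) (rep₃ a b) (rep₁ b a) (rep₁ b b))
        (congTR (φ st st up up) (ψ st st up up) (rep₂ b a) (rep₁ b b) (rep₁ b c)))
      (congTR (λ i' j' → comb TR (φ up st i' j')) (λ i' j' → comb TR (ψ up st i' j'))
        (congTR (φ up st st st) (ψ up st st st) (rep₂ a b) (rep₂ a c) (sym (cyc c a b)))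
        (congTR (φ up st up st) (ψ up st up st) (rep₁ b a) (trans (A₁ c b a) (cong -_ (cyc a b c))) (rep₂ b c))
        (congTR (φ up st up up) (ψ up st up up) (rep₁ b b) (rep₂ b c) (rep₃ c b)))
      (congTR (λ i' j' → comb TR (φ up up i' j')) (λ i' j' → comb TR (ψ up up i' j'))
        (congTR (φ up up st st) (ψ up up st st) (rep₁ b a) (trans (A₁ c b a) (cong -_ (cyc a b c))) (rep₂ b c))
        (congTR (φ up up up st) (ψ up up up st) (cyc a b c) (rep₁ c a) (rep₁ c b))
        (congTR (φ up up up up) (ψ up up up up) (rep₃ b c) (rep₁ c b) (rep₁ c c))))
    (table-sum (Q a b c))
    where
    b = ℤ.suc a
    c = ℤ.suc b
    φ ψ : (i j i' j' i″ j″ : Shift) → ℚ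
    φ i j i' j' i″ j″ = Q (sh i″ (sh i a)) (sh i' (sh j a)) (sh j″ (sh j' a))
    ψ i j i' j' i″ j″ =
      table 0ℚ (Q a b c) (- Q a b c) (♯ i ℕ.+ ♯ i″) (♯ j ℕ.+ ♯ i') (♯ j' ℕ.+ ♯ j″)

P-triple : ∀ f → Alt f → ∀ a xs → P f (a ∷ a ∷ a ∷ xs) ≡ 0ℚ
P-triple f A a xs = trans (Q-comb a a a) (triple-vanishes Q Q-anti₁ Q-anti₂ a)
  where open Triple f A xs

-- Binomials, determinants and the Vandermonde product

/-eq : ∀ {a b r s} .{{_ : ℕ.NonZero r}} .{{_ : ℕ.NonZero s}} →
       a ℤ.* ℤ.+ s ≡ b ℤ.* ℤ.+ r → a ℚ./ r ≡ b ℚ./ s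
/-eq {a} {b} {suc r} {suc s} e = ℚ.fromℚᵘ-cong {ℚᵘ.mkℚᵘ a r} {ℚᵘ.mkℚᵘ b s} (ℚᵘ.*≡* e)

/-*-/ : ∀ a b r s .{{_ : ℕ.NonZero r}} .{{_ : ℕ.NonZero s}} .{{_ : ℕ.NonZero (r ℕ.* s)}} →
        (a ℚ./ r) * (b ℚ./ s) ≡ (a ℤ.* b) ℚ./ (r ℕ.* s)
/-*-/ a b (suc r) (suc s) = ℚ.toℚᵘ-injective (begin′
  ℚ.toℚᵘ ((a ℚ./ suc r) * (b ℚ./ suc s))             ≈⟨ ℚ.toℚᵘ-homo-* (a ℚ./ suc r) (b ℚ./ suc s) ⟩
  ℚ.toℚᵘ (a ℚ./ suc r) ℚᵘ.* ℚ.toℚᵘ (b ℚ./ suc s)      ≈⟨ ℚᵘ.*-cong (ℚ.toℚᵘ-fromℚᵘ (ℚᵘ.mkℚᵘ a r)) (ℚ.toℚᵘ-fromℚᵘ (ℚᵘ.mkℚᵘ b s)) ⟩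
  ℚᵘ.mkℚᵘ a r ℚᵘ.* ℚᵘ.mkℚᵘ b s                        ≈⟨ ℚ.toℚᵘ-fromℚᵘ (ℚᵘ.mkℚᵘ a r ℚᵘ.* ℚᵘ.mkℚᵘ b s) ⟨
  ℚ.toℚᵘ ((a ℤ.* b) ℚ./ (suc r ℕ.* suc s))           ∎′)
  where open ℚᵘ.≃-Reasoning renaming (begin_ to begin′_; _∎ to _∎′)

/-+-/ : ∀ a b r .{{_ : ℕ.NonZero r}} → (a ℚ./ r) + (b ℚ./ r) ≡ (a ℤ.+ b) ℚ./ r
/-+-/ a b (suc r) = ℚ.toℚᵘ-injective (begin′
  ℚ.toℚᵘ ((a ℚ./ suc r) + (b ℚ./ suc r))             ≈⟨ ℚ.toℚᵘ-homo-+ (a ℚ./ suc r) (b ℚ./ suc r) ⟩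
  ℚ.toℚᵘ (a ℚ./ suc r) ℚᵘ.+ ℚ.toℚᵘ (b ℚ./ suc r)      ≈⟨ ℚᵘ.+-cong (ℚ.toℚᵘ-fromℚᵘ (ℚᵘ.mkℚᵘ a r)) (ℚ.toℚᵘ-fromℚᵘ (ℚᵘ.mkℚᵘ b r)) ⟩
  ℚᵘ.mkℚᵘ a r ℚᵘ.+ ℚᵘ.mkℚᵘ b r                        ≈⟨ ℚᵘ.*≡* (ℤ-lemma a b (+ (suc r))) ⟩
  ℚᵘ.mkℚᵘ (a ℤ.+ b) r                                ≈⟨ ℚ.toℚᵘ-fromℚᵘ (ℚᵘ.mkℚᵘ (a ℤ.+ b) r) ⟨
  ℚ.toℚᵘ ((a ℤ.+ b) ℚ./ suc r)                       ∎′)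
  where
  open ℚᵘ.≃-Reasoning renaming (begin_ to begin′_; _∎ to _∎′)
  ℤ-lemma : ∀ a b r → (a ℤ.* r ℤ.+ b ℤ.* r) ℤ.* r ≡ (a ℤ.+ b) ℤ.* (r ℤ.* r)
  ℤ-lemma = ℤ.+-*-Solver.solve 3 (λ a b r → (a ℤ.+-*-Solver.:* r ℤ.+-*-Solver.:+ b ℤ.+-*-Solver.:* r) ℤ.+-*-Solver.:* r
    ℤ.+-*-Solver.:= (a ℤ.+-*-Solver.:+ b) ℤ.+-*-Solver.:* (r ℤ.+-*-Solver.:* r)) refl

fromℤ-+ : ∀ a b → fromℤ (a ℤ.+ b) ≡ fromℤ a + fromℤ b
fromℤ-+ a b = sym (/-+-/ a b 1)

fromℤ-* : ∀ a b → fromℤ (a ℤ.* b) ≡ fromℤ a * fromℤ b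
fromℤ-* a b = sym (/-*-/ a b 1 1)

fromℤ-neg : ∀ a → fromℤ (ℤ.- a) ≡ - fromℤ a
fromℤ-neg a = begin
  fromℤ (ℤ.- a)                           ≡⟨ solve 2 (λ x y → x := x :+ y :- y) refl (fromℤ (ℤ.- a)) (fromℤ a) ⟩
  fromℤ (ℤ.- a) + fromℤ a - fromℤ a       ≡⟨ cong (_- fromℤ a) (fromℤ-+ (ℤ.- a) a) ⟨
  fromℤ (ℤ.- a ℤ.+ a) - fromℤ a           ≡⟨ cong (λ z → fromℤ z - fromℤ a) (ℤ.+-inverseˡ a) ⟩
  0ℚ - fromℤ a                            ≡⟨ ℚ.+-identityˡ (- fromℤ a) ⟩
  - fromℤ a                               ∎

fromℤ-- : ∀ a b → fromℤ (a ℤ.- b) ≡ fromℤ a - fromℤ b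
fromℤ-- a b = trans (fromℤ-+ a (ℤ.- b)) (cong (λ z → fromℤ a + z) (fromℤ-neg b))

inv : ℕ → ℚ
inv m = ℤ.1ℤ ℚ./ suc m

/≡inv : ∀ a m → a ℚ./ suc m ≡ inv m * fromℤ a
/≡inv a m = sym (trans (/-*-/ ℤ.1ℤ a (suc m) 1)
  (/-eq {ℤ.1ℤ ℤ.* a} {a} {suc m ℕ.* 1} {suc m}
    (cong₂ ℤ._*_ (ℤ.*-identityˡ a) (cong +_ (sym (ℕ.*-identityʳ (suc m)))))))

absorption : ∀ x m → binomial x (suc m) ≡ inv m * (fromℤ (x ℤ.- + m) * binomial x m)
absorption x m = sym (begin
  inv m * (fromℤ y * (f ℚ./ (m !)))
    ≡⟨ cong (inv m *_) (/-*-/ y f 1 (m !)) ⟩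
  inv m * ((y ℤ.* f) ℚ./ (1 ℕ.* m !))
    ≡⟨ /-*-/ ℤ.1ℤ (y ℤ.* f) (suc m) (1 ℕ.* m !) ⟩
  (ℤ.1ℤ ℤ.* (y ℤ.* f)) ℚ./ (suc m ℕ.* (1 ℕ.* m !))
    ≡⟨ /-eq {ℤ.1ℤ ℤ.* (y ℤ.* f)} {f ℤ.* y} (cong₂ ℤ._*_
         (trans (ℤ.*-identityˡ _) (ℤ.*-comm y f))
         (cong (λ d → + (suc m ℕ.* d)) (sym (ℕ.*-identityˡ (m !))))) ⟩
  (f ℤ.* y) ℚ./ (suc m !) ∎)
  where
  y = x ℤ.- + m
  f = fallingFactorial x m
  instance
    _ : ℕ.NonZero (m !)
    _ = m ℕ.!≢0
    _ : ℕ.NonZero (1 ℕ.* m !)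
    _ = ℕ.m*n≢0 1 (m !)
    _ : ℕ.NonZero (suc m ℕ.* (1 ℕ.* m !))
    _ = ℕ.m*n≢0 (suc m) (1 ℕ.* m !)
    _ : ℕ.NonZero (suc m !)
    _ = suc m ℕ.!≢0

inv-cancel : ∀ m → inv m * fromℤ (+ (suc m)) ≡ 1ℚ
inv-cancel m = trans (sym (/≡inv (+ (suc m)) m))
  (/-eq {+ (suc m)} {ℤ.1ℤ} {suc m} {1} (ℤ.*-comm (+ (suc m)) ℤ.1ℤ))

pascal : ∀ x m → binomial (ℤ.suc x) (suc m) ≡ binomial x (suc m) + binomial x m
pascal x zero = begin
  binomial (ℤ.suc x) 1      ≡⟨ absorption (ℤ.suc x) 0 ⟩
  inv 0 * (fromℤ (ℤ.suc x ℤ.- + 0) * 1ℚ) ≡⟨ cong (λ z → inv 0 * (z * 1ℚ)) (trans (fromℤ-- (ℤ.suc x) (+ 0)) (cong (_- fromℤ (+ 0)) (fromℤ-+ ℤ.1ℤ x))) ⟩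
  inv 0 * ((1ℚ + fromℤ x - 0ℚ) * 1ℚ)
    ≡⟨ solve 1 (λ x → con 1ℚ :* ((con 1ℚ :+ x :- con 0ℚ) :* con 1ℚ) := con 1ℚ :* ((x :- con 0ℚ) :* con 1ℚ) :+ con 1ℚ) refl (fromℤ x) ⟩
  inv 0 * ((fromℤ x - 0ℚ) * 1ℚ) + 1ℚ
    ≡⟨ cong (λ z → inv 0 * (z * 1ℚ) + 1ℚ) (sym (fromℤ-- x (+ 0))) ⟩
  inv 0 * (fromℤ (x ℤ.- + 0) * 1ℚ) + 1ℚ ≡⟨ cong (_+ 1ℚ) (sym (absorption x 0)) ⟩
  binomial x 1 + 1ℚ ∎
pascal x (suc m) = begin
  binomial (ℤ.suc x) (suc (suc m))
    ≡⟨ absorption (ℤ.suc x) (suc m) ⟩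
  i′ * (fromℤ (ℤ.suc x ℤ.- + (suc m)) * binomial (ℤ.suc x) (suc m))
    ≡⟨ cong₂ (λ u v → i′ * (u * v)) e₁ (trans (pascal x m) (cong (_+ b) (trans (absorption x m) (cong (λ z → i * (z * b)) e₀)))) ⟩
  i′ * ((X - μ) * (i * ((X - μ) * b) + b))
    -- The summand with the factor 1 - i (1 + μ) makes this an identity in free variables; it is
    -- zero because `i` is the inverse of m + 1.
    ≡⟨ solve 5 (λ i′ X μ i b → i′ :* ((X :- μ) :* (i :* ((X :- μ) :* b) :+ b))
         := i′ :* ((X :- (con 1ℚ :+ μ)) :* (i :* ((X :- μ) :* b)))
            :+ i′ :* ((con 1ℚ :+ (con 1ℚ :+ μ)) :* (i :* ((X :- μ) :* b)))
            :+ i′ :* ((X :- μ) :* b) :* (con 1ℚ :- i :* (con 1ℚ :+ μ))) refl i′ X μ i b ⟩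
  i′ * ((X - (1ℚ + μ)) * (i * ((X - μ) * b))) + i′ * ((1ℚ + (1ℚ + μ)) * (i * ((X - μ) * b)))
    + i′ * ((X - μ) * b) * (1ℚ - i * (1ℚ + μ))
    ≡⟨ cong (λ z → i′ * ((X - (1ℚ + μ)) * (i * ((X - μ) * b))) + i′ * ((1ℚ + (1ℚ + μ)) * (i * ((X - μ) * b))) + i′ * ((X - μ) * b) * (1ℚ - z))
         (trans (cong (i *_) (sym e₂)) (inv-cancel m)) ⟩
  i′ * ((X - (1ℚ + μ)) * (i * ((X - μ) * b))) + i′ * ((1ℚ + (1ℚ + μ)) * (i * ((X - μ) * b)))
    + i′ * ((X - μ) * b) * (1ℚ - 1ℚ)
    ≡⟨ solve 5 (λ i′ X μ i b → i′ :* ((X :- (con 1ℚ :+ μ)) :* (i :* ((X :- μ) :* b)))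
            :+ i′ :* ((con 1ℚ :+ (con 1ℚ :+ μ)) :* (i :* ((X :- μ) :* b)))
            :+ i′ :* ((X :- μ) :* b) :* (con 1ℚ :- con 1ℚ)
         := i′ :* ((X :- (con 1ℚ :+ μ)) :* (i :* ((X :- μ) :* b)))
            :+ (i′ :* (con 1ℚ :+ (con 1ℚ :+ μ))) :* (i :* ((X :- μ) :* b))) refl i′ X μ i b ⟩
  i′ * ((X - (1ℚ + μ)) * (i * ((X - μ) * b))) + (i′ * (1ℚ + (1ℚ + μ))) * (i * ((X - μ) * b))
    ≡⟨ cong₂ (λ u v → i′ * ((X - (1ℚ + μ)) * u) + v * u)
         (sym (trans (absorption x m) (cong (λ z → i * (z * b)) e₀)))
         (trans (cong (i′ *_) (sym e₃)) (inv-cancel (suc m))) ⟩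
  i′ * ((X - (1ℚ + μ)) * binomial x (suc m)) + 1ℚ * binomial x (suc m)
    ≡⟨ cong₂ _+_ (sym (trans (absorption x (suc m)) (cong (λ z → i′ * (z * binomial x (suc m))) e₄)))
         (ℚ.*-identityˡ (binomial x (suc m))) ⟩
  binomial x (suc (suc m)) + binomial x (suc m) ∎
  where
  i′ = inv (suc m)
  i = inv m
  X = fromℤ x
  μ = fromℤ (+ m)
  b = binomial x m
  e₀ : fromℤ (x ℤ.- + m) ≡ X - μ
  e₀ = fromℤ-- x (+ m)
  e₂ : fromℤ (+ (suc m)) ≡ 1ℚ + μ
  e₂ = fromℤ-+ ℤ.1ℤ (+ m)
  e₃ : fromℤ (+ (suc (suc m))) ≡ 1ℚ + (1ℚ + μ)
  e₃ = trans (fromℤ-+ ℤ.1ℤ (+ (suc m))) (cong (λ z → 1ℚ + z) e₂)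
  e₁ : fromℤ (ℤ.suc x ℤ.- + (suc m)) ≡ X - μ
  e₁ = trans (fromℤ-- (ℤ.suc x) (+ (suc m))) (trans (cong₂ _-_ (fromℤ-+ ℤ.1ℤ x) e₂)
    (solve 2 (λ x y → con 1ℚ :+ x :- (con 1ℚ :+ y) := x :- y) refl X μ))
  e₄ : fromℤ (x ℤ.- + (suc m)) ≡ X - (1ℚ + μ)
  e₄ = trans (fromℤ-- x (+ (suc m))) (cong (λ z → X - z) e₂)

-- Determinants of functions evaluated at points

Fun : Set
Fun = ℤ → ℚ

-- Expansion along the row of x. The argument `g` is the minor as a function of the remaining
-- columns; the recursion puts each column passed back into it, and the subtraction produces the
-- alternating signs.
laplace : (List Fun → ℚ) → ℤ → List Fun → ℚ
laplace g x [] = 0ℚ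
laplace g x (f ∷ fs) = f x * g fs - laplace (λ hs → g (f ∷ hs)) x fs

Det : List Fun → List ℤ → ℚ
Det [] [] = 1ℚ
Det (_ ∷ _) [] = 0ℚ
Det fs (x ∷ xs) = laplace (λ hs → Det hs xs) x fs

laplace-cong : ∀ {g h} x fs → (∀ hs → g hs ≡ h hs) → laplace g x fs ≡ laplace h x fs
laplace-cong x [] e = refl
laplace-cong x (f ∷ fs) e = cong₂ (λ u v → f x * u - v) (e fs) (laplace-cong x fs (λ hs → e (f ∷ hs)))

laplace-lin : ∀ x fs a g h →
  laplace (λ hs → a * g hs + h hs) x fs ≡ a * laplace g x fs + laplace h x fs
laplace-lin x [] a g h = solve 1 (λ a → con 0ℚ := a :* con 0ℚ :+ con 0ℚ) refl a
laplace-lin x (f ∷ fs) a g h = trans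
  (cong (λ z → f x * (a * g fs + h fs) - z) (laplace-lin x fs a (λ hs → g (f ∷ hs)) (λ hs → h (f ∷ hs))))
  (solve 6 (λ f a g h G H → f :* (a :* g :+ h) :- (a :* G :+ H) := a :* (f :* g :- G) :+ (f :* h :- H))
    refl (f x) a (g fs) (h fs) (laplace (λ hs → g (f ∷ hs)) x fs) (laplace (λ hs → h (f ∷ hs)) x fs))

module laplace-Linear x fs = Linear (λ g → laplace g x fs) (laplace-cong x fs) (laplace-lin x fs)

Multilinear Alternating Extensional : (List Fun → ℚ) → Set
Multilinear g = ∀ pre a f h post →
  g (pre ++ (λ x → a * f x + h x) ∷ post) ≡ a * g (pre ++ f ∷ post) + g (pre ++ h ∷ post)
Alternating g = ∀ pre f post → g (pre ++ f ∷ f ∷ post) ≡ 0ℚ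
Extensional g = ∀ {fs hs} → Pointwise _≗_ fs hs → g fs ≡ g hs

laplace-multilinear : ∀ g → Multilinear g → ∀ x → Multilinear (laplace g x)
laplace-multilinear g L x [] a f h post = trans
  (cong (λ z → (a * f x + h x) * g post - z)
    (trans (laplace-cong x post (λ hs → L [] a f h hs))
           (laplace-lin x post a (λ hs → g (f ∷ hs)) (λ hs → g (h ∷ hs)))))
  (solve 6 (λ a f h g F H → (a :* f :+ h) :* g :- (a :* F :+ H) := a :* (f :* g :- F) :+ (h :* g :- H))
    refl a (f x) (h x) (g post) (laplace (λ hs → g (f ∷ hs)) x post) (laplace (λ hs → g (h ∷ hs)) x post))
laplace-multilinear g L x (p ∷ pre) a f h post = trans
  (cong₂ (λ u v → p x * u - v) (L pre a f h post)
         (laplace-multilinear (λ hs → g (p ∷ hs)) (λ pre' → L (p ∷ pre')) x pre a f h post))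
  (solve 6 (λ p a F H F′ H′ → p :* (a :* F :+ H) :- (a :* F′ :+ H′) := a :* (p :* F :- F′) :+ (p :* H :- H′))
    refl (p x) a (g (pre ++ f ∷ post)) (g (pre ++ h ∷ post))
    (laplace (λ hs → g (p ∷ hs)) x (pre ++ f ∷ post)) (laplace (λ hs → g (p ∷ hs)) x (pre ++ h ∷ post)))

laplace-alternating : ∀ g → Alternating g → ∀ x → Alternating (laplace g x)
laplace-alternating g A x [] f post = trans
  (cong (λ z → f x * g (f ∷ post) - (f x * g (f ∷ post) - z))
    (trans (laplace-cong x post (λ hs → A [] f hs)) (laplace-Linear.L-zero x post)))
  (solve 1 (λ y → y :- (y :- con 0ℚ) := con 0ℚ) refl (f x * g (f ∷ post)))
laplace-alternating g A x (p ∷ pre) f post = trans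
  (cong₂ (λ u v → p x * u - v) (A pre f post) (laplace-alternating (λ hs → g (p ∷ hs)) (λ pre' → A (p ∷ pre')) x pre f post))
  (solve 1 (λ y → y :* con 0ℚ :- con 0ℚ := con 0ℚ) refl (p x))

laplace-extensional : ∀ g → Extensional g → ∀ x → Extensional (laplace g x)
laplace-extensional g E x [] = refl
laplace-extensional g E x {f ∷ fs} {h ∷ hs} (e ∷ es) = cong₂ _-_
  (cong₂ _*_ (e x) (E es))
  (trans (laplace-cong x fs (λ ks → E (e ∷ Pointwise.refl (λ _ → refl))))
         (laplace-extensional (λ ks → g (h ∷ ks)) (λ es' → E ((λ _ → refl) ∷ es')) x es))

Det-multilinear : ∀ xs → Multilinear (λ fs → Det fs xs)
Det-multilinear [] [] a f h post = solve 1 (λ a → con 0ℚ := a :* con 0ℚ :+ con 0ℚ) refl a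
Det-multilinear [] (_ ∷ _) a f h post = solve 1 (λ a → con 0ℚ := a :* con 0ℚ :+ con 0ℚ) refl a
Det-multilinear (x ∷ xs) [] a f h post =
  laplace-multilinear (λ hs → Det hs xs) (Det-multilinear xs) x [] a f h post
Det-multilinear (x ∷ xs) (p ∷ pre) a f h post =
  laplace-multilinear (λ hs → Det hs xs) (Det-multilinear xs) x (p ∷ pre) a f h post

Det-alternating : ∀ xs → Alternating (λ fs → Det fs xs)
Det-alternating [] [] f post = refl
Det-alternating [] (_ ∷ _) f post = refl
Det-alternating (x ∷ xs) [] f post = laplace-alternating (λ hs → Det hs xs) (Det-alternating xs) x [] f post
Det-alternating (x ∷ xs) (p ∷ pre) f post = laplace-alternating (λ hs → Det hs xs) (Det-alternating xs) x (p ∷ pre) f post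

Det-extensional : ∀ xs → Extensional (λ fs → Det fs xs)
Det-extensional [] [] = refl
Det-extensional [] (_ ∷ _) = refl
Det-extensional (x ∷ xs) [] = refl
Det-extensional (x ∷ xs) (e ∷ es) = laplace-extensional (λ hs → Det hs xs) (Det-extensional xs) x (e ∷ es)

column-ops : (ℕ → ℚ) → ℕ → Fun → List Fun → List Fun
column-ops w m f [] = []
column-ops w m f (h ∷ hs) = (λ x → w m * f x + h x) ∷ column-ops w (suc m) h hs

-- Each column receives a multiple of its unmodified left neighbour. Undoing the additions from left
-- to right, that neighbour already stands there in its original form, and alternation removes the
-- extra term.
column-ops-invariant : ∀ g → Multilinear g → Alternating g → ∀ w m f fs →
                       g (f ∷ column-ops w m f fs) ≡ g (f ∷ fs)
column-ops-invariant g L A w m f [] = refl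
column-ops-invariant g L A w m f (h ∷ hs) = begin
  g (f ∷ (λ x → w m * f x + h x) ∷ column-ops w (suc m) h hs)
    ≡⟨ L (f ∷ []) (w m) f h (column-ops w (suc m) h hs) ⟩
  w m * g (f ∷ f ∷ column-ops w (suc m) h hs) + g (f ∷ h ∷ column-ops w (suc m) h hs)
    ≡⟨ cong₂ (λ u v → w m * u + v) (A [] f (column-ops w (suc m) h hs))
         (column-ops-invariant (λ ks → g (f ∷ ks)) (λ pre → L (f ∷ pre)) (λ pre → A (f ∷ pre)) w (suc m) h hs) ⟩
  w m * 0ℚ + g (f ∷ h ∷ hs)
    ≡⟨ solve 2 (λ w g → w :* con 0ℚ :+ g := g) refl (w m) (g (f ∷ h ∷ hs)) ⟩
  g (f ∷ h ∷ hs) ∎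

-- The Vandermonde product as a determinant of binomials

quotients : ℕ → ℤ → List ℤ → ℚ
quotients d k [] = 1ℚ
quotients d k (x ∷ xs) = ((x ℤ.- k) ℚ./ suc d) * quotients (suc d) k xs

-- ∏_{i<j} (xⱼ - xᵢ) / (j - i)
W : List ℤ → ℚ
W [] = 1ℚ
W (k ∷ ks) = quotients 0 k ks * W ks

invs : ℕ → ℕ → ℚ
invs d zero = 1ℚ
invs d (suc n) = inv d * invs (suc d) n

differences : ℤ → List ℤ → ℚ
differences k [] = 1ℚ
differences k (x ∷ xs) = fromℤ (x ℤ.- k) * differences k xs

quotients≡ : ∀ d k xs → quotients d k xs ≡ invs d (length xs) * differences k xs
quotients≡ d k [] = refl
quotients≡ d k (x ∷ xs) = trans
  (cong₂ _*_ (/≡inv (x ℤ.- k) d) (quotients≡ (suc d) k xs))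
  (solve 4 (λ a b c d → (a :* b) :* (c :* d) := (a :* c) :* (b :* d)) refl
    (inv d) (fromℤ (x ℤ.- k)) (invs (suc d) (length xs)) (differences k xs))

binomials : ℕ → ℕ → List Fun
binomials m zero = []
binomials m (suc n) = (λ x → binomial x m) ∷ binomials (suc m) n

scale-entries : (ℤ → ℚ) → List Fun → List Fun
scale-entries q = map (λ f x → q x * f x)

laplace-scale : ∀ q c x g h → (∀ hs → g (scale-entries q hs) ≡ c * h hs) → ∀ fs →
                laplace g x (scale-entries q fs) ≡ q x * c * laplace h x fs
laplace-scale q c x g h e [] = solve 2 (λ q c → con 0ℚ := q :* c :* con 0ℚ) refl (q x) c
laplace-scale q c x g h e (f ∷ fs) = trans
  (cong₂ (λ u v → q x * f x * u - v) (e fs)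
    (laplace-scale q c x (λ hs → g ((λ x → q x * f x) ∷ hs)) (λ hs → h (f ∷ hs)) (λ hs → e (f ∷ hs)) fs))
  (solve 5 (λ q c f h H → q :* f :* (c :* h) :- q :* c :* H := q :* c :* (f :* h :- H)) refl
    (q x) c (f x) (h fs) (laplace (λ hs → h (f ∷ hs)) x fs))

∏ : (ℤ → ℚ) → List ℤ → ℚ
∏ q [] = 1ℚ
∏ q (x ∷ xs) = q x * ∏ q xs

Det-scale : ∀ q xs fs → Det (scale-entries q fs) xs ≡ ∏ q xs * Det fs xs
Det-scale q [] [] = refl
Det-scale q [] (_ ∷ _) = refl
Det-scale q (x ∷ xs) [] = solve 1 (λ p → con 0ℚ := p :* con 0ℚ) refl (q x * ∏ q xs)
Det-scale q (x ∷ xs) (f ∷ fs) =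
  laplace-scale q (∏ q xs) x (λ hs → Det hs xs) (λ hs → Det hs xs) (Det-scale q xs) (f ∷ fs)

scale-columns : ℕ → List Fun → List Fun
scale-columns d [] = []
scale-columns d (f ∷ fs) = (λ x → inv d * f x) ∷ scale-columns (suc d) fs

scale-columns-invs : ∀ g → Multilinear g → Extensional g → ∀ d fs →
                     g (scale-columns d fs) ≡ invs d (length fs) * g fs
scale-columns-invs g L E d [] = sym (ℚ.*-identityˡ (g []))
scale-columns-invs g L E d (f ∷ fs) = begin
  g ((λ x → inv d * f x) ∷ scale-columns (suc d) fs)
    ≡⟨ L-scale (inv d) f ⟩
  inv d * g (f ∷ scale-columns (suc d) fs)
    ≡⟨ cong (inv d *_) (scale-columns-invs (λ hs → g (f ∷ hs)) (λ pre → L (f ∷ pre))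
         (λ es → E ((λ _ → refl) ∷ es)) (suc d) fs) ⟩
  inv d * (invs (suc d) (length fs) * g (f ∷ fs))
    ≡⟨ ℚ.*-assoc (inv d) (invs (suc d) (length fs)) (g (f ∷ fs)) ⟨
  inv d * invs (suc d) (length fs) * g (f ∷ fs) ∎
  where open Linear {ℤ} (λ h → g (h ∷ scale-columns (suc d) fs))
                    (λ e → E (e ∷ Pointwise.refl (λ _ → refl))) (λ a f h → L [] a f h _)

laplace-zero-columns : ∀ k fs → Pointwise (λ f _ → f k ≡ 0ℚ) fs fs → ∀ g → laplace g k fs ≡ 0ℚ
laplace-zero-columns k [] [] g = refl
laplace-zero-columns k (f ∷ fs) (e ∷ es) g = trans
  (cong₂ (λ u v → u * g fs - v) e (laplace-zero-columns k fs es (λ hs → g (f ∷ hs))))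
  (solve 1 (λ g → con 0ℚ :* g :- con 0ℚ := con 0ℚ) refl (g fs))

length-binomials : ∀ m n → length (binomials m n) ≡ n
length-binomials m zero = refl
length-binomials m (suc n) = cong suc (length-binomials (suc m) n)

module Vandermonde (k : ℤ) where

  w : ℕ → ℚ
  w m = inv m * fromℤ (+ m ℤ.- k)

  -- The weight cancels the value of C(x, m + 1) at x = k, since C(k, m + 1) = (k - m)/(m + 1) C(k,
  -- m). What remains is divisible by x - k, with a cofactor that is again a multiple of C(x, m).
  w-absorption : ∀ m x → w m * binomial x m + binomial x (suc m) ≡ inv m * (fromℤ (x ℤ.- k) * binomial x m)
  w-absorption m x = begin
    inv m * fromℤ (+ m ℤ.- k) * b + binomial x (suc m)
      ≡⟨ cong₂ (λ u v → inv m * u * b + v) (fromℤ-- (+ m) k)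
           (trans (absorption x m) (cong (λ z → inv m * (z * b)) (fromℤ-- x (+ m)))) ⟩
    inv m * (fromℤ (+ m) - fromℤ k) * b + inv m * ((fromℤ x - fromℤ (+ m)) * b)
      ≡⟨ solve 5 (λ i m k x b → i :* (m :- k) :* b :+ i :* ((x :- m) :* b) := i :* ((x :- k) :* b)) refl
           (inv m) (fromℤ (+ m)) (fromℤ k) (fromℤ x) b ⟩
    inv m * ((fromℤ x - fromℤ k) * b)
      ≡⟨ cong (λ z → inv m * (z * b)) (sym (fromℤ-- x k)) ⟩
    inv m * (fromℤ (x ℤ.- k) * b) ∎
    where b = binomial x m

  q : ℤ → ℚ
  q x = fromℤ (x ℤ.- k)

  reduced : ℕ → ℕ → List Fun
  reduced m n = scale-columns m (scale-entries q (binomials m n))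

  column-ops≗ : ∀ m n → Pointwise _≗_ (reduced m n)
    (column-ops w m (λ x → binomial x m) (binomials (suc m) n))
  column-ops≗ m zero = []
  column-ops≗ m (suc n) = (λ x → sym (w-absorption m x)) ∷ column-ops≗ (suc m) n

  reduced-vanish : ∀ m n → Pointwise (λ f _ → f k ≡ 0ℚ) (reduced m n) (reduced m n)
  reduced-vanish m zero = []
  reduced-vanish m (suc n) = trans
    (cong (λ z → inv m * (fromℤ z * binomial k m)) (ℤ.+-inverseʳ k))
    (solve 2 (λ i b → i :* (con 0ℚ :* b) := con 0ℚ) refl (inv m) (binomial k m)) ∷ reduced-vanish (suc m) n

  ∏≡ : ∀ xs → ∏ q xs ≡ differences k xs
  ∏≡ [] = refl
  ∏≡ (x ∷ xs) = cong (q x *_) (∏≡ xs)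

-- After the column operations the row of k is (1, 0, ..., 0). The remaining minor has a factor x -
-- k in each row and 1/(m + 1) in each column; without them it is the determinant for the tail.
W≡Det : ∀ xs → W xs ≡ Det (binomials 0 (length xs)) xs
W≡Det [] = refl
W≡Det (k ∷ xs) = sym (begin
  Det ((λ x → binomial x 0) ∷ binomials 1 n) (k ∷ xs)
    ≡⟨ column-ops-invariant (λ hs → Det hs (k ∷ xs)) (Det-multilinear (k ∷ xs)) (Det-alternating (k ∷ xs))
         w 0 (λ x → binomial x 0) (binomials 1 n) ⟨
  Det ((λ x → binomial x 0) ∷ column-ops w 0 (λ x → binomial x 0) (binomials 1 n)) (k ∷ xs)
    ≡⟨ Det-extensional (k ∷ xs) {(λ x → binomial x 0) ∷ reduced 0 n} ((λ _ → refl) ∷ column-ops≗ 0 n) ⟨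
  1ℚ * Det (reduced 0 n) xs - laplace (λ hs → Det ((λ x → binomial x 0) ∷ hs) xs) k (reduced 0 n)
    ≡⟨ cong₂ (λ u v → 1ℚ * u - v) e
         (laplace-zero-columns k (reduced 0 n) (reduced-vanish 0 n) (λ hs → Det ((λ x → binomial x 0) ∷ hs) xs)) ⟩
  1ℚ * (invs 0 n * (differences k xs * W xs)) - 0ℚ
    ≡⟨ solve 3 (λ i d w → con 1ℚ :* (i :* (d :* w)) :- con 0ℚ := i :* d :* w) refl
         (invs 0 n) (differences k xs) (W xs) ⟩
  invs 0 n * differences k xs * W xs
    ≡⟨ cong (_* W xs) (quotients≡ 0 k xs) ⟨
  quotients 0 k xs * W xs ∎)
  where
  open Vandermonde k
  n = length xs
  e : Det (reduced 0 n) xs ≡ invs 0 n * (differences k xs * W xs)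
  e = begin
    Det (reduced 0 n) xs
      ≡⟨ scale-columns-invs (λ hs → Det hs xs) (Det-multilinear xs) (Det-extensional xs) 0 (scale-entries q (binomials 0 n)) ⟩
    invs 0 (length (scale-entries q (binomials 0 n))) * Det (scale-entries q (binomials 0 n)) xs
      ≡⟨ cong₂ (λ u v → invs 0 u * v)
           (trans (List.length-map _ (binomials 0 n)) (length-binomials 0 n))
           (trans (Det-scale q xs (binomials 0 n)) (cong₂ _*_ (∏≡ xs) (sym (W≡Det xs)))) ⟩
    invs 0 n * (differences k xs * W xs) ∎

-- Denominators belong to positions and numerators to entries, so the product as a whole does not
-- see the order of the entries.
quotients-swap : ∀ d k pre a b suf →
                 quotients d k (pre ++ a ∷ b ∷ suf) ≡ quotients d k (pre ++ b ∷ a ∷ suf)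
quotients-swap d k (x ∷ pre) a b suf =
  cong (((x ℤ.- k) ℚ./ suc d) *_) (quotients-swap (suc d) k pre a b suf)
quotients-swap d k [] a b suf = begin
  quotients d k (a ∷ b ∷ suf)
    ≡⟨ quotients≡ d k (a ∷ b ∷ suf) ⟩
  invs d (length (a ∷ b ∷ suf)) * (fromℤ (a ℤ.- k) * (fromℤ (b ℤ.- k) * differences k suf))
    ≡⟨ solve 4 (λ i a b d → i :* (a :* (b :* d)) := i :* (b :* (a :* d))) refl
         (invs d (length (a ∷ b ∷ suf))) (fromℤ (a ℤ.- k)) (fromℤ (b ℤ.- k)) (differences k suf) ⟩
  invs d (length (b ∷ a ∷ suf)) * (fromℤ (b ℤ.- k) * (fromℤ (a ℤ.- k) * differences k suf))
    ≡⟨ quotients≡ d k (b ∷ a ∷ suf) ⟨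
  quotients d k (b ∷ a ∷ suf) ∎

W-Alt : Alt W
W-Alt (x ∷ pre) a b suf = trans
  (cong₂ _*_ (quotients-swap 0 x pre a b suf) (W-Alt pre a b suf))
  (solve 2 (λ p q → p :* (:- q) := :- (p :* q)) refl (quotients 0 x (pre ++ b ∷ a ∷ suf)) (W (pre ++ b ∷ a ∷ suf)))
W-Alt [] a b suf = begin
  ((b ℤ.- a) ℚ./ 1) * quotients 1 a suf * (quotients 0 b suf * W suf)
    ≡⟨ cong₂ (λ u v → fromℤ (b ℤ.- a) * u * (v * W suf)) (quotients≡ 1 a suf) (quotients≡ 0 b suf) ⟩
  fromℤ (b ℤ.- a) * (i₁ * da) * (i₀ * db * W suf)
    ≡⟨ cong (λ z → z * (i₁ * da) * (i₀ * db * W suf)) (fromℤ-- b a) ⟩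
  (fromℤ b - fromℤ a) * (i₁ * da) * (i₀ * db * W suf)
    ≡⟨ solve 7 (λ a b i₁ i₀ da db w → (b :- a) :* (i₁ :* da) :* (i₀ :* db :* w)
         := :- ((a :- b) :* (i₁ :* db) :* (i₀ :* da :* w))) refl (fromℤ a) (fromℤ b) i₁ i₀ da db (W suf) ⟩
  - ((fromℤ a - fromℤ b) * (i₁ * db) * (i₀ * da * W suf))
    ≡⟨ cong -_ (cong (λ z → z * (i₁ * db) * (i₀ * da * W suf)) (sym (fromℤ-- a b))) ⟩
  - (fromℤ (a ℤ.- b) * (i₁ * db) * (i₀ * da * W suf))
    ≡⟨ cong -_ (cong₂ (λ u v → fromℤ (a ℤ.- b) * u * (v * W suf)) (sym (quotients≡ 1 b suf)) (sym (quotients≡ 0 a suf))) ⟩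
  - (((a ℤ.- b) ℚ./ 1) * quotients 1 b suf * (quotients 0 a suf * W suf)) ∎
  where
  i₁ = invs 1 (length suf)
  i₀ = invs 0 (length suf)
  da = differences a suf
  db = differences b suf

W-suc : ∀ xs → W (map ℤ.suc xs) ≡ W xs
W-suc [] = refl
W-suc (k ∷ xs) = cong₂ _*_ (go 0 xs) (W-suc xs)
  where
  suc-suc : ∀ x k → ℤ.suc x ℤ.- ℤ.suc k ≡ x ℤ.- k
  suc-suc = ℤ.+-*-Solver.solve 2 (λ x k → (ℤ.+-*-Solver.con ℤ.1ℤ ℤ.+-*-Solver.:+ x) ℤ.+-*-Solver.:-
    (ℤ.+-*-Solver.con ℤ.1ℤ ℤ.+-*-Solver.:+ k) ℤ.+-*-Solver.:= x ℤ.+-*-Solver.:- k) refl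
  go : ∀ d xs → quotients d (ℤ.suc k) (map ℤ.suc xs) ≡ quotients d k xs
  go d [] = refl
  go d (x ∷ xs) = cong₂ (λ u v → (u ℚ./ suc d) * v) (suc-suc x k) (go (suc d) xs)

W-pred : ∀ xs → W (map ℤ.pred xs) ≡ W xs
W-pred xs = trans (sym (W-suc (map ℤ.pred xs)))
  (cong W (trans (sym (List.map-∘ xs)) (trans (List.map-cong ℤ.suc-pred xs) (List.map-id xs))))

-- ∏ₓ (id - Eₓ⁻¹)
T∇ : Terms
T∇ = (1ℚ , st , st) ∷ (- 1ℚ , st , dn) ∷ []

∇all : (List ℤ → ℚ) → List ℤ → ℚ
∇all h = M T∇ (λ _ → h) ℤ.0ℤ

module ∇all-Linear xs = Linear (λ h → ∇all h xs) (λ e → M-cong T∇ ℤ.0ℤ xs (λ _ → e))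
                                 (λ a f g → M-lin T∇ ℤ.0ℤ xs a _ _)

∇all-cong : ∀ {g h} xs → (∀ ys → g ys ≡ h ys) → ∇all g xs ≡ ∇all h xs
∇all-cong xs e = M-cong T∇ ℤ.0ℤ xs (λ _ → e)

∇all-∷ : ∀ h x xs → ∇all h (x ∷ xs) ≡ ∇all (λ ys → h (x ∷ ys)) xs - ∇all (λ ys → h (ℤ.pred x ∷ ys)) xs
∇all-∷ h x xs = solve 2 (λ u v → con 1ℚ :* u :+ (con (- 1ℚ) :* v :+ con 0ℚ) := u :- v) refl
  (∇all (λ ys → h (x ∷ ys)) xs) (∇all (λ ys → h (ℤ.pred x ∷ ys)) xs)

∇all-sub : ∀ xs f g → ∇all (λ ys → f ys - g ys) xs ≡ ∇all f xs - ∇all g xs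
∇all-sub xs = ∇all-Linear.L-sub xs

M-cong-length : ∀ T {g h} k xs → (∀ l ys → length ys ≡ length xs → g l ys ≡ h l ys) →
                M T g k xs ≡ M T h k xs
M-cong-length T k [] e = e k [] refl
M-cong-length T k (x ∷ xs) e = comb-cong T λ i j →
  M-cong-length T (sh i k) xs (λ l ys p → e l (sh j x ∷ ys) (cong suc p))

∇f : Fun → Fun
∇f f x = f x - f (ℤ.pred x)

∇all-laplace : ∀ (g : List Fun → List ℤ → ℚ) x fs xs →
  ∇all (λ ys → laplace (λ hs → g hs ys) x fs) xs ≡ laplace (λ hs → ∇all (g hs) xs) x fs
∇all-laplace g x [] xs = ∇all-Linear.L-zero xs
∇all-laplace g x (f ∷ fs) xs = begin
  ∇all (λ ys → f x * g fs ys - laplace (λ hs → g (f ∷ hs) ys) x fs) xs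
    ≡⟨ ∇all-sub xs (λ ys → f x * g fs ys) (λ ys → laplace (λ hs → g (f ∷ hs) ys) x fs) ⟩
  ∇all (λ ys → f x * g fs ys) xs - ∇all (λ ys → laplace (λ hs → g (f ∷ hs) ys) x fs) xs
    ≡⟨ cong₂ _-_ (∇all-Linear.L-scale xs (f x) (g fs)) (∇all-laplace (λ hs → g (f ∷ hs)) x fs xs) ⟩
  f x * ∇all (g fs) xs - laplace (λ hs → ∇all (g (f ∷ hs)) xs) x fs ∎

laplace-∇ : ∀ (g : List Fun → ℚ) x fs →
  laplace (λ hs → g (map ∇f hs)) x fs - laplace (λ hs → g (map ∇f hs)) (ℤ.pred x) fs ≡
  laplace g x (map ∇f fs)
laplace-∇ g x [] = refl
laplace-∇ g x (f ∷ fs) = begin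
  f x * G - A - (f x′ * G - B)
    ≡⟨ solve 5 (λ f f′ g A B → f :* g :- A :- (f′ :* g :- B) := (f :- f′) :* g :- (A :- B)) refl (f x) (f x′) G A B ⟩
  (f x - f x′) * G - (A - B)
    ≡⟨ cong (λ z → (f x - f x′) * G - z) (laplace-∇ (λ hs → g (∇f f ∷ hs)) x fs) ⟩
  (f x - f x′) * G - laplace (λ hs → g (∇f f ∷ hs)) x (map ∇f fs) ∎
  where
  x′ = ℤ.pred x
  G = g (map ∇f fs)
  A = laplace (λ hs → g (∇f f ∷ map ∇f hs)) x fs
  B = laplace (λ hs → g (∇f f ∷ map ∇f hs)) x′ fs

-- Each variable occurs in one row only, and the determinant is linear in that row; hence ∇ in the
-- variable acts on the entries of its row.
∇all-Det : ∀ fs xs → ∇all (Det fs) xs ≡ Det (map ∇f fs) xs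
∇all-Det [] [] = refl
∇all-Det (_ ∷ _) [] = refl
∇all-Det fs (x ∷ xs) = begin
  ∇all (Det fs) (x ∷ xs)
    ≡⟨ ∇all-∷ (Det fs) x xs ⟩
  ∇all (λ ys → Det fs (x ∷ ys)) xs - ∇all (λ ys → Det fs (ℤ.pred x ∷ ys)) xs
    ≡⟨ cong₂ _-_ (step x fs) (step (ℤ.pred x) fs) ⟩
  laplace (λ hs → Det (map ∇f hs) xs) x fs - laplace (λ hs → Det (map ∇f hs) xs) (ℤ.pred x) fs
    ≡⟨ laplace-∇ (λ hs → Det hs xs) x fs ⟩
  laplace (λ hs → Det hs xs) x (map ∇f fs)
    ≡⟨ Det-∷ (map ∇f fs) x xs ⟨
  Det (map ∇f fs) (x ∷ xs) ∎
  where
  Det-∷ : ∀ fs x xs → Det fs (x ∷ xs) ≡ laplace (λ hs → Det hs xs) x fs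
  Det-∷ [] x xs = refl
  Det-∷ (_ ∷ _) x xs = refl
  step : ∀ y fs → ∇all (λ ys → Det fs (y ∷ ys)) xs ≡ laplace (λ hs → Det (map ∇f hs) xs) y fs
  step y fs = trans (∇all-cong xs (λ ys → Det-∷ fs y ys))
    (trans (∇all-laplace Det y fs xs) (laplace-cong y fs (λ hs → ∇all-Det hs xs)))

∇-binomial : ∀ x m → ∇f (λ x → binomial x (suc m)) x ≡ binomial (ℤ.pred x) m
∇-binomial x m = begin
  binomial x (suc m) - b
    ≡⟨ cong (λ z → binomial z (suc m) - b) (sym (ℤ.suc-pred x)) ⟩
  binomial (ℤ.suc (ℤ.pred x)) (suc m) - b
    ≡⟨ cong (_- b) (pascal (ℤ.pred x) m) ⟩
  b + binomial (ℤ.pred x) m - b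
    ≡⟨ solve 2 (λ b c → b :+ c :- b := c) refl b (binomial (ℤ.pred x) m) ⟩
  binomial (ℤ.pred x) m ∎
  where b = binomial (ℤ.pred x) (suc m)

Det-pred : ∀ fs xs → Det (map (_∘ ℤ.pred) fs) xs ≡ Det fs (map ℤ.pred xs)
Det-pred [] [] = refl
Det-pred (_ ∷ _) [] = refl
Det-pred [] (x ∷ xs) = refl
Det-pred (f ∷ fs) (x ∷ xs) = go (λ hs → Det hs xs) (λ hs → Det hs (map ℤ.pred xs)) (λ hs → Det-pred hs xs) (f ∷ fs)
  where
  go : ∀ g h → (∀ hs → g (map (_∘ ℤ.pred) hs) ≡ h hs) → ∀ fs →
       laplace g x (map (_∘ ℤ.pred) fs) ≡ laplace h (ℤ.pred x) fs
  go g h e [] = refl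
  go g h e (f ∷ fs) = cong₂ (λ u v → f (ℤ.pred x) * u - v) (e fs)
    (go (λ hs → g ((f ∘ ℤ.pred) ∷ hs)) (λ hs → h (f ∷ hs)) (λ hs → e (f ∷ hs)) fs)

-- Expand the determinant along the row of k. A minor that retains the constant column is killed by
-- ∇; the one that omits it becomes the determinant of the C(x - 1, m), because ∇ C(x, m + 1) = C(x
-- - 1, m), and `W` is invariant under translation.
W-∇ : ∀ k xs → ∇all (λ ys → W (k ∷ ys)) xs ≡ W xs
W-∇ k xs = begin
  ∇all (λ ys → W (k ∷ ys)) xs
    ≡⟨ M-cong-length T∇ ℤ.0ℤ xs (λ _ ys p →
         trans (W≡Det (k ∷ ys)) (cong (λ n → Det (b₀ ∷ binomials 1 n) (k ∷ ys)) p)) ⟩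
  ∇all (λ ys → laplace (λ hs → Det hs ys) k (b₀ ∷ binomials 1 n)) xs
    ≡⟨ ∇all-laplace Det k (b₀ ∷ binomials 1 n) xs ⟩
  1ℚ * ∇all (Det (binomials 1 n)) xs - laplace (λ hs → ∇all (Det (b₀ ∷ hs)) xs) k (binomials 1 n)
    ≡⟨ cong₂ (λ u v → 1ℚ * u - v) e₁
         (trans (laplace-cong k (binomials 1 n) e₂) (laplace-Linear.L-zero k (binomials 1 n))) ⟩
  1ℚ * W xs - 0ℚ
    ≡⟨ solve 1 (λ w → con 1ℚ :* w :- con 0ℚ := w) refl (W xs) ⟩
  W xs ∎
  where
  n = length xs
  b₀ : Fun
  b₀ x = binomial x 0
  ∇≗ : ∀ m n → Pointwise _≗_ (map ∇f (binomials (suc m) n)) (map (_∘ ℤ.pred) (binomials m n))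
  ∇≗ m zero = []
  ∇≗ m (suc n) = (λ x → ∇-binomial x m) ∷ ∇≗ (suc m) n
  e₁ : ∇all (Det (binomials 1 n)) xs ≡ W xs
  e₁ = begin
    ∇all (Det (binomials 1 n)) xs                ≡⟨ ∇all-Det (binomials 1 n) xs ⟩
    Det (map ∇f (binomials 1 n)) xs              ≡⟨ Det-extensional xs (∇≗ 0 n) ⟩
    Det (map (_∘ ℤ.pred) (binomials 0 n)) xs     ≡⟨ Det-pred (binomials 0 n) xs ⟩
    Det (binomials 0 n) (map ℤ.pred xs)          ≡⟨ cong (λ n → Det (binomials 0 n) (map ℤ.pred xs)) (List.length-map ℤ.pred xs) ⟨
    Det (binomials 0 (length (map ℤ.pred xs))) (map ℤ.pred xs) ≡⟨ W≡Det (map ℤ.pred xs) ⟨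
    W (map ℤ.pred xs)                            ≡⟨ W-pred xs ⟩
    W xs                                         ∎
  e₂ : ∀ hs → ∇all (Det (b₀ ∷ hs)) xs ≡ 0ℚ
  e₂ hs = begin
    ∇all (Det (b₀ ∷ hs)) xs           ≡⟨ ∇all-Det (b₀ ∷ hs) xs ⟩
    Det (∇f b₀ ∷ map ∇f hs) xs        ≡⟨ Det-extensional xs ((λ _ → refl) ∷ Pointwise.refl (λ _ → refl)) ⟩
    Det ((λ _ → 0ℚ) ∷ map ∇f hs) xs   ≡⟨ L-zero ⟩
    0ℚ                                ∎
    where open Linear {ℤ} (λ h → Det (h ∷ map ∇f hs) xs)
                      (λ e → Det-extensional xs (e ∷ Pointwise.refl (λ _ → refl)))
                      (λ a f h → Det-multilinear xs [] a f h _)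

-- The functions α on lists

αL : List ℤ → ℚ
αL = P W

-- Where nothing depends on k, the operator id - E_k + E_k E_x is just E_x.
M-TR-const : ∀ g k xs → M TR (λ _ → g) k xs ≡ g (map ℤ.suc xs)
M-TR-const g k [] = refl
M-TR-const g k (x ∷ xs) = trans
  (cong₂ (λ u v → 1ℚ * u + v) (M-TR-const (λ ys → g (x ∷ ys)) k xs)
    (cong₂ (λ u v → - 1ℚ * u + (1ℚ * v + 0ℚ)) (M-TR-const (λ ys → g (x ∷ ys)) (ℤ.suc k) xs)
      (M-TR-const (λ ys → g (ℤ.suc x ∷ ys)) (ℤ.suc k) xs)))
  (solve 2 (λ a b → con 1ℚ :* a :+ (con (- 1ℚ) :* a :+ (con 1ℚ :* b :+ con 0ℚ)) := b) refl
    (g (x ∷ map ℤ.suc xs)) (g (ℤ.suc x ∷ map ℤ.suc xs)))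

-- ∇ commutes with all factors and acts on `W` first. By `W-∇` the dependence on the first entry
-- disappears, so its factors only translate the other entries, to which `W` is insensitive.
αL-∇ : ∀ k xs → ∇all (λ ys → αL (k ∷ ys)) xs ≡ αL xs
αL-∇ k xs = begin
  M T∇ (λ _ → P (M TR (λ l zs → W (l ∷ zs)) k)) ℤ.0ℤ xs
    ≡⟨ P-M T∇ (λ _ → M TR (λ l zs → W (l ∷ zs)) k) ℤ.0ℤ xs ⟨
  P (M T∇ (λ _ → M TR (λ l zs → W (l ∷ zs)) k) ℤ.0ℤ) xs
    ≡⟨ P-cong xs (λ ys → begin
         M T∇ (λ _ → M TR (λ l zs → W (l ∷ zs)) k) ℤ.0ℤ ys
           ≡⟨ M-comm T∇ TR (λ _ l zs → W (l ∷ zs)) ℤ.0ℤ k ys ⟩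
         M TR (λ l zs → ∇all (λ ws → W (l ∷ ws)) zs) k ys
           ≡⟨ M-cong TR k ys W-∇ ⟩
         M TR (λ _ → W) k ys
           ≡⟨ M-TR-const W k ys ⟩
         W (map ℤ.suc ys)
           ≡⟨ W-suc ys ⟩
         W ys ∎) ⟩
  αL xs ∎

-- The class in which `pair` and `triple` hold. These rules speak of leading entries; closure under
-- fixing the first entry, under `M T` and under linear combinations carries them to any later place
-- and under ∇.
Rep : (List ℤ → ℚ) → Set
Rep h = ∃ λ f → Alt f × (∀ xs → h xs ≡ P f xs)

αL-Rep : Rep αL
αL-Rep = W , W-Alt , λ _ → refl

Rep-∷ : ∀ {h} → Rep h → ∀ k → Rep (λ xs → h (k ∷ xs))
Rep-∷ (f , A , e) k =
  M TR (λ l zs → f (l ∷ zs)) k , M-Alt TR (λ l pre → A (l ∷ pre)) k , λ xs → e (k ∷ xs)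

Rep-M : ∀ T {g} → (∀ l → Rep (g l)) → ∀ k → Rep (M T g k)
Rep-M T {g} R k = M T f k , M-Alt T A k ,
  λ xs → trans (M-cong T k xs e) (sym (P-M T f k xs))
  where
  f = λ l → R l .proj₁
  A = λ l → R l .proj₂ .proj₁
  e = λ l → R l .proj₂ .proj₂

Rep-lin : ∀ a {g h} → Rep g → Rep h → Rep (λ xs → a * g xs + h xs)
Rep-lin a {g} {h} (f₁ , A₁ , e₁) (f₂ , A₂ , e₂) = (λ xs → a * f₁ xs + f₂ xs) ,
  (λ pre x y suf → trans (cong₂ (λ u v → a * u + v) (A₁ pre x y suf) (A₂ pre x y suf))
    (solve 3 (λ a u v → a :* (:- u) :+ :- v := :- (a :* u :+ v)) refl a
      (f₁ (pre ++ y ∷ x ∷ suf)) (f₂ (pre ++ y ∷ x ∷ suf)))) ,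
  λ xs → trans (cong₂ (λ u v → a * u + v) (e₁ xs) (e₂ xs)) (sym (P-lin xs a f₁ f₂))

Rep-cong : ∀ {g h} → (∀ xs → h xs ≡ g xs) → Rep g → Rep h
Rep-cong c (f , A , e) = f , A , λ xs → trans (c xs) (e xs)

Rep-zero : Rep (λ _ → 0ℚ)
Rep-zero = (λ _ → 0ℚ) , (λ _ _ _ _ → refl) , λ xs → sym (P-Linear.L-zero xs)

Rep-comb : ∀ T {g : Shift → Shift → List ℤ → ℚ} → (∀ i j → Rep (g i j)) → Rep (λ xs → comb T (λ i j → g i j xs))
Rep-comb [] R = Rep-zero
Rep-comb ((c , i , j) ∷ T) R = Rep-lin c (R i j) (Rep-comb T R)

Rep-sub : ∀ {g h} → Rep g → Rep h → Rep (λ xs → g xs - h xs)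
Rep-sub {g} {h} R S = Rep-cong
  (λ xs → solve 2 (λ u v → u :- v := con (- 1ℚ) :* v :+ u) refl (g xs) (h xs)) (Rep-lin (- 1ℚ) S R)

Rep-scale : ∀ a {g} → Rep g → Rep (λ xs → a * g xs)
Rep-scale a {g} R = Rep-cong (λ xs → sym (ℚ.+-identityʳ (a * g xs))) (Rep-lin a R Rep-zero)

Rep-∇ : ∀ {h} → Rep h → Rep (∇all h)
Rep-∇ R = Rep-M T∇ (λ _ → R) ℤ.0ℤ

pair : ∀ {h} → Rep h → ∀ a xs →
       h (a ∷ a ∷ xs) + h (ℤ.suc a ∷ ℤ.suc a ∷ xs) ≡ h (a ∷ ℤ.suc a ∷ xs)
pair (f , A , e) a xs = begin
  _ ≡⟨ cong₂ _+_ (e (a ∷ a ∷ xs)) (e (ℤ.suc a ∷ ℤ.suc a ∷ xs)) ⟩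
  _ ≡⟨ P-pair f A a xs ⟩
  _ ≡⟨ e (a ∷ ℤ.suc a ∷ xs) ⟨
  _ ∎

triple : ∀ {h} → Rep h → ∀ a xs → h (a ∷ a ∷ a ∷ xs) ≡ 0ℚ
triple (f , A , e) a xs = trans (e (a ∷ a ∷ a ∷ xs)) (P-triple f A a xs)

∇all-suc : ∀ h x xs → ∇all h (ℤ.suc x ∷ xs) ≡
           ∇all (λ ys → h (ℤ.suc x ∷ ys)) xs - ∇all (λ ys → h (x ∷ ys)) xs
∇all-suc h x xs = trans (∇all-∷ h (ℤ.suc x) xs)
  (cong (λ z → ∇all (λ ys → h (ℤ.suc x ∷ ys)) xs - ∇all (λ ys → h (z ∷ ys)) xs) (ℤ.pred-suc x))

-- `pair` solved for the equal entries a + 1: h(a + 1, a + 1) = h(a, a + 1) - h(a, a) is a ∇ in the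
-- second entry. A repeated entry is thereby traded for one more ∇, which `αL-∇` and its relatives
-- can evaluate.
∇all-pair : ∀ {h} → Rep h → ∀ a xs →
  ∇all (λ ys → h (ℤ.suc a ∷ ℤ.suc a ∷ ys)) xs ≡ ∇all (λ ys → h (a ∷ ys)) (ℤ.suc a ∷ xs)
∇all-pair {h} R a xs = begin
  ∇all (λ ys → h (b ∷ b ∷ ys)) xs
    ≡⟨ ∇all-cong xs (λ ys → begin
         h (b ∷ b ∷ ys)
           ≡⟨ solve 2 (λ u v → v := u :+ v :- u) refl (h (a ∷ a ∷ ys)) (h (b ∷ b ∷ ys)) ⟩
         h (a ∷ a ∷ ys) + h (b ∷ b ∷ ys) - h (a ∷ a ∷ ys)
           ≡⟨ cong (_- h (a ∷ a ∷ ys)) (pair R a ys) ⟩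
         h (a ∷ b ∷ ys) - h (a ∷ a ∷ ys) ∎) ⟩
  ∇all (λ ys → h (a ∷ b ∷ ys) - h (a ∷ a ∷ ys)) xs
    ≡⟨ ∇all-sub xs (λ ys → h (a ∷ b ∷ ys)) (λ ys → h (a ∷ a ∷ ys)) ⟩
  ∇all (λ ys → h (a ∷ b ∷ ys)) xs - ∇all (λ ys → h (a ∷ a ∷ ys)) xs
    ≡⟨ ∇all-suc (λ ys → h (a ∷ ys)) a xs ⟨
  ∇all (λ ys → h (a ∷ ys)) (b ∷ xs) ∎
  where b = ℤ.suc a

-- By `pair`, h(b, a) = h(a, b) - h(a, a) - (h(b, b) - h(b, a)) with b = a + 1, which is minus ∇∇h
-- at (b, b). The further ∇ at b in the statement supplies the third equal entry for `triple`.
∇all-descent : ∀ {h} → Rep h → ∀ a xs → ∇all (λ ys → h (ℤ.suc a ∷ a ∷ ys)) (ℤ.suc a ∷ xs) ≡ 0ℚ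
∇all-descent {h} R a xs = begin
  R′ b a
    ≡⟨ solve 3 (λ ba bb aa → ba := (aa :+ bb) :- aa :- (bb :- ba)) refl (R′ b a) (R′ b b) (R′ a a) ⟩
  R′ a a + R′ b b - R′ a a - (R′ b b - R′ b a)
    ≡⟨ cong (λ z → z - R′ a a - (R′ b b - R′ b a)) (trans
         (sym (∇all-Linear.L-add zs (λ ys → h (a ∷ a ∷ ys)) (λ ys → h (b ∷ b ∷ ys))))
         (∇all-cong zs (pair R a))) ⟩
  R′ a b - R′ a a - (R′ b b - R′ b a)
    ≡⟨ cong₂ _-_ (∇all-suc (λ ys → h (a ∷ ys)) a zs) (∇all-suc (λ ys → h (b ∷ ys)) a zs) ⟨
  ∇all (λ ys → h (a ∷ ys)) (b ∷ zs) - ∇all (λ ys → h (b ∷ ys)) (b ∷ zs)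
    ≡⟨ solve 2 (λ u v → u :- v := :- (v :- u)) refl
         (∇all (λ ys → h (a ∷ ys)) (b ∷ zs)) (∇all (λ ys → h (b ∷ ys)) (b ∷ zs)) ⟩
  - (∇all (λ ys → h (b ∷ ys)) (b ∷ zs) - ∇all (λ ys → h (a ∷ ys)) (b ∷ zs))
    ≡⟨ cong -_ (sym (∇all-suc h a (b ∷ zs))) ⟩
  - ∇all h (b ∷ b ∷ b ∷ xs)
    ≡⟨ cong -_ (triple (Rep-∇ R) b xs) ⟩
  0ℚ ∎
  where
  b = ℤ.suc a
  zs = b ∷ xs
  R′ : ℤ → ℤ → ℚ
  R′ x y = ∇all (λ ys → h (x ∷ y ∷ ys)) zs

-- Functions determined by their differences

suc-invariant⇒const : ∀ {A : Set} (φ : ℤ → A) → (∀ c → φ (ℤ.suc c) ≡ φ c) → ∀ c → φ c ≡ φ ℤ.0ℤ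
suc-invariant⇒const φ e (+ zero) = refl
suc-invariant⇒const φ e (+ suc n) = trans (e (+ n)) (suc-invariant⇒const φ e (+ n))
suc-invariant⇒const φ e -[1+ zero ] = sym (e -[1+ 0 ])
suc-invariant⇒const φ e -[1+ suc n ] =
  trans (sym (e -[1+ suc n ])) (suc-invariant⇒const φ e -[1+ n ])

suc-invariant : ∀ {A : Set} (φ : ℤ → A) → (∀ c → φ (ℤ.suc c) ≡ φ c) → ∀ c d → φ c ≡ φ d
suc-invariant φ e c d = trans (suc-invariant⇒const φ e c) (sym (suc-invariant⇒const φ e d))

x-y≡0⇒x≡y : ∀ {x y} → x - y ≡ 0ℚ → x ≡ y
x-y≡0⇒x≡y {x} {y} e = begin
  x           ≡⟨ solve 2 (λ x y → x := x :- y :+ y) refl x y ⟩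
  x - y + y   ≡⟨ cong (_+ y) e ⟩
  0ℚ + y      ≡⟨ ℚ.+-identityˡ y ⟩
  y           ∎

-- Induction on the tail with k fixed. In the next entry c the hypothesis gives only that the
-- differences are constant; at c = k the constant is identified by `∇all-pair` with another
-- instance of the hypothesis, hence zero.
vanishes : ∀ n {h} → Rep h →
  (∀ k xs → length xs ≡ n → ∇all (λ ys → h (k ∷ ys)) xs ≡ 0ℚ) →
  ∀ k xs → length xs ≡ n → h (k ∷ xs) ≡ 0ℚ
vanishes zero R e k [] p = e k [] p
vanishes (suc n) {h} R e k (x ∷ xs) p =
  vanishes n (Rep-∷ R k) e′ x xs (ℕ.suc-injective p)
  where
  e′ : ∀ c ys → length ys ≡ n → ∇all (λ zs → h (k ∷ c ∷ zs)) ys ≡ 0ℚ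
  e′ c ys q = trans
    (suc-invariant (λ c → ∇all (λ zs → h (k ∷ c ∷ zs)) ys)
      (λ c → x-y≡0⇒x≡y (trans (sym (∇all-suc (λ zs → h (k ∷ zs)) c ys))
                              (e k (ℤ.suc c ∷ ys) (cong suc q)))) c k)
    (subst (λ b → ∇all (λ zs → h (b ∷ b ∷ zs)) ys ≡ 0ℚ) (ℤ.suc-pred k)
      (trans (∇all-pair R (ℤ.pred k) ys) (e (ℤ.pred k) (ℤ.suc (ℤ.pred k) ∷ ys) (cong suc q))))

-- ∏ₓ (v + (1 - v) Eₓ).  A power series in v is encoded as a function on ℤ, its
-- coefficient of vᵖ being the value at p; thus v acts as the shift by -1.
Tv : Terms
Tv = (1ℚ , dn , st) ∷ (1ℚ , st , up) ∷ (- 1ℚ , dn , up) ∷ []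

comb-Tv : ∀ φ → comb Tv φ ≡ φ dn st + φ st up - φ dn up
comb-Tv φ = solve 3 (λ a b c → con 1ℚ :* a :+ (con 1ℚ :* b :+ (con (- 1ℚ) :* c :+ con 0ℚ)) := a :+ b :- c)
  refl (φ dn st) (φ st up) (φ dn up)

module _ (φ : ℤ → ℚ) where

  private
    F : ℤ → List ℤ → ℚ
    F k ys = φ k * αL ys

    h : ℤ → List ℤ → ℚ
    h k ys = M Tv F k ys - F k ys

    h-Rep : ∀ k → Rep (h k)
    h-Rep k = Rep-sub (Rep-M Tv (λ l → Rep-scale (φ l) αL-Rep) k) (Rep-scale (φ k) αL-Rep)

    F-∇ : ∀ l c zs → ∇all (λ ys → F l (c ∷ ys)) zs ≡ F l zs
    F-∇ l c zs = trans (∇all-Linear.L-scale zs (φ l) (λ ys → αL (c ∷ ys))) (cong (φ l *_) (αL-∇ c zs))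

    -- Once ∇ has been applied to the later entries, `F-∇` removes the dependence on c, and the
    -- factor of c becomes v + (1 - v) = 1. This is the inductive step of (2) on the length of the
    -- list.
    h-∇ : ∀ k c zs → ∇all (λ ys → h k (c ∷ ys)) zs ≡ h k zs
    h-∇ k c zs = begin
      ∇all (λ ys → M Tv F k (c ∷ ys) - F k (c ∷ ys)) zs
        ≡⟨ ∇all-sub zs (λ ys → M Tv F k (c ∷ ys)) (λ ys → F k (c ∷ ys)) ⟩
      ∇all (λ ys → M Tv F k (c ∷ ys)) zs - ∇all (λ ys → F k (c ∷ ys)) zs
        ≡⟨ cong₂ _-_ (begin
             ∇all (λ ys → comb Tv (λ i j → M Tv (λ l ws → F l (sh j c ∷ ws)) (sh i k) ys)) zs
               ≡⟨ ∇all-Linear.L-comb zs Tv (λ i j ys → M Tv (λ l ws → F l (sh j c ∷ ws)) (sh i k) ys) ⟩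
             comb Tv (λ i j → ∇all (M Tv (λ l ws → F l (sh j c ∷ ws)) (sh i k)) zs)
               ≡⟨ comb-cong Tv (λ i j → trans
                    (M-comm T∇ Tv (λ _ l ws → F l (sh j c ∷ ws)) ℤ.0ℤ (sh i k) zs)
                    (M-cong Tv (sh i k) zs (λ l ys → F-∇ l (sh j c) ys))) ⟩
             comb Tv (λ i j → M Tv F (sh i k) zs)
               ≡⟨ comb-Tv (λ i j → M Tv F (sh i k) zs) ⟩
             M Tv F (ℤ.pred k) zs + M Tv F k zs - M Tv F (ℤ.pred k) zs
               ≡⟨ solve 2 (λ a b → a :+ b :- a := b) refl (M Tv F (ℤ.pred k) zs) (M Tv F k zs) ⟩
             M Tv F k zs ∎)
           (F-∇ k c zs) ⟩
      h k zs ∎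

    h-vanishes : ∀ n k xs → length xs ≡ n → h k xs ≡ 0ℚ
    h-vanishes zero k [] p = ℚ.+-inverseʳ (F k [])
    h-vanishes (suc n) k (x ∷ xs) p = vanishes n (h-Rep k)
      (λ c zs q → trans (h-∇ k c zs) (h-vanishes n k zs q)) x xs (ℕ.suc-injective p)

  αL-fixed : ∀ k xs → M Tv (λ k ys → φ k * αL ys) k xs ≡ φ k * αL xs
  αL-fixed k xs = x-y≡0⇒x≡y (h-vanishes (length xs) k xs refl)

-- The increment in c supplied by `αL-∇` is the same for k and k + 1, so the difference does not
-- depend on c. At c = k + 1 it is evaluated by the rule for equal entries.
αL-∇-D : ∀ k c xs → ∇all (λ ys → αL (k ∷ c ∷ ys) - αL (ℤ.suc k ∷ c ∷ ys)) xs ≡ αL (k ∷ xs)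
αL-∇-D k c xs = begin
  ∇all (λ ys → αL (k ∷ c ∷ ys) - αL (ℤ.suc k ∷ c ∷ ys)) xs
    ≡⟨ ∇all-sub xs (λ ys → αL (k ∷ c ∷ ys)) (λ ys → αL (ℤ.suc k ∷ c ∷ ys)) ⟩
  f k c - f (ℤ.suc k) c
    ≡⟨ suc-invariant (λ c → f k c - f (ℤ.suc k) c)
         (λ c → trans (cong₂ _-_ (step k c) (step (ℤ.suc k) c))
           (solve 3 (λ a b c → a :+ b :- (c :+ b) := a :- c) refl (f k c) (αL (ℤ.suc c ∷ xs)) (f (ℤ.suc k) c)))
         c (ℤ.suc k) ⟩
  f k (ℤ.suc k) - f (ℤ.suc k) (ℤ.suc k)
    ≡⟨ cong₂ _-_ (step k k) (diag (ℤ.suc k)) ⟩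
  f k k + αL (ℤ.suc k ∷ xs) - αL (ℤ.suc k ∷ xs)
    ≡⟨ cong (λ z → z + αL (ℤ.suc k ∷ xs) - αL (ℤ.suc k ∷ xs)) (diag k) ⟩
  αL (k ∷ xs) + αL (ℤ.suc k ∷ xs) - αL (ℤ.suc k ∷ xs)
    ≡⟨ solve 2 (λ a b → a :+ b :- b := a) refl (αL (k ∷ xs)) (αL (ℤ.suc k ∷ xs)) ⟩
  αL (k ∷ xs) ∎
  where
  f : ℤ → ℤ → ℚ
  f a c = ∇all (λ ys → αL (a ∷ c ∷ ys)) xs
  step : ∀ a c → f a (ℤ.suc c) ≡ f a c + αL (ℤ.suc c ∷ xs)
  step a c = begin
    f a (ℤ.suc c)
      ≡⟨ solve 2 (λ u v → u := v :+ (u :- v)) refl (f a (ℤ.suc c)) (f a c) ⟩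
    f a c + (f a (ℤ.suc c) - f a c)
      ≡⟨ cong (λ z → f a c + z) (trans (sym (∇all-suc (λ ys → αL (a ∷ ys)) c xs)) (αL-∇ a (ℤ.suc c ∷ xs))) ⟩
    f a c + αL (ℤ.suc c ∷ xs) ∎
  diag : ∀ a → f a a ≡ αL (a ∷ xs)
  diag a = subst (λ b → f b b ≡ αL (b ∷ xs)) (ℤ.suc-pred a)
    (trans (∇all-pair αL-Rep (ℤ.pred a) xs) (αL-∇ (ℤ.pred a) (ℤ.suc (ℤ.pred a) ∷ xs)))

-- Weighted shifts

-- (2, 3, …, m + 1) prepended to a list
prefix : ℕ → List ℤ → List ℤ
prefix zero xs = xs
prefix (suc m) xs = prefix m (+ (2 ℕ.+ m) ∷ xs)

Series : Set
Series = ℤ → List ℤ → ℚ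

weigh : ℤ → Series → Series
weigh x g k ys = comb Tv λ i j → g (sh i k) (sh j x ∷ ys)

weighs : ℕ → Series → Series
weighs zero g = g
weighs (suc m) g = weigh (+ (2 ℕ.+ m)) (weighs m g)

M-weigh : ∀ g k x xs → M Tv g k (x ∷ xs) ≡ M Tv (weigh x g) k xs
M-weigh g k x xs = sym (trans
  (M-comb Tv k xs Tv (λ i j l ys → g (sh i l) (sh j x ∷ ys)))
  (comb-cong Tv λ i j → M-shift Tv i (λ l ys → g l (sh j x ∷ ys)) k xs))

M-weighs : ∀ m g k xs → M Tv g k (prefix m xs) ≡ M Tv (weighs m g) k xs
M-weighs zero g k xs = refl
M-weighs (suc m) g k xs = trans (M-weighs m g k (+ (2 ℕ.+ m) ∷ xs)) (M-weigh (weighs m g) k (+ (2 ℕ.+ m)) xs)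

weighs-cong : ∀ m {g h} → (∀ k ys → g k ys ≡ h k ys) → ∀ k ys → weighs m g k ys ≡ weighs m h k ys
weighs-cong zero e k ys = e k ys
weighs-cong (suc m) e k ys = comb-cong Tv λ i j → weighs-cong m e (sh i k) (sh j (+ (2 ℕ.+ m)) ∷ ys)

weighs-lin : ∀ m a g h k ys →
  weighs m (λ k ys → a * g k ys + h k ys) k ys ≡ a * weighs m g k ys + weighs m h k ys
weighs-lin zero a g h k ys = refl
weighs-lin (suc m) a g h k ys = trans
  (comb-cong Tv λ i j → weighs-lin m a g h (sh i k) (sh j (+ (2 ℕ.+ m)) ∷ ys))
  (comb-lin Tv a (λ i j → weighs m g (sh i k) (sh j (+ (2 ℕ.+ m)) ∷ ys))
                 (λ i j → weighs m h (sh i k) (sh j (+ (2 ℕ.+ m)) ∷ ys)))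

module weighs-Linear m k ys = Linear {ℤ × List ℤ} (λ f → weighs m (λ l zs → f (l , zs)) k ys)
  (λ e → weighs-cong m (λ l zs → e (l , zs)) k ys) (λ a f g → weighs-lin m a _ _ k ys)

weighs-shift : ∀ m i g k ys → weighs m (λ l → g (sh i l)) k ys ≡ weighs m g (sh i k) ys
weighs-shift zero i g k ys = refl
weighs-shift (suc m) i g k ys = comb-cong Tv λ i' j → trans
  (weighs-shift m i g (sh i' k) (sh j (+ (2 ℕ.+ m)) ∷ ys))
  (cong (λ l → weighs m g l (sh j (+ (2 ℕ.+ m)) ∷ ys)) (sh-comm i i' k))

module _ (φ : ℤ → ℚ) where

  -- the coefficients of φ(v) vᵐ
  shifted : ℕ → ℤ → ℚ
  shifted zero k = φ k
  shifted (suc m) k = shifted m (ℤ.pred k)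

  module _ (a : ℤ) where

    start : Series
    start k ys = φ k * (αL (a ∷ ys) - αL (ℤ.suc a ∷ ys))

    weighted : ℕ → Series
    weighted m = weighs m start

    weighted-Rep : ∀ m k → Rep (weighted m k)
    weighted-Rep zero k = Rep-scale (φ k) (Rep-sub (Rep-∷ αL-Rep a) (Rep-∷ αL-Rep (ℤ.suc a)))
    weighted-Rep (suc m) k = Rep-comb Tv λ i j → Rep-∷ (weighted-Rep m (sh i k)) (sh j (+ (2 ℕ.+ m)))

    start-∇ : ∀ k c xs → ∇all (λ ys → start k (c ∷ ys)) xs ≡ φ k * αL (a ∷ xs)
    start-∇ k c xs = trans
      (∇all-Linear.L-scale xs (φ k) (λ ys → αL (a ∷ c ∷ ys) - αL (ℤ.suc a ∷ c ∷ ys)))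
      (cong (φ k *_) (αL-∇-D a c xs))

    -- Of the factor v + (1 - v) E of an entry c followed by c, only v survives: the terms in which
    -- c has moved to c + 1 are descents and vanish, the next entry under ∇ being c + 1. The term
    -- (c, c) becomes a ∇ at c behind c - 1, the same situation one step lower; in all this gives m
    -- powers of v.
    weighted-∇-low : ∀ m k ys →
      ∇all (λ ws → weighted m k (+ (1 ℕ.+ m) ∷ ws)) (+ (2 ℕ.+ m) ∷ ys) ≡
      shifted m k * αL (a ∷ prefix (suc m) ys)
    weighted-∇-low zero k ys = start-∇ k (+ 1) (+ 2 ∷ ys)
    weighted-∇-low (suc m) k ys = begin
      ∇all (λ ws → comb Tv (λ i j → g (sh i k) (sh j c ∷ c ∷ ws))) zs
        ≡⟨ ∇all-Linear.L-comb zs Tv (λ i j ws → g (sh i k) (sh j c ∷ c ∷ ws)) ⟩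
      comb Tv (λ i j → ∇all (λ ws → g (sh i k) (sh j c ∷ c ∷ ws)) zs)
        ≡⟨ comb-Tv (λ i j → ∇all (λ ws → g (sh i k) (sh j c ∷ c ∷ ws)) zs) ⟩
      ∇all (λ ws → g k′ (c ∷ c ∷ ws)) zs + ∇all (λ ws → g k (ℤ.suc c ∷ c ∷ ws)) zs
        - ∇all (λ ws → g k′ (ℤ.suc c ∷ c ∷ ws)) zs
        ≡⟨ cong₂ _-_ (cong₂ _+_ (∇all-pair (weighted-Rep m k′) (+ (1 ℕ.+ m)) zs)
                                (∇all-descent (weighted-Rep m k) c ys))
                     (∇all-descent (weighted-Rep m k′) c ys) ⟩
      ∇all (λ ws → g k′ (+ (1 ℕ.+ m) ∷ ws)) (c ∷ zs) + 0ℚ - 0ℚ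
        ≡⟨ cong (λ z → z + 0ℚ - 0ℚ) (weighted-∇-low m k′ zs) ⟩
      shifted m k′ * αL (a ∷ prefix (suc m) zs) + 0ℚ - 0ℚ
        ≡⟨ solve 1 (λ z → z :+ con 0ℚ :- con 0ℚ := z) refl (shifted m k′ * αL (a ∷ prefix (suc m) zs)) ⟩
      shifted m k′ * αL (a ∷ prefix (suc m) zs) ∎
      where
      c = + (2 ℕ.+ m)
      k′ = ℤ.pred k
      zs = + (3 ℕ.+ m) ∷ ys
      g = weighted m

    -- ∑ᵢ vⁱ⁻² α(a, 2, …, i - 1, i + 1, …, m + 2, xs) φ(v), with 2 ≤ i ≤ m + 2
    omissions : ℕ → Series
    omissions zero k xs = φ k * αL (a ∷ xs)
    omissions (suc m) k xs =
      omissions m k (+ (3 ℕ.+ m) ∷ xs) + shifted (suc m) k * αL (a ∷ prefix (suc m) xs)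

    -- Let c be the last weighted entry and b = c + 1 the next one. By `pair`, v (c, b) + (1 - v)
    -- (b, b) equals (b, b) + v (c, c). The first term continues the induction with b kept; the
    -- second is the omission of b, evaluated by `weighted-∇-low`.
    weighted-∇ : ∀ m k xs →
      ∇all (λ ws → weighted m k (+ (2 ℕ.+ m) ∷ ws)) xs ≡ omissions m k xs
    weighted-∇ zero k xs = start-∇ k (+ 2) xs
    weighted-∇ (suc m) k xs = begin
      ∇all (λ ws → comb Tv (λ i j → g (sh i k) (sh j c ∷ b ∷ ws))) xs
        ≡⟨ ∇all-Linear.L-comb xs Tv (λ i j ws → g (sh i k) (sh j c ∷ b ∷ ws)) ⟩
      comb Tv (λ i j → G (sh i k) (sh j c) b)
        ≡⟨ comb-Tv (λ i j → G (sh i k) (sh j c) b) ⟩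
      G k′ c b + G k b b - G k′ b b
        ≡⟨ cong (λ z → z + G k b b - G k′ b b) (trans
             (∇all-cong xs (λ ws → sym (pair (weighted-Rep m k′) c ws)))
             (∇all-Linear.L-add xs (λ ws → g k′ (c ∷ c ∷ ws)) (λ ws → g k′ (b ∷ b ∷ ws)))) ⟩
      G k′ c c + G k′ b b + G k b b - G k′ b b
        ≡⟨ solve 3 (λ x y z → x :+ y :+ z :- y := z :+ x) refl (G k′ c c) (G k′ b b) (G k b b) ⟩
      G k b b + G k′ c c
        ≡⟨ cong₂ _+_ (trans (∇all-pair (weighted-Rep m k) c xs) (weighted-∇ m k (b ∷ xs)))
                     (trans (∇all-pair (weighted-Rep m k′) (+ (1 ℕ.+ m)) xs) (weighted-∇-low m k′ xs)) ⟩
      omissions m k (b ∷ xs) + shifted m k′ * αL (a ∷ prefix (suc m) xs) ∎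
      where
      c = + (2 ℕ.+ m)
      b = + (3 ℕ.+ m)
      k′ = ℤ.pred k
      g = weighted m
      G : ℤ → ℤ → ℤ → ℚ
      G k x y = ∇all (λ ws → g k (x ∷ y ∷ ws)) xs

  module _ (m : ℕ) where

    private
      H : ℤ → Series
      H a = weighs m (λ k ys → φ k * αL (a ∷ ys))

      H-weighted : ∀ a k ys → weighted a m k ys ≡ H a k ys - H (ℤ.suc a) k ys
      H-weighted a k ys = trans
        (weighs-cong m (λ k ys → solve 3 (λ p u v → p :* (u :- v) := p :* u :- p :* v) refl
          (φ k) (αL (a ∷ ys)) (αL (ℤ.suc a ∷ ys))) k ys)
        (weighs-Linear.L-sub m k ys (λ (k , ys) → φ k * αL (a ∷ ys)) (λ (k , ys) → φ k * αL (ℤ.suc a ∷ ys)))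

      X : ℤ → ℤ → ℤ → ℤ → ℚ
      X a k x y = φ k * αL (a ∷ prefix m (x ∷ y ∷ []))

      Y : ℤ → ℤ → ℤ → ℤ → ℚ
      Y a k x y = comb Tv λ i j → comb Tv λ i' j' → comb Tv λ i″ j″ →
        H (sh j″ a) (sh i″ (sh i' (sh i k))) (sh j x ∷ sh j' y ∷ [])

      -- This is (2), with the factors of 2, ..., m + 1 gathered in `H` and those of x, y and a left
      -- outside.
      X≡Y : ∀ a k x y → X a k x y ≡ Y a k x y
      X≡Y a k x y = begin
        φ k * αL (a ∷ prefix m (x ∷ y ∷ []))
          ≡⟨ αL-fixed φ k (a ∷ prefix m (x ∷ y ∷ [])) ⟨
        M Tv (λ k ys → φ k * αL ys) k (a ∷ prefix m (x ∷ y ∷ []))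
          ≡⟨ M-weigh (λ k ys → φ k * αL ys) k a (prefix m (x ∷ y ∷ [])) ⟩
        M Tv (weigh a (λ k ys → φ k * αL ys)) k (prefix m (x ∷ y ∷ []))
          ≡⟨ M-weighs m (weigh a (λ k ys → φ k * αL ys)) k (x ∷ y ∷ []) ⟩
        M Tv (weighs m (weigh a (λ k ys → φ k * αL ys))) k (x ∷ y ∷ [])
          ≡⟨ M-cong Tv k (x ∷ y ∷ []) (λ l ys → trans
               (weighs-Linear.L-comb m l ys Tv (λ i j (k , ys) → φ (sh i k) * αL (sh j a ∷ ys)))
               (comb-cong Tv λ i j → weighs-shift m i (λ k ys → φ k * αL (sh j a ∷ ys)) l ys)) ⟩
        Y a k x y ∎

    -- (id - E_a)(id - E_y⁻¹) ∏ⱼ (v + (1 - v) Eⱼ) φ(v) α(a, 2, …, m + 1, x, y), with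
    -- j running over the entries 2, …, m + 1
    Z : ℤ → ℤ → ℤ → ℤ → ℚ
    Z a k x y = ∇all (λ ws → weighted a m k (x ∷ ws)) (y ∷ [])

    private
      Z≡ : ∀ a k x y → Z a k x y ≡
           (H a k (x ∷ y ∷ []) - H (ℤ.suc a) k (x ∷ y ∷ []))
           - (H a k (x ∷ ℤ.pred y ∷ []) - H (ℤ.suc a) k (x ∷ ℤ.pred y ∷ []))
      Z≡ a k x y = trans (∇all-∷ (λ ws → weighted a m k (x ∷ ws)) y [])
        (cong₂ _-_ (H-weighted a k (x ∷ y ∷ [])) (H-weighted a k (x ∷ ℤ.pred y ∷ [])))

      comb³ : (Shift → Shift → Shift → Shift → Shift → Shift → ℚ) → ℚ
      comb³ f = comb Tv λ i j → comb Tv λ i' j' → comb Tv λ i″ j″ → f i j i' j' i″ j″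

      comb³-sub : ∀ f g → comb³ (λ i j i' j' i″ j″ → f i j i' j' i″ j″ - g i j i' j' i″ j″) ≡ comb³ f - comb³ g
      comb³-sub f g = trans
        (comb-cong Tv λ i j → trans
          (comb-cong Tv λ i' j' → comb-sub Tv (f i j i' j') (g i j i' j'))
          (comb-sub Tv (λ i' j' → comb Tv (f i j i' j')) (λ i' j' → comb Tv (g i j i' j'))))
        (comb-sub Tv (λ i j → comb Tv λ i' j' → comb Tv (f i j i' j')) (λ i j → comb Tv λ i' j' → comb Tv (g i j i' j')))

      comb³-Z : ∀ a k x y →
        comb³ (λ i j i' j' i″ j″ → Z (sh j″ a) (sh i″ (sh i' (sh i k))) (sh j x) (sh j' y)) ≡
        (Y a k x y - Y (ℤ.suc a) k x y) - (Y a k x (ℤ.pred y) - Y (ℤ.suc a) k x (ℤ.pred y))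
      comb³-Z a k x y = begin
        comb³ (λ i j i' j' i″ j″ → Z (sh j″ a) (K i i' i″) (sh j x) (sh j' y))
          ≡⟨ comb-cong Tv (λ i j → comb-cong Tv (λ i' j' → comb-cong Tv (λ i″ j″ → trans
               (Z≡ (sh j″ a) (K i i' i″) (sh j x) (sh j' y))
               (cong₂ (λ a′ y′ → (h a y i j i' j' i″ j″ - H a′ (K i i' i″) (sh j x ∷ sh j' y ∷ []))
                                 - (H (sh j″ a) (K i i' i″) (sh j x ∷ y′ ∷ []) - H a′ (K i i' i″) (sh j x ∷ y′ ∷ [])))
                      (sh-comm up j″ a) (sh-comm dn j' y))))) ⟩
        comb³ (λ i j i' j' i″ j″ → (h a y i j i' j' i″ j″ - h (ℤ.suc a) y i j i' j' i″ j″)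
                - (h a (ℤ.pred y) i j i' j' i″ j″ - h (ℤ.suc a) (ℤ.pred y) i j i' j' i″ j″))
          ≡⟨ trans (comb³-sub (λ i j i' j' i″ j″ → h a y i j i' j' i″ j″ - h (ℤ.suc a) y i j i' j' i″ j″)
                             (λ i j i' j' i″ j″ → h a (ℤ.pred y) i j i' j' i″ j″ - h (ℤ.suc a) (ℤ.pred y) i j i' j' i″ j″)) (cong₂ _-_ (comb³-sub (h a y) (h (ℤ.suc a) y))
                                              (comb³-sub (h a (ℤ.pred y)) (h (ℤ.suc a) (ℤ.pred y)))) ⟩
        (Y a k x y - Y (ℤ.suc a) k x y) - (Y a k x (ℤ.pred y) - Y (ℤ.suc a) k x (ℤ.pred y)) ∎
        where
        K : Shift → Shift → Shift → ℤ
        K i i' i″ = sh i″ (sh i' (sh i k))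
        h : ℤ → ℤ → Shift → Shift → Shift → Shift → Shift → Shift → ℚ
        h a y i j i' j' i″ j″ = H (sh j″ a) (K i i' i″) (sh j x ∷ sh j' y ∷ [])

    -- (id - E_a)(id - E_y⁻¹) α(a, 2, …, m + 1, x, y)
    DαL∇ : ℤ → ℤ → ℤ → ℚ
    DαL∇ a x y = (α′ a y - α′ (ℤ.suc a) y) - (α′ a (ℤ.pred y) - α′ (ℤ.suc a) (ℤ.pred y))
      where
      α′ : ℤ → ℤ → ℚ
      α′ a y = αL (a ∷ prefix m (x ∷ y ∷ []))

    Ψ : ℤ → ℤ → ℤ → ℤ → ℚ
    Ψ a y k x = comb Tv λ i' j' → comb Tv λ i″ j″ → Z (sh j″ a) (sh i″ (sh i' k)) x (sh j' y)

    -- (2) after D and ∇, with the factor of x set apart: the right side is the coefficient of (v +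
    -- (1 - v) E_x) Ψ. It serves as a recursion that determines Ψ from the left side.
    expansion : ∀ a k x y → φ k * DαL∇ a x y ≡
                Ψ a y (ℤ.pred k) x + Ψ a y k (ℤ.suc x) - Ψ a y (ℤ.pred k) (ℤ.suc x)
    expansion a k x y = begin
      φ k * DαL∇ a x y
        ≡⟨ solve 5 (λ p a b c d → p :* ((a :- b) :- (c :- d)) := (p :* a :- p :* b) :- (p :* c :- p :* d)) refl
             (φ k) (α′ a y) (α′ (ℤ.suc a) y) (α′ a (ℤ.pred y)) (α′ (ℤ.suc a) (ℤ.pred y)) ⟩
      (X a k x y - X (ℤ.suc a) k x y) - (X a k x (ℤ.pred y) - X (ℤ.suc a) k x (ℤ.pred y))
        ≡⟨ cong₂ _-_ (cong₂ _-_ (X≡Y a k x y) (X≡Y (ℤ.suc a) k x y))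
                     (cong₂ _-_ (X≡Y a k x (ℤ.pred y)) (X≡Y (ℤ.suc a) k x (ℤ.pred y))) ⟩
      (Y a k x y - Y (ℤ.suc a) k x y) - (Y a k x (ℤ.pred y) - Y (ℤ.suc a) k x (ℤ.pred y))
        ≡⟨ comb³-Z a k x y ⟨
      comb Tv (λ i j → Ψ a y (sh i k) (sh j x))
        ≡⟨ comb-Tv (λ i j → Ψ a y (sh i k) (sh j x)) ⟩
      Ψ a y (ℤ.pred k) x + Ψ a y k (ℤ.suc x) - Ψ a y (ℤ.pred k) (ℤ.suc x) ∎
      where
      α′ : ℤ → ℤ → ℚ
      α′ a y = αL (a ∷ prefix m (x ∷ y ∷ []))

-- Rows of monotone triangles

-- The number of ways to choose the next row L of a monotone triangle below K,
-- weighted by u.  The state is true when as many entries of K as of L have been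
-- passed, and false when K is one ahead.
tot : ∀ {m} → Bool → Bool → Vec Bool m → (Vec Bool m → ℚ) → ℚ
tot σ τ [] u = if does (σ Bool.≟ τ) then u [] else 0ℚ
tot true τ (true ∷ K) u = tot true τ K (λ L → u (true ∷ L)) + tot false τ K (λ L → u (false ∷ L))
tot true τ (false ∷ K) u = tot true τ K (λ L → u (false ∷ L))
tot false τ (true ∷ K) u = tot false τ K (λ L → u (true ∷ L))
tot false τ (false ∷ K) u = tot false τ K (λ L → u (false ∷ L)) + tot true τ K (λ L → u (true ∷ L))

state : Bool → ℕ
state true = 0
state false = 1

∣_∣ₜ : ∀ {m} → Vec Bool m → ℕ
∣ [] ∣ₜ = 0
∣ true ∷ K ∣ₜ = suc ∣ K ∣ₜ
∣ false ∷ K ∣ₜ = ∣ K ∣ₜ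

-- The two states record the excess of K over L and so fix the number of entries of L. The
-- restriction matters because `triangles≡val` compares rows of matching size only.
tot-cong-size : ∀ {m} σ τ (K : Vec Bool m) {u v} →
  (∀ L → state σ ℕ.+ ∣ K ∣ₜ ≡ state τ ℕ.+ ∣ L ∣ₜ → u L ≡ v L) → tot σ τ K u ≡ tot σ τ K v
tot-cong-size true true [] e = e [] refl
tot-cong-size false false [] e = e [] refl
tot-cong-size true false [] e = refl
tot-cong-size false true [] e = refl
tot-cong-size true τ (true ∷ K) e = cong₂ _+_
  (tot-cong-size true τ K λ L p → e (true ∷ L) (trans (cong suc p) (sym (ℕ.+-suc (state τ) ∣ L ∣ₜ))))
  (tot-cong-size false τ K λ L p → e (false ∷ L) p)
tot-cong-size true τ (false ∷ K) e = tot-cong-size true τ K λ L → e (false ∷ L)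
tot-cong-size false τ (true ∷ K) e =
  tot-cong-size false τ K λ L p → e (true ∷ L) (trans (cong suc p) (sym (ℕ.+-suc (state τ) ∣ L ∣ₜ)))
tot-cong-size false τ (false ∷ K) e = cong₂ _+_
  (tot-cong-size false τ K λ L → e (false ∷ L))
  (tot-cong-size true τ K λ L p → e (true ∷ L) (trans (cong suc p) (sym (ℕ.+-suc (state τ) ∣ L ∣ₜ))))

tot-cong : ∀ {m} σ τ (K : Vec Bool m) {u v} → (∀ L → u L ≡ v L) → tot σ τ K u ≡ tot σ τ K v
tot-cong σ τ K e = tot-cong-size σ τ K λ L _ → e L

tot-lin : ∀ {m} σ τ (K : Vec Bool m) a u v →
          tot σ τ K (λ L → a * u L + v L) ≡ a * tot σ τ K u + tot σ τ K v
tot-lin true true [] a u v = refl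
tot-lin false false [] a u v = refl
tot-lin true false [] a u v = solve 1 (λ a → con 0ℚ := a :* con 0ℚ :+ con 0ℚ) refl a
tot-lin false true [] a u v = solve 1 (λ a → con 0ℚ := a :* con 0ℚ :+ con 0ℚ) refl a
tot-lin true τ (true ∷ K) a u v = trans
  (cong₂ _+_ (tot-lin true τ K a (λ L → u (true ∷ L)) (λ L → v (true ∷ L)))
             (tot-lin false τ K a (λ L → u (false ∷ L)) (λ L → v (false ∷ L))))
  (solve 5 (λ a x y z w → a :* x :+ y :+ (a :* z :+ w) := a :* (x :+ z) :+ (y :+ w)) refl a
    (tot true τ K (λ L → u (true ∷ L))) (tot true τ K (λ L → v (true ∷ L)))
    (tot false τ K (λ L → u (false ∷ L))) (tot false τ K (λ L → v (false ∷ L))))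
tot-lin true τ (false ∷ K) a u v = tot-lin true τ K a (λ L → u (false ∷ L)) (λ L → v (false ∷ L))
tot-lin false τ (true ∷ K) a u v = tot-lin false τ K a (λ L → u (true ∷ L)) (λ L → v (true ∷ L))
tot-lin false τ (false ∷ K) a u v = trans
  (cong₂ _+_ (tot-lin false τ K a (λ L → u (false ∷ L)) (λ L → v (false ∷ L)))
             (tot-lin true τ K a (λ L → u (true ∷ L)) (λ L → v (true ∷ L))))
  (solve 5 (λ a x y z w → a :* x :+ y :+ (a :* z :+ w) := a :* (x :+ z) :+ (y :+ w)) refl a
    (tot false τ K (λ L → u (false ∷ L))) (tot false τ K (λ L → v (false ∷ L)))
    (tot true τ K (λ L → u (true ∷ L))) (tot true τ K (λ L → v (true ∷ L))))

module tot-Linear {m} σ τ (K : Vec Bool m) = Linear (tot σ τ K) (tot-cong σ τ K) (tot-lin σ τ K)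

elems : ∀ {m} → ℕ → Vec Bool m → List ℤ
elems c [] = []
elems c (true ∷ K) = + c ∷ elems (suc c) K
elems c (false ∷ K) = elems (suc c) K

end : Bool → ℤ → List ℤ → List ℤ
end true c ys = c ∷ ys
end false c ys = ys

∇all-suc-+ : ∀ h x xs → ∇all h (ℤ.suc x ∷ xs) + ∇all (λ ys → h (x ∷ ys)) xs ≡ ∇all (λ ys → h (ℤ.suc x ∷ ys)) xs
∇all-suc-+ h x xs = trans (cong (_+ ∇all (λ ys → h (x ∷ ys)) xs) (∇all-suc h x xs))
  (solve 2 (λ u v → u :- v :+ v := u) refl (∇all (λ ys → h (ℤ.suc x ∷ ys)) xs) (∇all (λ ys → h (x ∷ ys)) xs))

-- The invariant of reading from left to right. In state true one argument more of `h` is filled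
-- than in state false, and it waits at the last column passed, d. If L has an entry at d + 1, its ∇
-- telescopes with the value held at d; if K has one as well, `∇all-pair` turns the term from d into
-- two entries d + 1.
scan : ∀ {h} → Rep h → ∀ {m} τ d (K : Vec Bool m) ws →
  tot false τ K (λ L → ∇all h (elems (suc d) L ++ ws))
  + tot true τ K (λ L → ∇all (λ ys → h (+ d ∷ ys)) (elems (suc d) L ++ ws))
  ≡ ∇all (λ ys → h (elems (suc d) K ++ end τ (+ (d ℕ.+ m)) ys)) ws
scan {h} R true d [] ws = trans
  (ℚ.+-identityˡ (∇all (λ ys → h (+ d ∷ ys)) ws))
  (cong (λ e → ∇all (λ ys → h (+ e ∷ ys)) ws) (sym (ℕ.+-identityʳ d)))
scan {h} R false d [] ws = ℚ.+-identityʳ (∇all h ws)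
scan {h} R {suc m} τ d (true ∷ K) ws = begin
  A + (B + C)
    ≡⟨ solve 3 (λ a b c → a :+ (b :+ c) := (a :+ c) :+ b) refl A B C ⟩
  (A + C) + B
    ≡⟨ cong₂ _+_ (trans
         (sym (tot-Linear.L-add false τ K (λ L → ∇all h (b ∷ elems (2 ℕ.+ d) L ++ ws))
           (λ L → ∇all (λ ys → h (+ d ∷ ys)) (elems (2 ℕ.+ d) L ++ ws))))
         (tot-cong false τ K (λ L → ∇all-suc-+ h (+ d) (elems (2 ℕ.+ d) L ++ ws))))
         (tot-cong true τ K (λ L → sym (∇all-pair R (+ d) (elems (2 ℕ.+ d) L ++ ws)))) ⟩
  tot false τ K (λ L → ∇all (λ ys → h (b ∷ ys)) (elems (2 ℕ.+ d) L ++ ws))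
    + tot true τ K (λ L → ∇all (λ ys → h (b ∷ b ∷ ys)) (elems (2 ℕ.+ d) L ++ ws))
    ≡⟨ scan (Rep-∷ R b) τ (suc d) K ws ⟩
  ∇all (λ ys → h (b ∷ elems (2 ℕ.+ d) K ++ end τ (+ (suc d ℕ.+ m)) ys)) ws
    ≡⟨ cong (λ e → ∇all (λ ys → h (b ∷ elems (2 ℕ.+ d) K ++ end τ (+ e) ys)) ws) (sym (ℕ.+-suc d m)) ⟩
  ∇all (λ ys → h (b ∷ elems (2 ℕ.+ d) K ++ end τ (+ (d ℕ.+ suc m)) ys)) ws ∎
  where
  b = + (suc d)
  A = tot false τ K (λ L → ∇all h (b ∷ elems (2 ℕ.+ d) L ++ ws))
  B = tot true τ K (λ L → ∇all (λ ys → h (+ d ∷ ys)) (b ∷ elems (2 ℕ.+ d) L ++ ws))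
  C = tot false τ K (λ L → ∇all (λ ys → h (+ d ∷ ys)) (elems (2 ℕ.+ d) L ++ ws))
scan {h} R {suc m} τ d (false ∷ K) ws = begin
  (A + B) + C
    ≡⟨ ℚ.+-assoc A B C ⟩
  A + (B + C)
    ≡⟨ cong (λ z → A + z) (trans
         (sym (tot-Linear.L-add true τ K (λ L → ∇all h (b ∷ elems (2 ℕ.+ d) L ++ ws))
           (λ L → ∇all (λ ys → h (+ d ∷ ys)) (elems (2 ℕ.+ d) L ++ ws))))
         (tot-cong true τ K (λ L → ∇all-suc-+ h (+ d) (elems (2 ℕ.+ d) L ++ ws)))) ⟩
  tot false τ K (λ L → ∇all h (elems (2 ℕ.+ d) L ++ ws))
    + tot true τ K (λ L → ∇all (λ ys → h (b ∷ ys)) (elems (2 ℕ.+ d) L ++ ws))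
    ≡⟨ scan R τ (suc d) K ws ⟩
  ∇all (λ ys → h (elems (2 ℕ.+ d) K ++ end τ (+ (suc d ℕ.+ m)) ys)) ws
    ≡⟨ cong (λ e → ∇all (λ ys → h (elems (2 ℕ.+ d) K ++ end τ (+ e) ys)) ws) (sym (ℕ.+-suc d m)) ⟩
  ∇all (λ ys → h (elems (2 ℕ.+ d) K ++ end τ (+ (d ℕ.+ suc m)) ys)) ws ∎
  where
  b = + (suc d)
  A = tot false τ K (λ L → ∇all h (elems (2 ℕ.+ d) L ++ ws))
  B = tot true τ K (λ L → ∇all h (b ∷ elems (2 ℕ.+ d) L ++ ws))
  C = tot true τ K (λ L → ∇all (λ ys → h (+ d ∷ ys)) (elems (2 ℕ.+ d) L ++ ws))

αL-∇-diag : ∀ a xs → ∇all (λ ys → αL (a ∷ a ∷ ys)) xs ≡ αL (a ∷ xs)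
αL-∇-diag a xs = subst (λ b → ∇all (λ ys → αL (b ∷ b ∷ ys)) xs ≡ αL (b ∷ xs)) (ℤ.suc-pred a)
  (trans (∇all-pair αL-Rep (ℤ.pred a) xs) (αL-∇ (ℤ.pred a) (ℤ.suc (ℤ.pred a) ∷ xs)))

αL-∇-descent : ∀ a xs → ∇all (λ ys → αL (ℤ.suc a ∷ a ∷ ys)) xs ≡ 0ℚ
αL-∇-descent a xs = begin
  f a
    ≡⟨ solve 2 (λ u v → u := v :- (v :- u)) refl (f a) (f b) ⟩
  f b - (f b - f a)
    ≡⟨ cong₂ _-_ (αL-∇-diag b xs) (trans (sym (∇all-suc (λ ys → αL (b ∷ ys)) a xs)) (αL-∇ b (b ∷ xs))) ⟩
  αL (b ∷ xs) - αL (b ∷ xs)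
    ≡⟨ ℚ.+-inverseʳ (αL (b ∷ xs)) ⟩
  0ℚ ∎
  where
  b = ℤ.suc a
  f : ℤ → ℚ
  f c = ∇all (λ ys → αL (b ∷ c ∷ ys)) xs

module _ {m} (τ : Bool) (K : Vec Bool m) (ws : List ℤ) where

  private
    e : ℤ
    e = + (1 ℕ.+ m)

  -- `scan` for D α(x, ·), started at column 1. The sum for state false vanishes because `αL-∇`
  -- forgets x before D is taken; the sum for state true is evaluated by `αL-∇-D`.
  scan-D : ∀ x → tot true τ K (λ L → αL (x ∷ elems 2 L ++ ws)) ≡
           ∇all (λ ys → αL (x ∷ elems 2 K ++ end τ e ys)) ws
           - ∇all (λ ys → αL (ℤ.suc x ∷ elems 2 K ++ end τ e ys)) ws
  scan-D x = begin
    Θ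
      ≡⟨ ℚ.+-identityˡ Θ ⟨
    0ℚ + Θ
      ≡⟨ cong₂ _+_
           (trans (tot-cong false τ K λ L → begin
              ∇all h (elems 2 L ++ ws)
                ≡⟨ ∇all-sub (elems 2 L ++ ws) (λ ys → αL (x ∷ ys)) (λ ys → αL (ℤ.suc x ∷ ys)) ⟩
              ∇all (λ ys → αL (x ∷ ys)) (elems 2 L ++ ws) - ∇all (λ ys → αL (ℤ.suc x ∷ ys)) (elems 2 L ++ ws)
                ≡⟨ cong₂ _-_ (αL-∇ x (elems 2 L ++ ws)) (αL-∇ (ℤ.suc x) (elems 2 L ++ ws)) ⟩
              αL (elems 2 L ++ ws) - αL (elems 2 L ++ ws)
                ≡⟨ ℚ.+-inverseʳ (αL (elems 2 L ++ ws)) ⟩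
              0ℚ ∎)
             (tot-Linear.L-zero false τ K))
           (tot-cong true τ K λ L → αL-∇-D x (+ 1) (elems 2 L ++ ws)) ⟨
    tot false τ K (λ L → ∇all h (elems 2 L ++ ws)) + tot true τ K (λ L → ∇all (λ ys → h (+ 1 ∷ ys)) (elems 2 L ++ ws))
      ≡⟨ scan (Rep-sub (Rep-∷ αL-Rep x) (Rep-∷ αL-Rep (ℤ.suc x))) τ 1 K ws ⟩
    ∇all (λ ys → h (elems 2 K ++ end τ e ys)) ws
      ≡⟨ ∇all-sub ws (λ ys → αL (x ∷ elems 2 K ++ end τ e ys)) (λ ys → αL (ℤ.suc x ∷ elems 2 K ++ end τ e ys)) ⟩
    ∇all (λ ys → αL (x ∷ elems 2 K ++ end τ e ys)) ws
      - ∇all (λ ys → αL (ℤ.suc x ∷ elems 2 K ++ end τ e ys)) ws ∎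
    where
    Θ = tot true τ K (λ L → αL (x ∷ elems 2 L ++ ws))
    h : List ℤ → ℚ
    h ys = αL (x ∷ ys) - αL (ℤ.suc x ∷ ys)

  -- `scan` for α(2, ·), started at column 1: now the sum for state true vanishes, its leading
  -- entries 2, 1 forming a descent.
  scan-2 : tot false τ K (λ L → αL (elems 2 L ++ ws)) ≡
           ∇all (λ ys → αL (+ 2 ∷ elems 2 K ++ end τ e ys)) ws
  scan-2 = begin
    Θ
      ≡⟨ ℚ.+-identityʳ Θ ⟨
    Θ + 0ℚ
      ≡⟨ cong₂ _+_ (tot-cong false τ K λ L → αL-∇ (+ 2) (elems 2 L ++ ws))
           (trans (tot-cong true τ K λ L → αL-∇-descent (+ 1) (elems 2 L ++ ws)) (tot-Linear.L-zero true τ K)) ⟨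
    tot false τ K (λ L → ∇all (λ ys → αL (+ 2 ∷ ys)) (elems 2 L ++ ws))
      + tot true τ K (λ L → ∇all (λ ys → αL (+ 2 ∷ + 1 ∷ ys)) (elems 2 L ++ ws))
      ≡⟨ scan (Rep-∷ αL-Rep (+ 2)) τ 1 K ws ⟩
    ∇all (λ ys → αL (+ 2 ∷ elems 2 K ++ end τ e ys)) ws ∎
    where
    Θ = tot false τ K (λ L → αL (elems 2 L ++ ws))

-- Excludes the empty row, as ∇all αL [] = 1 although no row lies below it.
data Inhabited (τ : Bool) {m : ℕ} (K : Vec Bool m) : List ℤ → Set where
  by-K : ∀ {n ws} → ∣ K ∣ₜ ≡ suc n → Inhabited τ K ws
  by-ws : ∀ {y ws} → Inhabited τ K (y ∷ ws)
  by-τ : ∀ {ws} → τ ≡ true → Inhabited τ K ws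

-- Nothing precedes K, so columns are skipped up to its first entry b. There the two possible states
-- match ∇ of α(b, ·) and of α(b, b, ·), and `scan` takes over.
scan-0 : ∀ {m} τ d (K : Vec Bool m) ws → Inhabited τ K ws →
  tot true τ K (λ L → αL (elems (suc d) L ++ ws)) ≡
  ∇all (λ ys → αL (elems (suc d) K ++ end τ (+ (d ℕ.+ m)) ys)) ws
scan-0 true d [] ws i = sym (αL-∇ (+ (d ℕ.+ 0)) ws)
scan-0 false d [] .(_ ∷ _) (by-ws {y} {ws}) = sym (begin
  ∇all αL (y ∷ ws)
    ≡⟨ ∇all-∷ αL y ws ⟩
  ∇all (λ ys → αL (y ∷ ys)) ws - ∇all (λ ys → αL (ℤ.pred y ∷ ys)) ws
    ≡⟨ cong₂ _-_ (αL-∇ y ws) (αL-∇ (ℤ.pred y) ws) ⟩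
  αL ws - αL ws
    ≡⟨ ℚ.+-inverseʳ (αL ws) ⟩
  0ℚ ∎)
scan-0 {suc m} τ d (true ∷ K) ws i = begin
  tot true τ K (λ L → αL (b ∷ elems (2 ℕ.+ d) L ++ ws)) + tot false τ K (λ L → αL (elems (2 ℕ.+ d) L ++ ws))
    ≡⟨ ℚ.+-comm (tot true τ K (λ L → αL (b ∷ elems (2 ℕ.+ d) L ++ ws)))
                (tot false τ K (λ L → αL (elems (2 ℕ.+ d) L ++ ws))) ⟩
  tot false τ K (λ L → αL (elems (2 ℕ.+ d) L ++ ws)) + tot true τ K (λ L → αL (b ∷ elems (2 ℕ.+ d) L ++ ws))
    ≡⟨ cong₂ _+_ (tot-cong false τ K λ L → αL-∇ b (elems (2 ℕ.+ d) L ++ ws))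
                 (tot-cong true τ K λ L → αL-∇-diag b (elems (2 ℕ.+ d) L ++ ws)) ⟨
  tot false τ K (λ L → ∇all (λ ys → αL (b ∷ ys)) (elems (2 ℕ.+ d) L ++ ws))
    + tot true τ K (λ L → ∇all (λ ys → αL (b ∷ b ∷ ys)) (elems (2 ℕ.+ d) L ++ ws))
    ≡⟨ scan (Rep-∷ αL-Rep b) τ (suc d) K ws ⟩
  ∇all (λ ys → αL (b ∷ elems (2 ℕ.+ d) K ++ end τ (+ (suc d ℕ.+ m)) ys)) ws
    ≡⟨ cong (λ e → ∇all (λ ys → αL (b ∷ elems (2 ℕ.+ d) K ++ end τ (+ e) ys)) ws) (sym (ℕ.+-suc d m)) ⟩
  ∇all (λ ys → αL (b ∷ elems (2 ℕ.+ d) K ++ end τ (+ (d ℕ.+ suc m)) ys)) ws ∎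
  where b = + (suc d)
scan-0 {suc m} τ d (false ∷ K) ws i = trans
  (scan-0 τ (suc d) K ws (tail i))
  (cong (λ e → ∇all (λ ys → αL (elems (2 ℕ.+ d) K ++ end τ (+ e) ys)) ws) (sym (ℕ.+-suc d m)))
  where
  tail : ∀ {ws} → Inhabited τ (false ∷ K) ws → Inhabited τ K ws
  tail (by-K p) = by-K p
  tail by-ws = by-ws
  tail (by-τ p) = by-τ p

-- Monotone triangles with prescribed diagonals

-- the a-th power of id - Eˢ
diff : Shift → ℕ → (ℤ → ℚ) → ℤ → ℚ
diff s zero f x = f x
diff s (suc a) f x = diff s a f x - diff s a f (sh s x)

diff-cong : ∀ s a {f g} → (∀ x → f x ≡ g x) → ∀ x → diff s a f x ≡ diff s a g x
diff-cong s zero e x = e x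
diff-cong s (suc a) e x = cong₂ _-_ (diff-cong s a e x) (diff-cong s a e (sh s x))

diff-lin : ∀ s a c f g x → diff s a (λ x → c * f x + g x) x ≡ c * diff s a f x + diff s a g x
diff-lin s zero c f g x = refl
diff-lin s (suc a) c f g x = trans
  (cong₂ _-_ (diff-lin s a c f g x) (diff-lin s a c f g (sh s x)))
  (solve 5 (λ c f g f′ g′ → (c :* f :+ g) :- (c :* f′ :+ g′) := c :* (f :- f′) :+ (g :- g′)) refl
    c (diff s a f x) (diff s a g x) (diff s a f (sh s x)) (diff s a g (sh s x)))

module diff-Linear s a x = Linear (λ f → diff s a f x) (λ e → diff-cong s a e x) (λ c f g → diff-lin s a c f g x)

diff-shift : ∀ s s′ a f x → diff s a (λ x → f (sh s′ x)) x ≡ diff s a f (sh s′ x)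
diff-shift s s′ zero f x = refl
diff-shift s s′ (suc a) f x = cong₂ _-_ (diff-shift s s′ a f x)
  (trans (diff-shift s s′ a f (sh s x)) (cong (diff s a f) (sh-comm s′ s x)))

diff-suc : ∀ s a f x → diff s (suc a) f x ≡ diff s a (λ x → f x - f (sh s x)) x
diff-suc s a f x = sym (trans
  (diff-Linear.L-sub s a x f (λ x → f (sh s x)))
  (cong (λ z → diff s a f x - z) (diff-shift s s a f x)))

module _ {A : Set} (L : (A → ℚ) → ℚ)
  (L-cong : ∀ {f g} → (∀ x → f x ≡ g x) → L f ≡ L g)
  (L-lin : ∀ a f g → L (λ x → a * f x + g x) ≡ a * L f + L g)
  where

  linear-diff : ∀ s a (f : ℤ → A → ℚ) x → L (λ y → diff s a (λ x → f x y) x) ≡ diff s a (λ x → L (f x)) x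
  linear-diff s zero f x = refl
  linear-diff s (suc a) f x = trans
    (Linear.L-sub L L-cong L-lin (λ y → diff s a (λ x → f x y) x) (λ y → diff s a (λ x → f x y) (sh s x)))
    (cong₂ _-_ (linear-diff s a f x) (linear-diff s a f (sh s x)))

diff-diff : ∀ s a s′ b (f : ℤ → ℤ → ℚ) x y →
  diff s a (λ x → diff s′ b (f x) y) x ≡ diff s′ b (λ y → diff s a (λ x → f x y) x) y
diff-diff s a s′ b f x y =
  linear-diff (λ f → diff s a f x) (λ e → diff-cong s a e x) (λ c f g → diff-lin s a c f g x)
    s′ b (λ y x → f x y) y

-- In both definitions the first argument tells how many consecutive rows, starting
-- with the present one, contain the extreme entry.
withLeft : ℕ → (List ℤ → ℚ) → ℚ
withLeft zero F = F []
withLeft (suc a) F = diff up a (λ x → F (x ∷ [])) (+ 2)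

withRight : ℤ → ℕ → (List ℤ → ℚ) → ℚ
withRight c zero F = F []
withRight c (suc b) F = diff dn b (λ y → F (y ∷ [])) c

withLeft-cong : ∀ a {F G} → (∀ l → F l ≡ G l) → withLeft a F ≡ withLeft a G
withLeft-cong zero e = e []
withLeft-cong (suc a) e = diff-cong up a (λ x → e (x ∷ [])) (+ 2)

withLeft-lin : ∀ a c F G → withLeft a (λ l → c * F l + G l) ≡ c * withLeft a F + withLeft a G
withLeft-lin zero c F G = refl
withLeft-lin (suc a) c F G = diff-lin up a c (λ x → F (x ∷ [])) (λ x → G (x ∷ [])) (+ 2)

-- The outer entries start from 2 and m + 1, not from 1 and m + 2: a first entry 2 allows exactly
-- those next rows that a first entry 1 allows without column 1, and likewise on the right. Each
-- further row that contains the outer column costs one difference.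
val : ∀ {m} → ℕ → ℕ → Vec Bool m → ℚ
val {m} a b K = withLeft a λ l → withRight (+ (1 ℕ.+ m)) b λ r → αL (l ++ elems 2 K ++ r)

-- The states after column 1 and before the last column. In the end K must be one ahead of L, so the
-- outer column changes the state exactly when the present row contains it and the next does not.
leftState rightState : ℕ → Bool
leftState 1 = false
leftState _ = true
rightState 1 = true
rightState _ = false

left-step : ∀ {m} a τ (K : Vec Bool m) ws → (a ≡ 0 → Inhabited τ K ws) →
  withLeft a (λ l → ∇all (λ ys → αL (l ++ elems 2 K ++ end τ (+ (1 ℕ.+ m)) ys)) ws) ≡
  tot (leftState a) τ K (λ L → withLeft (pred a) (λ l → αL (l ++ elems 2 L ++ ws)))
left-step 0 τ K ws i = sym (scan-0 τ 1 K ws (i refl))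
left-step 1 τ K ws i = sym (scan-2 τ K ws)
left-step {m} (suc (suc a)) τ K ws i = begin
  diff up (suc a) G (+ 2)
    ≡⟨ diff-suc up a G (+ 2) ⟩
  diff up a (λ x → G x - G (ℤ.suc x)) (+ 2)
    ≡⟨ diff-cong up a (λ x → sym (scan-D τ K ws x)) (+ 2) ⟩
  diff up a (λ x → tot true τ K (λ L → αL (x ∷ elems 2 L ++ ws))) (+ 2)
    ≡⟨ linear-diff (tot true τ K) (tot-cong true τ K) (tot-lin true τ K) up a
         (λ x L → αL (x ∷ elems 2 L ++ ws)) (+ 2) ⟨
  tot true τ K (λ L → diff up a (λ x → αL (x ∷ elems 2 L ++ ws)) (+ 2)) ∎
  where
  G : ℤ → ℚ
  G x = ∇all (λ ys → αL (x ∷ elems 2 K ++ end τ (+ (1 ℕ.+ m)) ys)) ws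

remaining : ℕ → List ℤ → Set
remaining (suc (suc b)) ws = ∃ λ y → ws ≡ y ∷ []
remaining _ ws = ws ≡ []

val-step : ∀ {m} a b (K : Vec Bool m) →
  (∀ ws → remaining b ws → a ≡ 0 → Inhabited (rightState b) K ws) →
  val a b K ≡ tot (leftState a) (rightState b) K (val (pred a) (pred b))
val-step a 0 K i = left-step a false K [] (i [] refl)
val-step a 1 K i = left-step a true K [] (i [] refl)
val-step {m} a (suc (suc b)) K i = begin
  withLeft a (λ l → diff dn (suc b) (g l) c)
    ≡⟨ withLeft-cong a (λ l → trans (diff-suc dn b (g l) c) (diff-cong dn b (λ y →
         sym (∇all-∷ (λ ys → αL (l ++ elems 2 K ++ ys)) y [])) c)) ⟩
  withLeft a (λ l → diff dn b (λ y → ∇all (λ ys → αL (l ++ elems 2 K ++ ys)) (y ∷ [])) c)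
    ≡⟨ linear-diff (withLeft a) (withLeft-cong a) (withLeft-lin a) dn b
         (λ y l → ∇all (λ ys → αL (l ++ elems 2 K ++ ys)) (y ∷ [])) c ⟩
  diff dn b (λ y → withLeft a (λ l → ∇all (λ ys → αL (l ++ elems 2 K ++ ys)) (y ∷ []))) c
    ≡⟨ diff-cong dn b (λ y → left-step a false K (y ∷ []) (i (y ∷ []) (y , refl))) c ⟩
  diff dn b (λ y → tot σ false K (λ L → withLeft (pred a) (λ l → αL (l ++ elems 2 L ++ y ∷ [])))) c
    ≡⟨ linear-diff (tot σ false K) (tot-cong σ false K) (tot-lin σ false K) dn b
         (λ y L → withLeft (pred a) (λ l → αL (l ++ elems 2 L ++ y ∷ []))) c ⟨
  tot σ false K (λ L → diff dn b (λ y → withLeft (pred a) (λ l → αL (l ++ elems 2 L ++ y ∷ []))) c)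
    ≡⟨ tot-cong σ false K (λ L → linear-diff (withLeft (pred a)) (withLeft-cong (pred a)) (withLeft-lin (pred a)) dn b
         (λ y l → αL (l ++ elems 2 L ++ y ∷ [])) c) ⟨
  tot σ false K (λ L → withLeft (pred a) (λ l → diff dn b (λ y → αL (l ++ elems 2 L ++ y ∷ [])) c)) ∎
  where
  c = + (1 ℕ.+ m)
  σ = leftState a
  g : List ℤ → ℤ → ℚ
  g l y = αL (l ++ elems 2 K ++ y ∷ [])

-- The number of monotone triangles with r rows whose bottom row has K in columns
-- 2, 3, …, whose last a rows are those containing the first column, and whose last b
-- rows are those containing the last column.
triangles : ∀ {m} → ℕ → ℕ → ℕ → Vec Bool m → ℚ
triangles zero zero zero K = if ∣ K ∣ₜ ℕ.≡ᵇ 0 then 1ℚ else 0ℚ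
triangles zero _ _ K = 0ℚ
triangles (suc r) a b K = tot (leftState a) (rightState b) K (triangles r (pred a) (pred b))

one : ℕ → ℕ
one zero = 0
one (suc _) = 1

size : ∀ {m} → ℕ → ℕ → Vec Bool m → ℕ
size a b K = one a ℕ.+ (one b ℕ.+ ∣ K ∣ₜ)

size-step : ∀ {m r} a b (K L : Vec Bool m) → size a b K ≡ suc r →
  state (leftState a) ℕ.+ ∣ K ∣ₜ ≡ state (rightState b) ℕ.+ ∣ L ∣ₜ → size (pred a) (pred b) L ≡ r
size-step 0 0 K L p q = ℕ.suc-injective (trans (sym q) p)
size-step 0 1 K L p q = trans (sym q) (ℕ.suc-injective p)
size-step 0 (suc (suc b)) K L p q = trans (sym q) (ℕ.suc-injective p)
size-step 1 0 K L p q = ℕ.suc-injective (trans (sym q) p)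
size-step 1 1 K L p q = trans (sym q) (ℕ.suc-injective p)
size-step 1 (suc (suc b)) K L p q = trans (sym q) (ℕ.suc-injective p)
size-step (suc (suc a)) 0 K L p q = trans (sym q) (ℕ.suc-injective p)
size-step (suc (suc a)) 1 K L p q = trans (cong suc (sym q)) (ℕ.suc-injective p)
size-step (suc (suc a)) (suc (suc b)) K L p q = trans (cong suc (sym q)) (ℕ.suc-injective p)

elems-empty : ∀ {m} c (K : Vec Bool m) → ∣ K ∣ₜ ≡ 0 → elems c K ≡ []
elems-empty c [] p = refl
elems-empty c (false ∷ K) p = elems-empty (suc c) K p

triangles≡val : ∀ {m} r a b (K : Vec Bool m) → size a b K ≡ r → triangles r a b K ≡ val a b K
triangles≡val zero zero zero K p = trans
  (cong (λ k → if k ℕ.≡ᵇ 0 then 1ℚ else 0ℚ) p)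
  (sym (cong (λ l → αL (l ++ [])) (elems-empty 2 K p)))
triangles≡val (suc r) a b K p = trans
  (tot-cong-size (leftState a) (rightState b) K λ L q →
    triangles≡val r (pred a) (pred b) L (size-step a b K L p q))
  (sym (val-step a b K (inhabited a b p)))
  where
  inhabited : ∀ a b → size a b K ≡ suc r → ∀ ws → remaining b ws → a ≡ 0 → Inhabited (rightState b) K ws
  inhabited zero 0 p ws q refl = by-K p
  inhabited zero 1 p ws q refl = by-τ refl
  inhabited zero (suc (suc b)) p ws (y , refl) refl = by-ws

-- Differences of α

-- The series 1, given by its coefficients.
δ : ℤ → ℚ
δ (+ zero) = 1ℚ
δ (+ suc _) = 0ℚ
δ -[1+ _ ] = 0ℚ

vanishing-comb-Tv : ∀ {φ} → φ dn st ≡ 0ℚ → φ st up ≡ 0ℚ → φ dn up ≡ 0ℚ → comb Tv φ ≡ 0ℚ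
vanishing-comb-Tv {φ} p q r = trans (comb-Tv φ) (cong₂ _-_ (cong₂ _+_ p q) r)

weighs-negative : ∀ m g → (∀ n ys → g -[1+ n ] ys ≡ 0ℚ) → ∀ n ys → weighs m g -[1+ n ] ys ≡ 0ℚ
weighs-negative zero g e n ys = e n ys
weighs-negative (suc m) g e n ys = vanishing-comb-Tv {λ i j → weighs m g (sh i -[1+ n ]) (sh j (+ (2 ℕ.+ m)) ∷ ys)}
  (weighs-negative m g e (suc n) (+ (2 ℕ.+ m) ∷ ys))
  (weighs-negative m g e n (+ (3 ℕ.+ m) ∷ ys))
  (weighs-negative m g e (suc n) (+ (3 ℕ.+ m) ∷ ys))

shifted-negative : ∀ m n → shifted δ m -[1+ n ] ≡ 0ℚ
shifted-negative zero n = refl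
shifted-negative (suc m) n = shifted-negative m (suc n)

shifted-diag : ∀ m → shifted δ m (+ m) ≡ 1ℚ
shifted-diag zero = refl
shifted-diag (suc m) = shifted-diag m

shifted-less : ∀ m p → p ℕ.< m → shifted δ m (+ p) ≡ 0ℚ
shifted-less (suc m) zero _ = shifted-negative m 0
shifted-less (suc m) (suc p) (ℕ.s≤s q) = shifted-less m p q

shifted-more : ∀ m p → m ℕ.< p → shifted δ m (+ p) ≡ 0ℚ
shifted-more zero (suc p) _ = refl
shifted-more (suc m) (suc p) (ℕ.s≤s q) = shifted-more m p q

missing : ∀ m → ℕ → Vec Bool m
missing zero p = []
missing (suc m) zero = false ∷ Vec.replicate m true
missing (suc m) (suc p) = true ∷ missing m p

elems-full : ∀ c m xs → elems c (Vec.replicate (suc m) true) ++ xs ≡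
                        elems c (Vec.replicate m true) ++ + (c ℕ.+ m) ∷ xs
elems-full c zero xs = cong (λ e → + e ∷ xs) (sym (ℕ.+-identityʳ c))
elems-full c (suc m) xs = cong (+ c ∷_) (trans (elems-full (suc c) m xs)
  (cong (λ e → elems (suc c) (Vec.replicate m true) ++ + e ∷ xs) (sym (ℕ.+-suc c m))))

elems-missing : ∀ c m p xs → p ℕ.≤ m → elems c (missing (2 ℕ.+ m) p) ++ xs ≡
                elems c (missing (suc m) p) ++ + (c ℕ.+ suc m) ∷ xs
elems-missing c m zero xs q = trans (elems-full (suc c) m xs)
  (cong (λ e → elems (suc c) (Vec.replicate m true) ++ + e ∷ xs) (sym (ℕ.+-suc c m)))
elems-missing c (suc m) (suc p) xs (ℕ.s≤s q) = cong (+ c ∷_) (trans (elems-missing (suc c) m p xs q)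
  (cong (λ e → elems (suc c) (missing (suc m) p) ++ + e ∷ xs) (sym (ℕ.+-suc c (suc m)))))

elems-missing-last : ∀ c m xs → elems c (missing (suc m) m) ++ xs ≡ elems c (Vec.replicate m true) ++ xs
elems-missing-last c zero xs = refl
elems-missing-last c (suc m) xs = cong (+ c ∷_) (elems-missing-last (suc c) m xs)

prefix≡ : ∀ m xs → prefix m xs ≡ elems 2 (Vec.replicate m true) ++ xs
prefix≡ zero xs = refl
prefix≡ (suc m) xs = trans (prefix≡ m (+ (2 ℕ.+ m) ∷ xs)) (sym (elems-full 2 m xs))

module _ (a : ℤ) where

  omissions-negative : ∀ m n xs → omissions δ a m -[1+ n ] xs ≡ 0ℚ
  omissions-negative zero n xs = ℚ.*-zeroˡ (αL (a ∷ xs))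
  omissions-negative (suc m) n xs = trans
    (cong₂ (λ u v → u + v * αL (a ∷ prefix (suc m) xs)) (omissions-negative m n (+ (3 ℕ.+ m) ∷ xs))
      (shifted-negative m (suc n)))
    (solve 1 (λ x → con 0ℚ :+ con 0ℚ :* x := con 0ℚ) refl (αL (a ∷ prefix (suc m) xs)))

  omissions-more : ∀ m p xs → m ℕ.< p → omissions δ a m (+ p) xs ≡ 0ℚ
  omissions-more zero (suc p) xs q = ℚ.*-zeroˡ (αL (a ∷ xs))
  omissions-more (suc m) p xs q = trans
    (cong₂ (λ u v → u + v * αL (a ∷ prefix (suc m) xs)) (omissions-more m p (+ (3 ℕ.+ m) ∷ xs) (ℕ.<⇒≤ q))
      (shifted-more (suc m) p q))
    (solve 1 (λ x → con 0ℚ :+ con 0ℚ :* x := con 0ℚ) refl (αL (a ∷ prefix (suc m) xs)))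

  omissions≡ : ∀ m p xs → p ℕ.≤ m → omissions δ a m (+ p) xs ≡ αL (a ∷ elems 2 (missing (suc m) p) ++ xs)
  omissions≡ zero zero xs q = ℚ.*-identityˡ (αL (a ∷ xs))
  omissions≡ (suc m) p xs q with p ℕ.≟ suc m
  -- Of all summands only the one that omits the largest entry, m + 3, has degree m + 1.
  ... | yes refl = begin
    omissions δ a m (+ (suc m)) (+ (3 ℕ.+ m) ∷ xs) + shifted δ m (+ m) * αL (a ∷ prefix (suc m) xs)
      ≡⟨ cong₂ (λ u v → u + v * αL (a ∷ prefix (suc m) xs))
           (omissions-more m (suc m) (+ (3 ℕ.+ m) ∷ xs) ℕ.≤-refl) (shifted-diag m) ⟩
    0ℚ + 1ℚ * αL (a ∷ prefix (suc m) xs)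
      ≡⟨ solve 1 (λ x → con 0ℚ :+ con 1ℚ :* x := x) refl (αL (a ∷ prefix (suc m) xs)) ⟩
    αL (a ∷ prefix (suc m) xs)
      ≡⟨ cong (λ l → αL (a ∷ l)) (trans (prefix≡ (suc m) xs) (sym (elems-missing-last 2 (suc m) xs))) ⟩
    αL (a ∷ elems 2 (missing (2 ℕ.+ m) (suc m)) ++ xs) ∎
  ... | no p≢1+m = begin
    omissions δ a m (+ p) (+ (3 ℕ.+ m) ∷ xs) + shifted δ (suc m) (+ p) * αL (a ∷ prefix (suc m) xs)
      ≡⟨ cong₂ (λ u v → u + v * αL (a ∷ prefix (suc m) xs))
           (omissions≡ m p (+ (3 ℕ.+ m) ∷ xs) p≤m) (shifted-less (suc m) p (ℕ.s≤s p≤m)) ⟩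
    αL (a ∷ elems 2 (missing (suc m) p) ++ + (3 ℕ.+ m) ∷ xs) + 0ℚ * αL (a ∷ prefix (suc m) xs)
      ≡⟨ solve 2 (λ x y → x :+ con 0ℚ :* y := x) refl
           (αL (a ∷ elems 2 (missing (suc m) p) ++ + (3 ℕ.+ m) ∷ xs)) (αL (a ∷ prefix (suc m) xs)) ⟩
    αL (a ∷ elems 2 (missing (suc m) p) ++ + (3 ℕ.+ m) ∷ xs)
      ≡⟨ cong (λ l → αL (a ∷ l)) (sym (elems-missing 2 m p xs p≤m)) ⟩
    αL (a ∷ elems 2 (missing (2 ℕ.+ m) p) ++ xs) ∎
    where
    p≤m : p ℕ.≤ m
    p≤m = ℕ.≤-pred (ℕ.≤∧≢⇒< q p≢1+m)

module _ (m : ℕ) where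

  private
    x₀ x₁ : ℤ
    x₀ = + (1 ℕ.+ m)
    x₁ = + (2 ℕ.+ m)

    Z-negative : ∀ a n x y → Z δ m a -[1+ n ] x y ≡ 0ℚ
    Z-negative a n x y = trans
      (∇all-cong (y ∷ []) (λ ws → weighs-negative m (start δ a)
        (λ n ys → ℚ.*-zeroˡ (αL (a ∷ ys) - αL (ℤ.suc a ∷ ys))) n (x ∷ ws)))
      (∇all-Linear.L-zero (y ∷ []))

    Ψ-negative : ∀ a n x y → Ψ δ m a y -[1+ n ] x ≡ 0ℚ
    Ψ-negative a n x y = vanishing-comb-Tv
      {λ i' j' → comb Tv λ i″ j″ → Z δ m (sh j″ a) (sh i″ (sh i' -[1+ n ])) x (sh j' y)}
      (inner (suc n) y) (inner n (ℤ.suc y)) (inner (suc n) (ℤ.suc y))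
      where
      inner : ∀ n y → comb Tv (λ i″ j″ → Z δ m (sh j″ a) (sh i″ -[1+ n ]) x y) ≡ 0ℚ
      inner n y = vanishing-comb-Tv {λ i″ j″ → Z δ m (sh j″ a) (sh i″ -[1+ n ]) x y}
        (Z-negative a (suc n) x y) (Z-negative (ℤ.suc a) n x y) (Z-negative (ℤ.suc a) (suc n) x y)

    -- Comparing coefficients of vᵖ⁺¹ in `expansion`, whose left side is constant in v, gives Ψₚ₊₁(x
    -- + 1) = Ψₚ(x + 1) - Ψₚ(x). Each power of v is therefore one more ∇ in x.
    Ψ-diff : ∀ a y p x → Ψ δ m a y (+ p) (ℤ.suc x) ≡ diff dn p (λ x → DαL∇ δ m a x y) x
    Ψ-diff a y zero x = begin
      Ψ δ m a y (+ 0) (ℤ.suc x)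
        ≡⟨ solve 1 (λ u → u := con 0ℚ :+ u :- con 0ℚ) refl (Ψ δ m a y (+ 0) (ℤ.suc x)) ⟩
      0ℚ + Ψ δ m a y (+ 0) (ℤ.suc x) - 0ℚ
        ≡⟨ cong₂ (λ u v → u + Ψ δ m a y (+ 0) (ℤ.suc x) - v) (Ψ-negative a 0 x y) (Ψ-negative a 0 (ℤ.suc x) y) ⟨
      Ψ δ m a y -[1+ 0 ] x + Ψ δ m a y (+ 0) (ℤ.suc x) - Ψ δ m a y -[1+ 0 ] (ℤ.suc x)
        ≡⟨ expansion δ m a (+ 0) x y ⟨
      1ℚ * DαL∇ δ m a x y
        ≡⟨ ℚ.*-identityˡ (DαL∇ δ m a x y) ⟩
      DαL∇ δ m a x y ∎
    Ψ-diff a y (suc p) x = begin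
      Ψ δ m a y (+ (suc p)) (ℤ.suc x)
        ≡⟨ solve 3 (λ u v w → v := (u :+ v :- w) :+ (w :- u)) refl
             (Ψ δ m a y (+ p) x) (Ψ δ m a y (+ (suc p)) (ℤ.suc x)) (Ψ δ m a y (+ p) (ℤ.suc x)) ⟩
      (Ψ δ m a y (+ p) x + Ψ δ m a y (+ (suc p)) (ℤ.suc x) - Ψ δ m a y (+ p) (ℤ.suc x))
        + (Ψ δ m a y (+ p) (ℤ.suc x) - Ψ δ m a y (+ p) x)
        ≡⟨ cong₂ _+_
             (trans (sym (expansion δ m a (+ (suc p)) x y)) (ℚ.*-zeroˡ (DαL∇ δ m a x y)))
             (cong₂ _-_ (Ψ-diff a y p x)
               (trans (cong (Ψ δ m a y (+ p)) (sym (ℤ.suc-pred x))) (Ψ-diff a y p (ℤ.pred x)))) ⟩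
      0ℚ + diff dn (suc p) (λ x → DαL∇ δ m a x y) x
        ≡⟨ ℚ.+-identityˡ (diff dn (suc p) (λ x → DαL∇ δ m a x y) x) ⟩
      diff dn (suc p) (λ x → DαL∇ δ m a x y) x ∎

    Γ : ℤ → ℤ → ℤ → ℚ
    Γ a k y = omissions δ a m k (y ∷ [])

    U : (ℤ → ℤ → ℚ) → ℤ → ℤ → ℚ
    U V a k = V a (ℤ.pred k) + V (ℤ.suc a) k - V (ℤ.suc a) (ℤ.pred k)

    -- At x = m + 2 the entry x continues 2, ..., m + 1, so `weighted-∇` evaluates the inner part;
    -- the factors of a and y remain.
    Ψ≡ : ∀ a y k → Ψ δ m a y k x₁ ≡
         U (λ a k → Γ a k y) a (ℤ.pred k) + U (λ a k → Γ a k (ℤ.suc y)) a k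
         - U (λ a k → Γ a k (ℤ.suc y)) a (ℤ.pred k)
    Ψ≡ a y k = trans
      (comb-Tv λ i' j' → comb Tv λ i″ j″ → Z δ m (sh j″ a) (sh i″ (sh i' k)) x₁ (sh j' y))
      (cong₂ _-_ (cong₂ _+_ (inner (ℤ.pred k) y) (inner k (ℤ.suc y)))
                                            (inner (ℤ.pred k) (ℤ.suc y)))
      where
      inner : ∀ k y → comb Tv (λ i″ j″ → Z δ m (sh j″ a) (sh i″ k) x₁ y) ≡ U (λ a k → Γ a k y) a k
      inner k y = trans (comb-Tv (λ i″ j″ → Z δ m (sh j″ a) (sh i″ k) x₁ y))
        (cong₂ _-_ (cong₂ _+_ (weighted-∇ δ a m (ℤ.pred k) (y ∷ [])) (weighted-∇ δ (ℤ.suc a) m k (y ∷ [])))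
                   (weighted-∇ δ (ℤ.suc a) m (ℤ.pred k) (y ∷ [])))

    diff₃ : ∀ s a f g h x → diff s a (λ x → f x + g x - h x) x ≡ diff s a f x + diff s a g x - diff s a h x
    diff₃ s a f g h x = trans (diff-Linear.L-sub s a x (λ x → f x + g x) h)
      (cong (_- diff s a h x) (diff-Linear.L-add s a x f g))

  coefficient : ℕ → ℕ → ℤ → ℚ
  coefficient u w k = diff up u (λ a → diff dn w (λ y → Γ a k y) x₁) (+ 2)

  coefficient-negative : ∀ u w n → coefficient u w -[1+ n ] ≡ 0ℚ
  coefficient-negative u w n = trans
    (diff-cong up u (λ a → trans (diff-cong dn w (λ y → omissions-negative a m n (y ∷ [])) x₁)
      (diff-Linear.L-zero dn w x₁)) (+ 2))
    (diff-Linear.L-zero up u (+ 2))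

  coefficient-more : ∀ u w p → m ℕ.< p → coefficient u w (+ p) ≡ 0ℚ
  coefficient-more u w p q = trans
    (diff-cong up u (λ a → trans (diff-cong dn w (λ y → omissions-more a m p (y ∷ []) q) x₁)
      (diff-Linear.L-zero dn w x₁)) (+ 2))
    (diff-Linear.L-zero up u (+ 2))

  coefficient≡val : ∀ u w p → p ℕ.≤ m → coefficient u w (+ p) ≡ val (suc u) (suc w) (missing (suc m) p)
  coefficient≡val u w p q = diff-cong up u (λ a → diff-cong dn w (λ y → omissions≡ a m p (y ∷ []) q) x₁) (+ 2)

  private
    V : ℕ → ℤ → ℤ → ℚ
    V w a k = diff dn w (λ y → Γ a k y) x₁

    -- The factor of a in terms of D = id - E: v + (1 - v)(1 - D) = 1 - D + v D.
    diff-U : ∀ u V k → diff up u (λ a → U V a k) (+ 2) ≡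
             diff up u (λ a → V a k) (+ 2) - diff up (suc u) (λ a → V a k) (+ 2)
             + diff up (suc u) (λ a → V a (ℤ.pred k)) (+ 2)
    diff-U u V k = begin
      diff up u (λ a → U V a k) (+ 2)
        ≡⟨ diff₃ up u (λ a → V a (ℤ.pred k)) (λ a → V (ℤ.suc a) k) (λ a → V (ℤ.suc a) (ℤ.pred k)) (+ 2) ⟩
      A′ + diff up u (λ a → V (ℤ.suc a) k) (+ 2) - diff up u (λ a → V (ℤ.suc a) (ℤ.pred k)) (+ 2)
        ≡⟨ cong₂ (λ x y → A′ + x - y) (diff-shift up up u (λ a → V a k) (+ 2))
                                      (diff-shift up up u (λ a → V a (ℤ.pred k)) (+ 2)) ⟩
      A′ + B - B′
        ≡⟨ solve 4 (λ a b a′ b′ → a′ :+ b :- b′ := a :- (a :- b) :+ (a′ :- b′)) refl A B A′ B′ ⟩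
      A - (A - B) + (A′ - B′) ∎
      where
      A = diff up u (λ a → V a k) (+ 2)
      A′ = diff up u (λ a → V a (ℤ.pred k)) (+ 2)
      B = diff up u (λ a → V a k) (+ 3)
      B′ = diff up u (λ a → V a (ℤ.pred k)) (+ 3)

    -- The factor of y in terms of ∇, with the base point moved from m + 1 to m + 2: the shift is
    -- absorbed by the move and the identity becomes 1 - ∇, so that v (1 - ∇) + (1 - v) = 1 - v ∇.
    diff-Ψ : ∀ w a k → diff dn w (λ y → Ψ δ m a y k x₁) x₀ ≡
             U (V w) a k - U (V (suc w)) a (ℤ.pred k)
    diff-Ψ w a k = begin
      diff dn w (λ y → Ψ δ m a y k x₁) x₀
        ≡⟨ diff-cong dn w (λ y → Ψ≡ a y k) x₀ ⟩
      diff dn w (λ y → U (λ a k → Γ a k y) a (ℤ.pred k) + U (λ a k → Γ a k (ℤ.suc y)) a k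
                       - U (λ a k → Γ a k (ℤ.suc y)) a (ℤ.pred k)) x₀
        ≡⟨ diff₃ dn w (λ y → U (λ a k → Γ a k y) a (ℤ.pred k)) (λ y → U (λ a k → Γ a k (ℤ.suc y)) a k)
             (λ y → U (λ a k → Γ a k (ℤ.suc y)) a (ℤ.pred k)) x₀ ⟩
      diff dn w (λ y → U (λ a k → Γ a k y) a (ℤ.pred k)) x₀
        + diff dn w (λ y → U (λ a k → Γ a k (ℤ.suc y)) a k) x₀
        - diff dn w (λ y → U (λ a k → Γ a k (ℤ.suc y)) a (ℤ.pred k)) x₀
        ≡⟨ cong₂ _-_ (cong₂ _+_ (low (ℤ.pred k)) (high k)) (high (ℤ.pred k)) ⟩
      U (λ a k → V w a k - V (suc w) a k) a (ℤ.pred k) + U (V w) a k - U (V w) a (ℤ.pred k)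
        ≡⟨ solve 7 (λ p q r p′ q′ r′ u →
             ((p :- p′) :+ (q :- q′) :- (r :- r′)) :+ u :- (p :+ q :- r) := u :- (p′ :+ q′ :- r′)) refl
             (V w a k″) (V w a⁺ k′) (V w a⁺ k″) (V (suc w) a k″) (V (suc w) a⁺ k′) (V (suc w) a⁺ k″) (U (V w) a k) ⟩
      U (V w) a k - U (V (suc w)) a (ℤ.pred k) ∎
      where
      k′ = ℤ.pred k
      k″ = ℤ.pred k′
      a⁺ = ℤ.suc a
      high : ∀ k → diff dn w (λ y → U (λ a k → Γ a k (ℤ.suc y)) a k) x₀ ≡ U (V w) a k
      high k = trans
        (diff₃ dn w (λ y → Γ a (ℤ.pred k) (ℤ.suc y)) (λ y → Γ (ℤ.suc a) k (ℤ.suc y))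
          (λ y → Γ (ℤ.suc a) (ℤ.pred k) (ℤ.suc y)) x₀)
        (cong₂ _-_ (cong₂ _+_ (diff-shift dn up w (Γ a (ℤ.pred k)) x₀) (diff-shift dn up w (Γ (ℤ.suc a) k) x₀))
                   (diff-shift dn up w (Γ (ℤ.suc a) (ℤ.pred k)) x₀))
      back : ∀ a k → diff dn w (Γ a k) x₀ ≡ V w a k - V (suc w) a k
      back a k = solve 2 (λ p q → q := p :- (p :- q)) refl (V w a k) (diff dn w (Γ a k) x₀)
      low : ∀ k → diff dn w (λ y → U (λ a k → Γ a k y) a k) x₀ ≡ U (λ a k → V w a k - V (suc w) a k) a k
      low k = trans
        (diff₃ dn w (Γ a (ℤ.pred k)) (Γ (ℤ.suc a) k) (Γ (ℤ.suc a) (ℤ.pred k)) x₀)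
        (cong₂ _-_ (cong₂ _+_ (back a (ℤ.pred k)) (back (ℤ.suc a) k)) (back (ℤ.suc a) (ℤ.pred k)))

  -- The six terms are those of (1 - D + v D)(1 - v ∇), read off at vᵖ. One D and one ∇ have already
  -- been spent on `DαL∇`.
  α-differences : ∀ u p w →
    diff up (suc u) (λ a → diff dn p (λ x → diff dn (suc w) (λ y → αL (a ∷ prefix m (x ∷ y ∷ []))) x₀) x₀) (+ 2) ≡
    coefficient u w (+ p) - coefficient (suc u) w (+ p) + coefficient (suc u) w (ℤ.pred (+ p))
    - (coefficient u (suc w) (ℤ.pred (+ p)) - coefficient (suc u) (suc w) (ℤ.pred (+ p))
       + coefficient (suc u) (suc w) (ℤ.pred (ℤ.pred (+ p))))
  α-differences u p w = begin
    diff up (suc u) (λ a → diff dn p (λ x → diff dn (suc w) (F a x) x₀) x₀) (+ 2)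
      ≡⟨ diff-suc up u (λ a → diff dn p (λ x → diff dn (suc w) (F a x) x₀) x₀) (+ 2) ⟩
    diff up u (λ a → diff dn p (λ x → diff dn (suc w) (F a x) x₀) x₀
                     - diff dn p (λ x → diff dn (suc w) (F (ℤ.suc a) x) x₀) x₀) (+ 2)
      ≡⟨ diff-cong up u (λ a → begin
           diff dn p (λ x → diff dn (suc w) (F a x) x₀) x₀
             - diff dn p (λ x → diff dn (suc w) (F (ℤ.suc a) x) x₀) x₀
             ≡⟨ diff-Linear.L-sub dn p x₀ (λ x → diff dn (suc w) (F a x) x₀) (λ x → diff dn (suc w) (F (ℤ.suc a) x) x₀) ⟨
           diff dn p (λ x → diff dn (suc w) (F a x) x₀ - diff dn (suc w) (F (ℤ.suc a) x) x₀) x₀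
             ≡⟨ diff-cong dn p (λ x → trans
                  (sym (diff-Linear.L-sub dn (suc w) x₀ (F a x) (F (ℤ.suc a) x)))
                  (diff-suc dn w (λ y → F a x y - F (ℤ.suc a) x y) x₀)) x₀ ⟩
           diff dn p (λ x → diff dn w (λ y → DαL∇ δ m a x y) x₀) x₀
             ≡⟨ diff-diff dn p dn w (λ x y → DαL∇ δ m a x y) x₀ x₀ ⟩
           diff dn w (λ y → diff dn p (λ x → DαL∇ δ m a x y) x₀) x₀
             ≡⟨ diff-cong dn w (λ y → sym (Ψ-diff a y p x₀)) x₀ ⟩
           diff dn w (λ y → Ψ δ m a y (+ p) x₁) x₀
             ≡⟨ diff-Ψ w a (+ p) ⟩
           U (V w) a (+ p) - U (V (suc w)) a (ℤ.pred (+ p)) ∎) (+ 2) ⟩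
    diff up u (λ a → U (V w) a (+ p) - U (V (suc w)) a (ℤ.pred (+ p))) (+ 2)
      ≡⟨ diff-Linear.L-sub up u (+ 2) (λ a → U (V w) a (+ p)) (λ a → U (V (suc w)) a (ℤ.pred (+ p))) ⟩
    diff up u (λ a → U (V w) a (+ p)) (+ 2) - diff up u (λ a → U (V (suc w)) a (ℤ.pred (+ p))) (+ 2)
      ≡⟨ cong₂ _-_ (diff-U u (V w) (+ p)) (diff-U u (V (suc w)) (ℤ.pred (+ p))) ⟩
    coefficient u w (+ p) - coefficient (suc u) w (+ p) + coefficient (suc u) w (ℤ.pred (+ p))
    - (coefficient u (suc w) (ℤ.pred (+ p)) - coefficient (suc u) (suc w) (ℤ.pred (+ p))
       + coefficient (suc u) (suc w) (ℤ.pred (ℤ.pred (+ p)))) ∎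
    where
    F : ℤ → ℤ → ℤ → ℚ
    F a x y = αL (a ∷ prefix m (x ∷ y ∷ []))

-- Alternating lines

data Step : Bool → ℤ → Bool → Set where
  keep : ∀ {b} → Step b 0ℤ b
  fall : Step true 1ℤ false
  rise : Step false -1ℤ true

-- The lines whose partial sums, started at 1 or 0 as the first argument is false
-- or true, stay in {0, 1} and end with 1.
data AltFrom : ∀ {n} → Bool → Vec ℤ n → Set where
  [] : AltFrom false []
  _∷_ : ∀ {b x b′ n} {v : Vec ℤ n} → Step b x b′ → AltFrom b′ v → AltFrom b (x ∷ v)

missingSum : Bool → ℤ
missingSum true = 1ℤ
missingSum false = 0ℤ

previous : Bool → ℤ
previous true = -1ℤ
previous false = 1ℤ

Σᵥ : ∀ {n} → Vec ℤ n → ℤ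
Σᵥ = Vec.foldr _ ℤ._+_ 0ℤ

Opposite : ℤ → ℤ → Set
Opposite x y = x ≡ ℤ.- y

AltFrom⇒signs : ∀ {n b} {v : Vec ℤ n} → AltFrom b v → All (_∈ signs) v
AltFrom⇒signs [] = []
AltFrom⇒signs (keep ∷ a) = there (there (here refl)) ∷ AltFrom⇒signs a
AltFrom⇒signs (fall ∷ a) = here refl ∷ AltFrom⇒signs a
AltFrom⇒signs (rise ∷ a) = there (here refl) ∷ AltFrom⇒signs a

AltFrom⇒sum : ∀ {n b} {v : Vec ℤ n} → AltFrom b v → Σᵥ v ≡ missingSum b
AltFrom⇒sum [] = refl
AltFrom⇒sum (keep ∷ a) = trans (ℤ.+-identityˡ _) (AltFrom⇒sum a)
AltFrom⇒sum (fall ∷ a) = cong (λ s → 1ℤ ℤ.+ s) (AltFrom⇒sum a)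
AltFrom⇒sum (rise ∷ a) = cong (λ s → -1ℤ ℤ.+ s) (AltFrom⇒sum a)

AltFrom⇒linked : ∀ {n b} {v : Vec ℤ n} → AltFrom b v → Linked Opposite (previous b ∷ nonZeros v)
AltFrom⇒linked [] = [-]
AltFrom⇒linked (keep ∷ a) = AltFrom⇒linked a
AltFrom⇒linked (fall ∷ a) = refl ∷ AltFrom⇒linked a
AltFrom⇒linked (rise ∷ a) = refl ∷ AltFrom⇒linked a

tail : ∀ {x xs} → Linked Opposite (x ∷ xs) → Linked Opposite xs
tail [-] = []
tail (_ ∷ l) = l

AltFrom⇒IsAltLine : ∀ {n} {v : Vec ℤ n} → AltFrom true v → IsAltLine v
AltFrom⇒IsAltLine a = AltFrom⇒signs a , AltFrom⇒sum a , tail (AltFrom⇒linked a)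

sum-1 : ∀ {s t} → 1ℤ ℤ.+ s ≡ 1ℤ ℤ.+ t → s ≡ t
sum-1 {s} {t} = ∙-cancelˡ 1ℤ s t

sum-−1 : ∀ {s t} → -1ℤ ℤ.+ s ≡ -1ℤ ℤ.+ t → s ≡ t
sum-−1 {s} {t} = ∙-cancelˡ -1ℤ s t

sum-0 : ∀ {s t} → 0ℤ ℤ.+ s ≡ t → s ≡ t
sum-0 {s} e = trans (sym (ℤ.+-identityˡ s)) e

⇒AltFrom : ∀ {n} b (v : Vec ℤ n) → All (_∈ signs) v → Σᵥ v ≡ missingSum b →
           Linked Opposite (previous b ∷ nonZeros v) → AltFrom b v
⇒AltFrom false [] _ _ _ = []
⇒AltFrom b (x ∷ v) (there (there (here refl)) ∷ s) e l = keep ∷ ⇒AltFrom b v s (sum-0 e) l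
⇒AltFrom true (x ∷ v) (here refl ∷ s) e (_ ∷ l) = fall ∷ ⇒AltFrom false v s (sum-1 e) l
⇒AltFrom false (x ∷ v) (there (here refl) ∷ s) e (_ ∷ l) = rise ∷ ⇒AltFrom true v s (sum-−1 e) l
⇒AltFrom true (x ∷ v) (there (here refl) ∷ s) e (() ∷ l)
⇒AltFrom false (x ∷ v) (here refl ∷ s) e (() ∷ l)

-- Alternation alone permits -1 as the first non-zero entry. The entries after it would then have to
-- sum to 2, which this bound excludes.
sum-bound : ∀ {n} b (v : Vec ℤ n) → All (_∈ signs) v →
            Linked Opposite (previous b ∷ nonZeros v) → ¬ Σᵥ v ≡ ℤ.suc (missingSum b)
sum-bound true [] _ _ ()
sum-bound false [] _ _ ()
sum-bound b (x ∷ v) (there (there (here refl)) ∷ s) l e = sum-bound b v s l (sum-0 e)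
sum-bound true (x ∷ v) (here refl ∷ s) (_ ∷ l) e = sum-bound false v s l (sum-1 e)
sum-bound false (x ∷ v) (there (here refl) ∷ s) (_ ∷ l) e = sum-bound true v s l (sum-−1 {t = + 2} e)
sum-bound true (x ∷ v) (there (here refl) ∷ s) (() ∷ l) e
sum-bound false (x ∷ v) (here refl ∷ s) (() ∷ l) e

IsAltLine⇒AltFrom : ∀ {n} (v : Vec ℤ n) → IsAltLine v → AltFrom true v
IsAltLine⇒AltFrom (x ∷ v) (there (there (here refl)) ∷ s , e , l) =
  keep ∷ IsAltLine⇒AltFrom v (s , sum-0 e , l)
IsAltLine⇒AltFrom (x ∷ v) (here refl ∷ s , e , l) = fall ∷ ⇒AltFrom false v s (sum-1 e) l
IsAltLine⇒AltFrom (x ∷ v) (there (here refl) ∷ s , e , l) =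
  ⊥-elim (sum-bound true v s l (sum-−1 {t = + 2} e))

-- Columns of a matrix

column : ∀ {r n} → Fin n → Vec (Vec ℤ n) r → Vec ℤ r
column j = Vec.map (λ row → lookup row j)

lookup-transpose : ∀ {r n} (M : Vec (Vec ℤ n) r) j → lookup (Vec.transpose M) j ≡ column j M
lookup-transpose [] j = Vec.lookup-replicate j []
lookup-transpose {n = n} (row ∷ M) j = begin
  lookup ((Vec.replicate n Vec._∷_ Vec.⊛ row) Vec.⊛ Vec.transpose M) j
    ≡⟨ Vec.lookup-⊛ j (Vec.replicate n Vec._∷_ Vec.⊛ row) (Vec.transpose M) ⟩
  lookup (Vec.replicate n Vec._∷_ Vec.⊛ row) j (lookup (Vec.transpose M) j)
    ≡⟨ cong₂ (λ f v → f v) (Vec.lookup-⊛ j (Vec.replicate n Vec._∷_) row) (lookup-transpose M j) ⟩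
  lookup (Vec.replicate n Vec._∷_) j (lookup row j) (column j M)
    ≡⟨ cong (λ f → f (lookup row j) (column j M)) (Vec.lookup-replicate j Vec._∷_) ⟩
  lookup row j ∷ column j M ∎

positive : ℕ → Bool
positive zero = false
positive (suc _) = true

-- The admissible entries of an outer column. The number is the row of its 1, counted from the
-- present row, or 0 once that row has been passed.
hit : ℕ → ℤ → Bool
hit 1 (+ 1) = true
hit 1 _ = false
hit _ (+ 0) = true
hit _ _ = false

data Hit : ℕ → ℤ → Set where
  now : Hit 1 1ℤ
  past : Hit 0 0ℤ
  later : ∀ {a} → Hit (suc (suc a)) 0ℤ

hit⇒Hit : ∀ a x → T (hit a x) → Hit a x
hit⇒Hit 0 (+ 0) _ = past
hit⇒Hit 1 (+ 1) _ = now
hit⇒Hit (suc (suc a)) (+ 0) _ = later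

Hit⇒hit : ∀ {a x} → Hit a x → T (hit a x)
Hit⇒hit now = tt
Hit⇒hit past = tt
Hit⇒hit later = tt

-- the a-th unit vector, or zero if a = 0
data Unit : ∀ {r} → ℕ → Vec ℤ r → Set where
  [] : Unit 0 []
  _∷_ : ∀ {a x r} {v : Vec ℤ r} → Hit a x → Unit (pred a) v → Unit a (x ∷ v)

NonNegative : ∀ {r} → Vec ℤ r → Set
NonNegative v = ∀ p → lookup v p ≢ -1ℤ

zeros : ∀ {r} {v : Vec ℤ r} → AltFrom false v → NonNegative v → Unit 0 v
zeros [] n = []
zeros (keep ∷ a) n = past ∷ zeros a (λ p → n (suc p))
zeros (rise ∷ a) n = ⊥-elim (n zero refl)

Unit-0-no-one : ∀ {r} {v : Vec ℤ r} → Unit 0 v → ∀ p → lookup v p ≢ 1ℤ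
Unit-0-no-one (past ∷ u) zero ()
Unit-0-no-one (past ∷ u) (suc p) e = Unit-0-no-one u p e

⇒Unit : ∀ {r} {v : Vec ℤ r} → AltFrom true v → NonNegative v → ∀ p → lookup v p ≡ 1ℤ → Unit (pos p) v
⇒Unit (fall ∷ a) n zero e = now ∷ zeros a (λ p → n (suc p))
⇒Unit (keep ∷ a) n (suc p) e = later ∷ ⇒Unit a (λ p → n (suc p)) p e
⇒Unit (fall ∷ a) n (suc p) e = ⊥-elim (Unit-0-no-one (zeros a (λ p → n (suc p))) p e)

Unit⇒AltFrom : ∀ {r a} {v : Vec ℤ r} → Unit a v → AltFrom (positive a) v
Unit⇒AltFrom [] = []
Unit⇒AltFrom (now ∷ u) = fall ∷ Unit⇒AltFrom u
Unit⇒AltFrom (past ∷ u) = keep ∷ Unit⇒AltFrom u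
Unit⇒AltFrom (later ∷ u) = keep ∷ Unit⇒AltFrom u

Unit⇒one : ∀ {r a} {v : Vec ℤ r} → Unit (suc a) v → ∃ λ p → pos p ≡ suc a × lookup v p ≡ 1ℤ
Unit⇒one (now ∷ u) = zero , refl , refl
Unit⇒one (later ∷ u) = let p , e , q = Unit⇒one u in suc p , cong suc e , q

-- A row whose partial sums stay in {0, 1} and end with 1 cannot begin with -1, nor end with it.
-- Hence the outer columns of an alternating sign matrix are unit vectors.
first-nonNegative : ∀ {n} {v : Vec ℤ (suc n)} → AltFrom true v → lookup v zero ≢ -1ℤ
first-nonNegative (keep ∷ _) ()
first-nonNegative (fall ∷ _) ()

last-nonNegative : ∀ {n b} {v : Vec ℤ (suc n)} → AltFrom b v → lookup v (fromℕ n) ≢ -1ℤ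
last-nonNegative {zero} (keep ∷ []) ()
last-nonNegative {zero} (fall ∷ []) ()
last-nonNegative {suc n} (_ ∷ a) = last-nonNegative a

-- Counting alternating sign matrices

T-∧ : ∀ {x y} → T (x ∧ y) → T x × T y
T-∧ {true} t = tt , t

∧-T : ∀ {x y} → T x → T y → T (x ∧ y)
∧-T {true} _ t = t

-- Reads a row without its first entry: σ is the state of the row, K and the argument
-- of κ are the states of the inner columns before and after the row.
reads : ∀ {m} → Bool → ℕ → Vec Bool m → Vec ℤ (suc m) → (Vec Bool m → Bool) → Bool
reads σ b [] (y ∷ []) κ = hit b y ∧ (does (σ Bool.≟ rightState b) ∧ κ [])
reads σ b (k ∷ K) (+ 0 ∷ xs) κ = reads σ b K xs (λ L → κ (k ∷ L))
reads true b (true ∷ K) (+ 1 ∷ xs) κ = reads false b K xs (λ L → κ (false ∷ L))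
reads false b (false ∷ K) (-[1+ 0 ] ∷ xs) κ = reads true b K xs (λ L → κ (true ∷ L))
reads _ _ (_ ∷ _) (_ ∷ _) κ = false

-- Reads the matrix from the top. An inner column belongs to K as long as its partial sum is 0, so
-- successive K are the rows of a monotone triangle from its bottom row on, and each matrix row is
-- the difference of two of them. The outer columns are described by `a` and `b`.
test : ∀ {m r} → ℕ → ℕ → Vec Bool m → Vec (Vec ℤ (2 ℕ.+ m)) r → Bool
test a b K [] = (a ℕ.≡ᵇ 0) ∧ ((b ℕ.≡ᵇ 0) ∧ (∣ K ∣ₜ ℕ.≡ᵇ 0))
test a b K ((x ∷ xs) ∷ M) = hit a x ∧ reads (leftState a) b K xs (λ L → test (pred a) (pred b) L M)

data Reads : ∀ {m} → Bool → ℕ → Vec Bool m → Vec ℤ (suc m) → Vec Bool m → Set where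
  last : ∀ {b y} → Hit b y → Reads (rightState b) b [] (y ∷ []) []
  keep : ∀ {m σ b k} {K L : Vec Bool m} {xs} → Reads σ b K xs L → Reads σ b (k ∷ K) (0ℤ ∷ xs) (k ∷ L)
  fall : ∀ {m b} {K L : Vec Bool m} {xs} → Reads false b K xs L → Reads true b (true ∷ K) (1ℤ ∷ xs) (false ∷ L)
  rise : ∀ {m b} {K L : Vec Bool m} {xs} → Reads true b K xs L → Reads false b (false ∷ K) (-1ℤ ∷ xs) (true ∷ L)

reads-sound : ∀ {m} σ b (K : Vec Bool m) xs κ → T (reads σ b K xs κ) → ∃ λ L → Reads σ b K xs L × T (κ L)
reads-sound σ b [] (y ∷ []) κ t with σ Bool.≟ rightState b
... | yes refl = let h , t′ = T-∧ t in [] , last (hit⇒Hit b y h) , t′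
... | no _ = ⊥-elim (proj₂ (T-∧ {hit b y} t))
reads-sound σ b (k ∷ K) (+ 0 ∷ xs) κ t =
  let L , r , t′ = reads-sound σ b K xs (λ L → κ (k ∷ L)) t in k ∷ L , keep r , t′
reads-sound true b (true ∷ K) (+ 1 ∷ xs) κ t =
  let L , r , t′ = reads-sound false b K xs (λ L → κ (false ∷ L)) t in false ∷ L , fall r , t′
reads-sound false b (false ∷ K) (-[1+ 0 ] ∷ xs) κ t =
  let L , r , t′ = reads-sound true b K xs (λ L → κ (true ∷ L)) t in true ∷ L , rise r , t′
reads-sound true b (false ∷ K) (+ 1 ∷ xs) κ ()
reads-sound false b (true ∷ K) (+ 1 ∷ xs) κ ()
reads-sound false b (false ∷ K) (+ 1 ∷ xs) κ ()
reads-sound true b (true ∷ K) (+ suc (suc _) ∷ xs) κ ()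
reads-sound true b (false ∷ K) (+ suc (suc _) ∷ xs) κ ()
reads-sound false b (true ∷ K) (+ suc (suc _) ∷ xs) κ ()
reads-sound false b (false ∷ K) (+ suc (suc _) ∷ xs) κ ()
reads-sound true b (true ∷ K) (-[1+ _ ] ∷ xs) κ ()
reads-sound true b (false ∷ K) (-[1+ _ ] ∷ xs) κ ()
reads-sound false b (true ∷ K) (-[1+ _ ] ∷ xs) κ ()
reads-sound false b (false ∷ K) (-[1+ suc _ ] ∷ xs) κ ()

reads-complete : ∀ {m σ b} {K : Vec Bool m} {xs L} → Reads σ b K xs L → ∀ κ → T (κ L) → T (reads σ b K xs κ)
reads-complete {b = b} (last h) κ t = ∧-T (Hit⇒hit h)
  (∧-T {does (rightState b Bool.≟ rightState b)}
    (subst T (sym (dec-true (rightState b Bool.≟ rightState b) refl)) tt) t)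
reads-complete (keep {k = k} r) κ t = reads-complete r (λ L → κ (k ∷ L)) t
reads-complete (fall r) κ t = reads-complete r (λ L → κ (false ∷ L)) t
reads-complete (rise r) κ t = reads-complete r (λ L → κ (true ∷ L)) t

Reads⇒AltFrom : ∀ {m σ b} {K : Vec Bool m} {xs L} → Reads σ b K xs L → AltFrom σ xs
Reads⇒AltFrom (last now) = fall ∷ []
Reads⇒AltFrom (last past) = keep ∷ []
Reads⇒AltFrom (last later) = keep ∷ []
Reads⇒AltFrom (keep r) = keep ∷ Reads⇒AltFrom r
Reads⇒AltFrom (fall r) = fall ∷ Reads⇒AltFrom r
Reads⇒AltFrom (rise r) = rise ∷ Reads⇒AltFrom r

Reads⇒Hit : ∀ {m σ b} {K : Vec Bool m} {xs L} → Reads σ b K xs L → Hit b (lookup xs (fromℕ m))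
Reads⇒Hit (last h) = h
Reads⇒Hit (keep r) = Reads⇒Hit r
Reads⇒Hit (fall r) = Reads⇒Hit r
Reads⇒Hit (rise r) = Reads⇒Hit r

Reads⇒Step : ∀ {m σ b} {K : Vec Bool m} {xs L} → Reads σ b K xs L →
             ∀ j → Step (lookup K j) (lookup xs (inject₁ j)) (lookup L j)
Reads⇒Step (keep r) zero = keep
Reads⇒Step (fall r) zero = fall
Reads⇒Step (rise r) zero = rise
Reads⇒Step (keep r) (suc j) = Reads⇒Step r j
Reads⇒Step (fall r) (suc j) = Reads⇒Step r j
Reads⇒Step (rise r) (suc j) = Reads⇒Step r j

⇒Reads : ∀ {m σ b} (K : Vec Bool m) (xs : Vec ℤ (suc m)) (L : Vec Bool m) → AltFrom σ xs →
         (∀ j → Step (lookup K j) (lookup xs (inject₁ j)) (lookup L j)) →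
         Hit b (lookup xs (fromℕ m)) → Reads σ b K xs L
⇒Reads [] (y ∷ []) [] (keep ∷ []) s past = last past
⇒Reads [] (y ∷ []) [] (keep ∷ []) s later = last later
⇒Reads [] (y ∷ []) [] (fall ∷ []) s now = last now
⇒Reads (k ∷ K) (x ∷ xs) (l ∷ L) (s₀ ∷ a) s h with s₀ | s zero
... | keep | keep = keep (⇒Reads K xs L a (λ j → s (suc j)) h)
... | fall | fall = fall (⇒Reads K xs L a (λ j → s (suc j)) h)
... | rise | rise = rise (⇒Reads K xs L a (λ j → s (suc j)) h)

data Test : ∀ {m r} → ℕ → ℕ → Vec Bool m → Vec (Vec ℤ (2 ℕ.+ m)) r → Set where
  [] : ∀ {m} {K : Vec Bool m} → ∣ K ∣ₜ ≡ 0 → Test 0 0 K []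
  step : ∀ {m r a b x xs} {K L : Vec Bool m} {M : Vec _ r} →
         Hit a x → Reads (leftState a) b K xs L → Test (pred a) (pred b) L M → Test a b K ((x ∷ xs) ∷ M)

test-sound : ∀ {m r} a b (K : Vec Bool m) (M : Vec (Vec ℤ (2 ℕ.+ m)) r) → T (test a b K M) → Test a b K M
test-sound zero zero K [] t = [] (ℕ.≡ᵇ⇒≡ ∣ K ∣ₜ 0 t)
test-sound a b K ((x ∷ xs) ∷ M) t =
  let h , t′ = T-∧ {hit a x} t
      L , r , t″ = reads-sound (leftState a) b K xs (λ L → test (pred a) (pred b) L M) t′
  in step (hit⇒Hit a x h) r (test-sound (pred a) (pred b) L M t″)

test-complete : ∀ {m r a b} {K : Vec Bool m} {M : Vec (Vec ℤ (2 ℕ.+ m)) r} → Test a b K M → T (test a b K M)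
test-complete {K = K} ([] e) = ℕ.≡⇒≡ᵇ ∣ K ∣ₜ 0 e
test-complete {a = a} {b} {M = _ ∷ M} (step h r t) =
  ∧-T (Hit⇒hit h) (reads-complete r (λ L → test (pred a) (pred b) L M) (test-complete t))

record Constraints {m r} (a b : ℕ) (K : Vec Bool m) (M : Vec (Vec ℤ (2 ℕ.+ m)) r) : Set where
  constructor constraints
  field
    rows  : All (AltFrom true) M
    left  : Unit a (column zero M)
    right : Unit b (column (fromℕ (suc m)) M)
    inner : ∀ j → AltFrom (lookup K j) (column (suc (inject₁ j)) M)

no-entries : ∀ {m} (K : Vec Bool m) → ∣ K ∣ₜ ≡ 0 → ∀ j → lookup K j ≡ false
no-entries (false ∷ K) e zero = refl
no-entries (false ∷ K) e (suc j) = no-entries K e j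

no-entries⁻¹ : ∀ {m} (K : Vec Bool m) → (∀ j → lookup K j ≡ false) → ∣ K ∣ₜ ≡ 0
no-entries⁻¹ [] e = refl
no-entries⁻¹ (false ∷ K) e = no-entries⁻¹ K (λ j → e (suc j))
no-entries⁻¹ (true ∷ K) e with () ← e zero

Hit⇒Step : ∀ {a x} → Hit a x → Step true x (leftState a)
Hit⇒Step now = fall
Hit⇒Step past = keep
Hit⇒Step later = keep

Test⇒Constraints : ∀ {m r a b} {K : Vec Bool m} {M : Vec (Vec ℤ (2 ℕ.+ m)) r} →
                   Test a b K M → Constraints a b K M
Test⇒Constraints {K = K} ([] e) =
  constraints [] [] [] λ j → subst (λ k → AltFrom k []) (sym (no-entries K e j)) []
Test⇒Constraints (step h r t) = constraints
  ((Hit⇒Step h ∷ Reads⇒AltFrom r) ∷ rows)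
  (h ∷ left)
  (Reads⇒Hit r ∷ right)
  (λ j → Reads⇒Step r j ∷ inner j)
  where open Constraints (Test⇒Constraints t)

AltFrom-[] : ∀ {b} → AltFrom b [] → b ≡ false
AltFrom-[] [] = refl

Constraints⇒Test : ∀ {m r} a b (K : Vec Bool m) (M : Vec (Vec ℤ (2 ℕ.+ m)) r) →
                   Constraints a b K M → Test a b K M
Constraints⇒Test a b K [] (constraints [] [] [] i) = [] (no-entries⁻¹ K λ j → AltFrom-[] (i j))
Constraints⇒Test {m} a b K ((x ∷ xs) ∷ M) (constraints ((s ∷ al) ∷ rows) (h ∷ left) (h′ ∷ right) i) =
  step h (⇒Reads K xs L (al′ s h al) steps h′)
    (Constraints⇒Test (pred a) (pred b) L M (constraints rows left right inner))
  where
  al′ : ∀ {a x σ} → Step true x σ → Hit a x → AltFrom σ xs → AltFrom (leftState a) xs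
  al′ keep past al = al
  al′ keep later al = al
  al′ fall now al = al
  next : ∀ {b x r} {v : Vec ℤ r} → AltFrom b (x ∷ v) → ∃ λ b′ → Step b x b′ × AltFrom b′ v
  next (s ∷ a) = _ , s , a
  L : Vec Bool m
  L = Vec.tabulate λ j → proj₁ (next (i j))
  steps : ∀ j → Step (lookup K j) (lookup xs (inject₁ j)) (lookup L j)
  steps j rewrite Vec.lookup∘tabulate (λ j → proj₁ (next (i j))) j = proj₁ (proj₂ (next (i j)))
  inner : ∀ j → AltFrom (lookup L j) (column (suc (inject₁ j)) M)
  inner j rewrite Vec.lookup∘tabulate (λ j → proj₁ (next (i j))) j = proj₂ (proj₂ (next (i j)))

isOne : ∀ {n} → ℕ → Vec ℤ n → Bool
isOne _ [] = false
isOne zero (x ∷ _) = hit 1 x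
isOne (suc p) (_ ∷ xs) = isOne p xs

firstOne : ∀ {n} → ℕ → Vec ℤ n → Bool
firstOne zero row = false
firstOne (suc i) row = isOne i row

isOne-sound : ∀ {n} p (v : Vec ℤ n) → T (isOne p v) → ∃ λ q → toℕ q ≡ p × lookup v q ≡ 1ℤ
isOne-sound zero (x ∷ v) t with now ← hit⇒Hit 1 x t = zero , refl , refl
isOne-sound (suc p) (x ∷ v) t = let q , e , o = isOne-sound p v t in suc q , cong suc e , o

firstOne-sound : ∀ {n} i (v : Vec ℤ n) → T (firstOne i v) → ∃ λ q → pos q ≡ i × lookup v q ≡ 1ℤ
firstOne-sound (suc i) v t = let q , e , o = isOne-sound i v t in q , cong suc e , o

isOne-complete : ∀ {n} (v : Vec ℤ n) q → lookup v q ≡ 1ℤ → T (isOne (toℕ q) v)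
isOne-complete (x ∷ v) zero refl = tt
isOne-complete (x ∷ v) (suc q) e = isOne-complete v q e

module _ {m : ℕ} (u w i : ℕ) (row : Vec ℤ (2 ℕ.+ m)) (M : Vec (Vec ℤ (2 ℕ.+ m)) (1 ℕ.+ m)) where

  private
    N : Matrix (2 ℕ.+ m)
    N = row ∷ M
    full : Vec Bool m
    full = Vec.replicate m true

  refined⇒ : IsRefinedASM (suc u) i (suc w) N → T (firstOne i row ∧ test (suc u) (suc w) full N)
  refined⇒ ((R , S) , (p , zero , refl , _ , o₁) , (zero , q , _ , refl , o₂) , (p′ , q′ , refl , e , o₃)) =
    ∧-T {firstOne i row} (isOne-complete row q o₂)
      (test-complete (Constraints⇒Test (suc u) (suc w) full N (constraints rows
        (⇒Unit (columns zero) (λ p → subst (_≢ -1ℤ) (sym (Vec.lookup-map p _ N)) (first-nonNegative (All.lookup⁺ rows p)))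
               p (trans (Vec.lookup-map p _ N) o₁))
        (⇒Unit (columns (fromℕ (suc m))) (λ p → subst (_≢ -1ℤ) (sym (Vec.lookup-map p _ N)) (last-nonNegative (All.lookup⁺ rows p)))
               p′ (trans (Vec.lookup-map p′ _ N) (subst (λ q → lookup (lookup N p′) q ≡ 1ℤ) q′≡ o₃)))
        λ j → subst (λ b → AltFrom b (column (suc (inject₁ j)) N)) (sym (Vec.lookup-replicate j true))
                    (columns (suc (inject₁ j))))))
    where
    rows : All (AltFrom true) N
    rows = All.map (λ {v} → IsAltLine⇒AltFrom v) R
    columns : ∀ j → AltFrom true (column j N)
    columns j = subst (AltFrom true) (lookup-transpose N j)
      (All.lookup⁺ (All.map (λ {v} → IsAltLine⇒AltFrom v) S) j)
    q′≡ : q′ ≡ fromℕ (suc m)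
    q′≡ = Fin.toℕ-injective (trans (ℕ.suc-injective e) (sym (Fin.toℕ-fromℕ (suc m))))

  refined⇐ : T (firstOne i row ∧ test (suc u) (suc w) full N) → IsRefinedASM (suc u) i (suc w) N
  refined⇐ t =
    let t₁ , t₂ = T-∧ {firstOne i row} t
        q , e , o = firstOne-sound i row t₁
        open Constraints (Test⇒Constraints (test-sound (suc u) (suc w) full N t₂))
        p₁ , e₁ , o₁ = Unit⇒one left
        p₂ , e₂ , o₂ = Unit⇒one right
        columns : ∀ j → AltFrom true (column j N)
        columns = λ { zero → Unit⇒AltFrom left
                    ; (suc j) → inner-columns inner (Unit⇒AltFrom right) j }
    in (All.map AltFrom⇒IsAltLine rows ,
        All.lookup⁻ (λ j → AltFrom⇒IsAltLine (subst (AltFrom true) (sym (lookup-transpose N j)) (columns j)))) ,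
       (p₁ , zero , e₁ , refl , trans (sym (Vec.lookup-map p₁ _ N)) o₁) ,
       (zero , q , refl , e , o) ,
       (p₂ , fromℕ (suc m) , e₂ , cong suc (Fin.toℕ-fromℕ (suc m)) , trans (sym (Vec.lookup-map p₂ _ N)) o₂)
    where
    inner-columns : (∀ j → AltFrom (lookup full j) (column (suc (inject₁ j)) N)) →
                    AltFrom true (column (fromℕ (suc m)) N) → ∀ j → AltFrom true (column (suc j) N)
    inner-columns inner right j with view j
    ... | ‵fromℕ = right
    ... | ‵inject₁ j = subst (λ b → AltFrom b (column (suc (inject₁ j)) N)) (Vec.lookup-replicate j true) (inner j)

  refined≡ : does (isRefinedASM? (suc u) i (suc w) N) ≡ firstOne i row ∧ test (suc u) (suc w) full N
  refined≡ with firstOne i row ∧ test (suc u) (suc w) full N in eq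
  ... | true = dec-true (isRefinedASM? (suc u) i (suc w) N) (refined⇐ (subst T (sym eq) tt))
  ... | false = dec-false (isRefinedASM? (suc u) i (suc w) N) (λ r → subst T eq (refined⇒ r))

-- Counting as summation over lists

∑ : {A : Set} → List A → (A → ℚ) → ℚ
∑ [] f = 0ℚ
∑ (x ∷ xs) f = f x + ∑ xs f

∑-cong : {A : Set} (xs : List A) {f g : A → ℚ} → (∀ x → f x ≡ g x) → ∑ xs f ≡ ∑ xs g
∑-cong [] e = refl
∑-cong (x ∷ xs) e = cong₂ _+_ (e x) (∑-cong xs e)

∑-zero : {A : Set} (xs : List A) → ∑ xs (λ _ → 0ℚ) ≡ 0ℚ
∑-zero [] = refl
∑-zero (x ∷ xs) = trans (ℚ.+-identityˡ (∑ xs (λ _ → 0ℚ))) (∑-zero xs)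

∑-++ : {A : Set} (xs ys : List A) (f : A → ℚ) → ∑ (xs List.++ ys) f ≡ ∑ xs f + ∑ ys f
∑-++ [] ys f = sym (ℚ.+-identityˡ (∑ ys f))
∑-++ (x ∷ xs) ys f = trans (cong (λ z → f x + z) (∑-++ xs ys f)) (sym (ℚ.+-assoc (f x) (∑ xs f) (∑ ys f)))

∑-map : {A B : Set} (h : A → B) (xs : List A) (f : B → ℚ) → ∑ (List.map h xs) f ≡ ∑ xs (λ x → f (h x))
∑-map h [] f = refl
∑-map h (x ∷ xs) f = cong (λ z → f (h x) + z) (∑-map h xs f)

∑-product : {A B D : Set} (h : A → B → D) (xs : List A) (ys : List B) (f : D → ℚ) →
  ∑ (List.cartesianProductWith h xs ys) f ≡ ∑ xs (λ x → ∑ ys (λ y → f (h x y)))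
∑-product h [] ys f = refl
∑-product h (x ∷ xs) ys f = trans (∑-++ (List.map (h x) ys) (List.cartesianProductWith h xs ys) f)
  (cong₂ _+_ (∑-map (h x) ys f) (∑-product h xs ys f))

ind : Bool → ℚ
ind true = 1ℚ
ind false = 0ℚ

count≡∑ : {A : Set} {Q : A → Set} (Q? : ∀ x → Dec (Q x)) (xs : List A) →
  fromℤ (+ (List.length (List.filter Q? xs))) ≡ ∑ xs (λ x → ind (does (Q? x)))
count≡∑ Q? [] = refl
count≡∑ Q? (x ∷ xs) with does (Q? x)
... | true = trans (fromℤ-+ 1ℤ (+ (List.length (List.filter Q? xs)))) (cong (λ z → 1ℚ + z) (count≡∑ Q? xs))
... | false = trans (count≡∑ Q? xs) (sym (ℚ.+-identityˡ _))

lines : ∀ m → List (Vec ℤ m)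
lines = allVecs signs

∑-lines : ∀ m (f : Vec ℤ (suc m) → ℚ) → ∑ (lines (suc m)) f ≡
  ∑ (lines m) (λ xs → f (1ℤ ∷ xs)) + (∑ (lines m) (λ xs → f (-1ℤ ∷ xs)) + ∑ (lines m) (λ xs → f (0ℤ ∷ xs)))
∑-lines m f = trans (∑-product _∷_ signs (lines m) f)
  (solve 3 (λ a b c → a :+ (b :+ (c :+ con 0ℚ)) := a :+ (b :+ c)) refl
    (∑ (lines m) (λ xs → f (1ℤ ∷ xs))) (∑ (lines m) (λ xs → f (-1ℤ ∷ xs))) (∑ (lines m) (λ xs → f (0ℤ ∷ xs))))

add₁ : ∀ {a b c x : ℚ} → a ≡ x → b ≡ 0ℚ → c ≡ 0ℚ → a + (b + c) ≡ x
add₁ {x = x} refl refl refl = solve 1 (λ x → x :+ (con 0ℚ :+ con 0ℚ) := x) refl x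

add₃ : ∀ {a b c x : ℚ} → a ≡ 0ℚ → b ≡ 0ℚ → c ≡ x → a + (b + c) ≡ x
add₃ {x = x} refl refl refl = solve 1 (λ x → con 0ℚ :+ (con 0ℚ :+ x) := x) refl x

add₁₃ : ∀ {a b c x y : ℚ} → a ≡ x → b ≡ 0ℚ → c ≡ y → a + (b + c) ≡ y + x
add₁₃ {x = x} {y} refl refl refl = solve 2 (λ x y → x :+ (con 0ℚ :+ y) := y :+ x) refl x y

add₂₃ : ∀ {a b c x y : ℚ} → a ≡ 0ℚ → b ≡ x → c ≡ y → a + (b + c) ≡ y + x
add₂₃ {x = x} {y} refl refl refl = solve 2 (λ x y → con 0ℚ :+ (x :+ y) := y :+ x) refl x y

module _ {B : Set} (Ms : List B) where

  count-in : (B → Bool) → ℚ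
  count-in f = ∑ Ms (λ M → ind (f M))

  none : count-in (λ _ → false) ≡ 0ℚ
  none = ∑-zero Ms

  nowhere : ∀ m → ∑ (lines m) (λ _ → count-in (λ _ → false)) ≡ 0ℚ
  nowhere m = trans (∑-cong (lines m) (λ _ → none)) (∑-zero (lines m))

  nowhere′ : ∀ m {f : Vec ℤ m → B → Bool} → (∀ xs M → f xs M ≡ false) →
             ∑ (lines m) (λ xs → count-in (f xs)) ≡ 0ℚ
  nowhere′ m e = trans (∑-cong (lines m) (λ xs → ∑-cong Ms (λ M → cong ind (e xs M)))) (nowhere m)

  private
    single : ∀ x → x + 0ℚ ≡ x
    single = ℚ.+-identityʳ

  -- An entry 1, -1 or 0 says whether its column leaves K, enters it or stays as it is. Choosing the
  -- matrix row is thus choosing L, under the interlacing condition of `tot`.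
  ∑-reads : ∀ {m} σ b (K : Vec Bool m) (t : Vec Bool m → B → Bool) →
    ∑ (lines (suc m)) (λ xs → count-in (λ M → reads σ b K xs (λ L → t L M))) ≡
    tot σ (rightState b) K (λ L → count-in (t L))
  ∑-reads σ b [] t = trans (∑-lines 0 (λ xs → count-in (λ M → reads σ b [] xs (λ L → t L M)))) (base b)
    where
    X : ℕ → ℤ → ℚ
    X b y = ∑ (lines 0) (λ xs → count-in (λ M → hit b y ∧ (does (σ Bool.≟ rightState b) ∧ t [] M)))
    miss : ∑ (lines 0) (λ _ → count-in (λ _ → false)) ≡ 0ℚ
    miss = nowhere 0
    score : ∀ c → ∑ (lines 0) (λ _ → count-in (λ M → c ∧ t [] M)) ≡ (if c then count-in (t []) else 0ℚ)
    score true = single (count-in (t []))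
    score false = nowhere 0
    base : ∀ b → X b 1ℤ + (X b -1ℤ + X b 0ℤ) ≡ (if does (σ Bool.≟ rightState b) then count-in (t []) else 0ℚ)
    base 0 = add₃ miss miss (score (does (σ Bool.≟ false)))
    base 1 = add₁ (score (does (σ Bool.≟ true))) miss miss
    base (suc (suc b)) = add₃ miss miss (score (does (σ Bool.≟ false)))
  ∑-reads {suc m} true b (true ∷ K) t = trans
    (∑-lines (suc m) (λ xs → count-in (λ M → reads true b (true ∷ K) xs (λ L → t L M))))
    (add₁₃ (∑-reads false b K (λ L → t (false ∷ L))) (nowhere (suc m)) (∑-reads true b K (λ L → t (true ∷ L))))
  ∑-reads {suc m} true b (false ∷ K) t = trans
    (∑-lines (suc m) (λ xs → count-in (λ M → reads true b (false ∷ K) xs (λ L → t L M))))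
    (add₃ (nowhere (suc m)) (nowhere (suc m)) (∑-reads true b K (λ L → t (false ∷ L))))
  ∑-reads {suc m} false b (true ∷ K) t = trans
    (∑-lines (suc m) (λ xs → count-in (λ M → reads false b (true ∷ K) xs (λ L → t L M))))
    (add₃ (nowhere (suc m)) (nowhere (suc m)) (∑-reads false b K (λ L → t (true ∷ L))))
  ∑-reads {suc m} false b (false ∷ K) t = trans
    (∑-lines (suc m) (λ xs → count-in (λ M → reads false b (false ∷ K) xs (λ L → t L M))))
    (add₂₃ (nowhere (suc m)) (∑-reads true b K (λ L → t (true ∷ L))) (∑-reads false b K (λ L → t (false ∷ L))))

  tot-full : ∀ m (f : Vec Bool m → ℚ) → tot false false (Vec.replicate m true) f ≡ f (Vec.replicate m true)
  tot-full zero f = refl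
  tot-full (suc m) f = tot-full m (λ L → f (true ∷ L))

  -- In state false another 1 is not allowed, and columns that still lie in K do not allow -1. After
  -- its single 1 the first row is therefore zero.
  no-second-one : ∀ {m} p b (xs : Vec ℤ (suc m)) κ →
    isOne p xs ∧ reads false (suc (suc b)) (Vec.replicate m true) xs κ ≡ false
  no-second-one {zero} zero b (+ 0 ∷ []) κ = refl
  no-second-one {zero} zero b (+ 1 ∷ []) κ = refl
  no-second-one {zero} zero b (+ suc (suc _) ∷ []) κ = refl
  no-second-one {zero} zero b (-[1+ _ ] ∷ []) κ = refl
  no-second-one {zero} (suc p) b (_ ∷ []) κ = refl
  no-second-one {suc m} zero b (+ 0 ∷ xs) κ = refl
  no-second-one {suc m} (suc p) b (+ 0 ∷ xs) κ = no-second-one p b xs (λ L → κ (true ∷ L))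
  no-second-one {suc m} p b (+ 1 ∷ xs) κ = Bool.∧-zeroʳ (isOne p (1ℤ ∷ xs))
  no-second-one {suc m} p b (+ suc (suc n) ∷ xs) κ = Bool.∧-zeroʳ (isOne p (+ (suc (suc n)) ∷ xs))
  no-second-one {suc m} p b (-[1+ n ] ∷ xs) κ = Bool.∧-zeroʳ (isOne p (-[1+ n ] ∷ xs))

  private
    first-row : ∀ m p b (t : Vec Bool m → B → Bool) → Vec ℤ (suc m) → ℚ
    first-row m p b t xs = count-in λ M →
      isOne p xs ∧ reads true (suc (suc b)) (Vec.replicate m true) xs (λ L → t L M)

  -- All inner columns lie in K at the start, so the first row is a single 1 and removes its own
  -- column. A 1 in the last column is excluded by `suc (suc b)`, which places the 1 of that column
  -- in a later row.
  ∑-first-row : ∀ m p b (t : Vec Bool m → B → Bool) →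
    ∑ (lines (suc m)) (first-row m p b t) ≡
    (if p ℕ.<ᵇ m then count-in (t (missing m p)) else 0ℚ)
  ∑-first-row zero zero b t = trans (∑-lines 0 (first-row zero zero b t)) (add₃ (nowhere 0) (nowhere 0) (nowhere 0))
  ∑-first-row zero (suc p) b t = trans (∑-lines 0 (first-row zero (suc p) b t)) (add₃ (nowhere 0) (nowhere 0) (nowhere 0))
  ∑-first-row (suc m) zero b t = trans (∑-lines (suc m) (first-row (suc m) zero b t))
    (add₁ (trans (∑-reads false (suc (suc b)) (Vec.replicate m true) (λ L → t (false ∷ L)))
                 (tot-full m (λ L → count-in (t (false ∷ L)))))
          (nowhere (suc m)) (nowhere (suc m)))
  ∑-first-row (suc m) (suc p) b t = trans (∑-lines (suc m) (first-row (suc m) (suc p) b t))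
    (add₃ (nowhere′ (suc m) (λ xs M → no-second-one p b xs (λ L → t (false ∷ L) M)))
          (nowhere′ (suc m) (λ xs M → Bool.∧-zeroʳ (isOne p xs)))
          (∑-first-row m p b (λ L → t (true ∷ L))))

∑-test : ∀ m r a b (K : Vec Bool m) →
  ∑ (allVecs (lines (2 ℕ.+ m)) r) (λ M → ind (test a b K M)) ≡ triangles r a b K
∑-test m zero zero zero K with ∣ K ∣ₜ ℕ.≡ᵇ 0
... | true = refl
... | false = refl
∑-test m zero zero (suc b) K = refl
∑-test m zero (suc a) b K = refl
∑-test m (suc r) a b K = begin
  ∑ (allVecs (lines (2 ℕ.+ m)) (suc r)) (λ M → ind (test a b K M))
    ≡⟨ ∑-product _∷_ (lines (2 ℕ.+ m)) Ms (λ M → ind (test a b K M)) ⟩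
  ∑ (lines (2 ℕ.+ m)) (λ row → ∑ Ms (λ M → ind (test a b K (row ∷ M))))
    ≡⟨ ∑-lines (suc m) (λ row → ∑ Ms (λ M → ind (test a b K (row ∷ M)))) ⟩
  _ ≡⟨ first a ⟩
  tot (leftState a) (rightState b) K (λ L → ∑ Ms (λ M → ind (test (pred a) (pred b) L M)))
    ≡⟨ tot-cong (leftState a) (rightState b) K (λ L → ∑-test m r (pred a) (pred b) L) ⟩
  tot (leftState a) (rightState b) K (triangles r (pred a) (pred b)) ∎
  where
  Ms = allVecs (lines (2 ℕ.+ m)) r
  f : ℕ → ℤ → ℚ
  f a x = ∑ (lines (suc m)) (λ xs → ∑ Ms (λ M → ind (test a b K ((x ∷ xs) ∷ M))))
  first : ∀ a → f a 1ℤ + (f a -1ℤ + f a 0ℤ) ≡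
          tot (leftState a) (rightState b) K (λ L → ∑ Ms (λ M → ind (test (pred a) (pred b) L M)))
  first 0 = add₃ (nowhere Ms (suc m)) (nowhere Ms (suc m)) (∑-reads Ms true b K (test 0 (pred b)))
  first 1 = add₁ (∑-reads Ms false b K (test 0 (pred b))) (nowhere Ms (suc m)) (nowhere Ms (suc m))
  first (suc (suc a)) = add₃ (nowhere Ms (suc m)) (nowhere Ms (suc m)) (∑-reads Ms true b K (test (suc a) (pred b)))

module _ (m u w : ℕ) where

  private
    s t n : ℕ
    s = 2 ℕ.+ u
    t = 2 ℕ.+ w
    n = 2 ℕ.+ m
    full : Vec Bool m
    full = Vec.replicate m true
    Ms : List (Vec (Vec ℤ n) (1 ℕ.+ m))
    Ms = allVecs (lines n) (1 ℕ.+ m)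

    tally : ℕ → Vec ℤ n → ℚ
    tally i row = ∑ Ms λ M → ind (firstOne i row ∧ test s t full (row ∷ M))

    #ASM≡∑ : ∀ i → fromℤ (+ (#ASM n s i t)) ≡ ∑ (lines n) (tally i)
    #ASM≡∑ i = begin
      fromℤ (+ (#ASM n s i t))
        ≡⟨ count≡∑ (isRefinedASM? s i t) (signMatrices n) ⟩
      ∑ (signMatrices n) (λ M → ind (does (isRefinedASM? s i t M)))
        ≡⟨ ∑-product _∷_ (lines n) Ms (λ M → ind (does (isRefinedASM? s i t M))) ⟩
      ∑ (lines n) (λ row → ∑ Ms (λ M → ind (does (isRefinedASM? s i t (row ∷ M)))))
        ≡⟨ ∑-cong (lines n) (λ row → ∑-cong Ms (λ M → cong ind (refined≡ (suc u) (suc w) i row M))) ⟩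
      ∑ (lines n) (tally i) ∎

  #ASM-0 : fromℤ (+ (#ASM n s 0 t)) ≡ 0ℚ
  #ASM-0 = trans (#ASM≡∑ 0) (nowhere Ms n)

  -- Since `s` is at least 2, the corner cannot be the 1 of the first column.
  #ASM-1 : fromℤ (+ (#ASM n s 1 t)) ≡ 0ℚ
  #ASM-1 = trans (#ASM≡∑ 1) (trans (∑-lines (suc m) (tally 1))
    (add₃ (nowhere Ms (suc m)) (nowhere Ms (suc m)) (nowhere Ms (suc m))))

  #ASM≡triangles : ∀ p → fromℤ (+ (#ASM n s (2 ℕ.+ p) t)) ≡
    (if p ℕ.<ᵇ m then triangles (1 ℕ.+ m) (suc u) (suc w) (missing m p) else 0ℚ)
  #ASM≡triangles p = trans (#ASM≡∑ (2 ℕ.+ p)) (trans (∑-lines (suc m) (tally (2 ℕ.+ p)))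
    (add₃ (nowhere′ Ms (suc m) (λ xs M → Bool.∧-zeroʳ (isOne p xs)))
          (nowhere′ Ms (suc m) (λ xs M → Bool.∧-zeroʳ (isOne p xs)))
          (trans (∑-first-row Ms m p w (test (suc u) (suc w)))
                 (cong (λ z → if p ℕ.<ᵇ m then z else 0ℚ) (∑-test m (1 ℕ.+ m) (suc u) (suc w) (missing m p))))))

-- The operator formula on lists

indices : ℕ → List ℕ
indices zero = []
indices (suc n) = 0 ∷ map suc (indices n)

suc² : ℕ × ℕ → ℕ × ℕ
suc² (i , j) = suc i , suc j

index-pairs : ℕ → List (ℕ × ℕ)
index-pairs zero = []
index-pairs (suc n) = map (λ j → 0 , suc j) (indices n) ++ map suc² (index-pairs n)

forget : ∀ {n} → (∃₂ λ (p q : Fin n) → p Fin.< q) → ℕ × ℕ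
forget (p , q , _) = toℕ p , toℕ q

below : ∀ {n} → List (Fin n × Fin n) → List (ℕ × ℕ)
below [] = []
below ((p , q) ∷ l) = if does (p Fin.<? q) then (toℕ p , toℕ q) ∷ below l else below l

below-++ : ∀ {n} (l l′ : List (Fin n × Fin n)) → below (l ++ l′) ≡ below l ++ below l′
below-++ [] l′ = refl
below-++ ((p , q) ∷ l) l′ with does (p Fin.<? q)
... | true = cong ((toℕ p , toℕ q) ∷_) (below-++ l l′)
... | false = below-++ l l′

forget-pairs : ∀ {n} (l : List (Fin n × Fin n)) →
  map forget (List.mapMaybe (λ (p , q) → Maybe.map (λ p<q → p , q , p<q) (dec⇒maybe (p Fin.<? q))) l) ≡ below l
forget-pairs [] = refl
forget-pairs {n} ((p , q) ∷ l) = trans (head (p Fin.<? q) _)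
  (cong (λ l → if does (p Fin.<? q) then (toℕ p , toℕ q) ∷ l else l) (forget-pairs l))
  where
  Pair : Set
  Pair = ∃₂ λ (p q : Fin n) → p Fin.< q
  head : (d : Dec (p Fin.< q)) (rest : List Pair) →
    map (forget {n}) (Maybe.maybe {A = Pair} {B = λ _ → List Pair → List Pair} _∷_ (λ l → l)
      (Maybe.map {B = Pair} (λ p<q → p , q , p<q) (dec⇒maybe d)) rest) ≡
    (if does d then (toℕ p , toℕ q) ∷ map (forget {n}) rest else map (forget {n}) rest)
  head (yes _) rest = refl
  head (no _) rest = refl

below-zero : ∀ {n} (l : List (Fin n)) → below (map (λ q → zero , q) (map suc l)) ≡ map (λ j → 0 , suc j) (map toℕ l)
below-zero [] = refl
below-zero (q ∷ l) = cong ((0 , suc (toℕ q)) ∷_) (below-zero l)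

below-suc : ∀ {n} (p : Fin n) (l : List (Fin n)) →
  below (map (λ q → suc p , q) (map suc l)) ≡ map suc² (below (map (λ q → p , q) l))
below-suc p [] = refl
below-suc p (q ∷ l) with does (p Fin.<? q)
... | true = cong ((suc (toℕ p) , suc (toℕ q)) ∷_) (below-suc p l)
... | false = below-suc p l

below-product : ∀ {n} (l l′ : List (Fin n)) →
  below (List.cartesianProduct (map suc l) (zero ∷ map suc l′)) ≡ map suc² (below (List.cartesianProduct l l′))
below-product [] l′ = refl
below-product (p ∷ l) l′ = begin
  below (map (λ q → suc p , q) (map suc l′) ++ List.cartesianProduct (map suc l) (zero ∷ map suc l′))
    ≡⟨ below-++ (map (λ q → suc p , q) (map suc l′)) _ ⟩
  below (map (λ q → suc p , q) (map suc l′)) ++ below (List.cartesianProduct (map suc l) (zero ∷ map suc l′))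
    ≡⟨ cong₂ _++_ (below-suc p l′) (below-product l l′) ⟩
  map suc² (below (map (λ q → p , q) l′)) ++ map suc² (below (List.cartesianProduct l l′))
    ≡⟨ List.map-++ suc² (below (map (λ q → p , q) l′)) _ ⟨
  map suc² (below (map (λ q → p , q) l′) ++ below (List.cartesianProduct l l′))
    ≡⟨ cong (map suc²) (below-++ (map (λ q → p , q) l′) _) ⟨
  map suc² (below (map (λ q → p , q) l′ ++ List.cartesianProduct l l′)) ∎

allFin-suc : ∀ n → List.allFin (suc n) ≡ zero ∷ map suc (List.allFin n)
allFin-suc n = cong (zero ∷_) (sym (List.map-tabulate (λ i → i) suc))

indices≡ : ∀ n → map toℕ (List.allFin n) ≡ indices n
indices≡ zero = refl
indices≡ (suc n) = begin
  map toℕ (List.allFin (suc n))                ≡⟨ cong (map toℕ) (allFin-suc n) ⟩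
  0 ∷ map toℕ (map suc (List.allFin n))        ≡⟨ cong (0 ∷_) (trans (sym (List.map-∘ (List.allFin n))) (List.map-∘ (List.allFin n))) ⟩
  0 ∷ map suc (map toℕ (List.allFin n))        ≡⟨ cong (λ l → 0 ∷ map suc l) (indices≡ n) ⟩
  indices (suc n)                              ∎

pairs≡ : ∀ n → map forget (pairs n) ≡ index-pairs n
pairs≡ n = trans (forget-pairs (List.cartesianProduct (List.allFin n) (List.allFin n))) (go n)
  where
  go : ∀ n → below (List.cartesianProduct (List.allFin n) (List.allFin n)) ≡ index-pairs n
  go zero = refl
  go (suc n) = begin
    below (List.cartesianProduct (List.allFin (suc n)) (List.allFin (suc n)))
      ≡⟨ cong (λ l → below (List.cartesianProduct l l)) (allFin-suc n) ⟩
    below (map (λ q → zero , q) (map suc A) ++ List.cartesianProduct (map suc A) (zero ∷ map suc A))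
      ≡⟨ below-++ (map (λ q → zero , q) (map suc A)) _ ⟩
    below (map (λ q → zero , q) (map suc A)) ++ below (List.cartesianProduct (map suc A) (zero ∷ map suc A))
      ≡⟨ cong₂ _++_ (trans (below-zero A) (cong (map (λ j → 0 , suc j)) (indices≡ n)))
                    (trans (below-product A A) (cong (map suc²) (go n))) ⟩
    index-pairs (suc n) ∎
    where A = List.allFin n

-- The shift factors on lists

increment : ℕ → List ℤ → List ℤ
increment i [] = []
increment zero (x ∷ xs) = ℤ.suc x ∷ xs
increment (suc i) (x ∷ xs) = x ∷ increment i xs

tabulate-updateAt : ∀ {n} (k : Vector ℤ n) p →
  List.tabulate (updateAt k p ℤ.suc) ≡ increment (toℕ p) (List.tabulate k)
tabulate-updateAt k zero = refl
tabulate-updateAt k (suc p) = cong (k zero ∷_) (tabulate-updateAt (λ i → k (suc i)) p)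

factor : ℕ × ℕ → (List ℤ → ℚ) → List ℤ → ℚ
factor (i , j) f xs = (f xs - f (increment i xs)) + f (increment j (increment i xs))

factors : List (ℕ × ℕ) → (List ℤ → ℚ) → List ℤ → ℚ
factors l f = foldr factor f l

factors≡ : ∀ {n} (l : List (∃₂ λ (p q : Fin n) → p Fin.< q)) {g : PolyFun n} {f} →
  (∀ k → g k ≡ f (List.tabulate k)) → ∀ k →
  foldr (λ (p , q , _) → shiftFactor p q) g l k ≡ factors (map forget l) f (List.tabulate k)
factors≡ [] e k = e k
factors≡ ((p , q , _) ∷ l) {g} {f} e k = cong₂ _+_
  (cong₂ _-_ (factors≡ l e k)
    (trans (factors≡ l e (updateAt k p ℤ.suc)) (cong (factors (map forget l) f) (tabulate-updateAt k p))))
  (trans (factors≡ l e (updateAt (updateAt k p ℤ.suc) q ℤ.suc))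
    (cong (factors (map forget l) f) (trans (tabulate-updateAt (updateAt k p ℤ.suc) q)
      (cong (increment (toℕ q)) (tabulate-updateAt k p)))))

factors-suc : ∀ l f x xs → factors (map suc² l) f (x ∷ xs) ≡ factors l (λ ys → f (x ∷ ys)) xs
factors-suc [] f x xs = refl
factors-suc ((i , j) ∷ l) f x xs = cong₂ _+_
  (cong₂ _-_ (factors-suc l f x xs) (factors-suc l f x (increment i xs)))
  (factors-suc l f x (increment j (increment i xs)))

row-factors : List ℕ → (ℤ → List ℤ → ℚ) → ℤ → List ℤ → ℚ
row-factors [] g l ys = g l ys
row-factors (j ∷ js) g l ys =
  (row-factors js g l ys - row-factors js g (ℤ.suc l) ys) + row-factors js g (ℤ.suc l) (increment j ys)

row-factors≡ : ∀ js f x xs →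
  factors (map (λ j → 0 , suc j) js) f (x ∷ xs) ≡ row-factors js (λ l ys → f (l ∷ ys)) x xs
row-factors≡ [] f x xs = refl
row-factors≡ (j ∷ js) f x xs = cong₂ _+_
  (cong₂ _-_ (row-factors≡ js f x xs) (row-factors≡ js f (ℤ.suc x) xs))
  (row-factors≡ js f (ℤ.suc x) (increment j xs))

row-factors-suc : ∀ js g l y ys →
  row-factors (map suc js) g l (y ∷ ys) ≡ row-factors js (λ l ys → g l (y ∷ ys)) l ys
row-factors-suc [] g l y ys = refl
row-factors-suc (j ∷ js) g l y ys = cong₂ _+_
  (cong₂ _-_ (row-factors-suc js g l y ys) (row-factors-suc js g (ℤ.suc l) y ys))
  (row-factors-suc js g (ℤ.suc l) y (increment j ys))

row-factors≡M : ∀ g l xs → row-factors (indices (length xs)) g l xs ≡ M TR g l xs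
row-factors≡M g l [] = refl
row-factors≡M g l (x ∷ xs) = trans
  (cong₂ _+_ (cong₂ _-_ (e l x) (e (ℤ.suc l) x)) (e (ℤ.suc l) (ℤ.suc x)))
  (solve 3 (λ a b c → a :- b :+ c := con 1ℚ :* a :+ (con (- 1ℚ) :* b :+ (con 1ℚ :* c :+ con 0ℚ))) refl
    (M TR (λ l ys → g l (x ∷ ys)) l xs) (M TR (λ l ys → g l (x ∷ ys)) (ℤ.suc l) xs)
    (M TR (λ l ys → g l (ℤ.suc x ∷ ys)) (ℤ.suc l) xs))
  where
  e : ∀ l y → row-factors (map suc (indices (length xs))) g l (y ∷ xs) ≡ M TR (λ l ys → g l (y ∷ ys)) l xs
  e l y = trans (row-factors-suc (indices (length xs)) g l y xs) (row-factors≡M (λ l ys → g l (y ∷ ys)) l xs)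

-- The list of pairs puts the factors of the first entry outermost, whereas `P` has them innermost;
-- `P-M` exchanges the two.
factors≡P : ∀ n f xs → length xs ≡ n → factors (index-pairs n) f xs ≡ P f xs
factors≡P zero f [] _ = refl
factors≡P (suc n) f (x ∷ xs) refl = begin
  factors (row ++ map suc² (index-pairs n)) f (x ∷ xs)
    ≡⟨ cong (λ h → h (x ∷ xs)) (List.foldr-++ factor f row (map suc² (index-pairs n))) ⟩
  factors row (factors (map suc² (index-pairs n)) f) (x ∷ xs)
    ≡⟨ row-factors≡ (indices n) (factors (map suc² (index-pairs n)) f) x xs ⟩
  row-factors (indices n) (λ l ys → factors (map suc² (index-pairs n)) f (l ∷ ys)) x xs
    ≡⟨ row-factors≡M (λ l ys → factors (map suc² (index-pairs n)) f (l ∷ ys)) x xs ⟩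
  M TR (λ l ys → factors (map suc² (index-pairs n)) f (l ∷ ys)) x xs
    ≡⟨ M-cong-length TR x xs (λ l ys p → trans (factors-suc (index-pairs n) f l ys)
         (factors≡P n (λ zs → f (l ∷ zs)) ys p)) ⟩
  M TR (λ l → P (λ zs → f (l ∷ zs))) x xs
    ≡⟨ P-M TR (λ l zs → f (l ∷ zs)) x xs ⟨
  P (M TR (λ l zs → f (l ∷ zs)) x) xs ∎
  where row = map (λ j → 0 , suc j) (indices n)

-- The product of difference quotients on lists

entry : ℕ → List ℤ → ℤ
entry i [] = 0ℤ
entry zero (x ∷ xs) = x
entry (suc i) (x ∷ xs) = entry i xs

entry-tabulate : ∀ {n} (k : Vector ℤ n) p → entry (toℕ p) (List.tabulate k) ≡ k p
entry-tabulate k zero = refl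
entry-tabulate k (suc p) = entry-tabulate (λ i → k (suc i)) p

-- The form `suc (pred _)` makes the denominator visibly non-zero without a proof of i < j; under i
-- < j it is j - i.
quotient : List ℤ → ℕ × ℕ → ℚ
quotient xs (i , j) = (entry j xs ℤ.- entry i xs) ℚ./ suc (pred (j ℕ.∸ i))

products : List ℤ → List (ℕ × ℕ) → ℚ → ℚ
products xs l r = foldr (λ ij r → quotient xs ij * r) r l

quotient≡ : ∀ {n} (k : Vector ℤ n) ij → differenceQuotient k ij ≡ quotient (List.tabulate k) (forget ij)
quotient≡ k (i , j , i<j) = ℚ./-cong {{ℕ.>-nonZero (ℕ.m<n⇒0<n∸m i<j)}}
  (cong₂ ℤ._-_ (sym (entry-tabulate k j)) (sym (entry-tabulate k i)))
  (sym (ℕ.suc-pred (toℕ j ℕ.∸ toℕ i) {{ℕ.>-nonZero (ℕ.m<n⇒0<n∸m i<j)}}))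

products≡ : ∀ {n} (k : Vector ℤ n) l →
  foldr (λ ij r → differenceQuotient k ij * r) 1ℚ l ≡ products (List.tabulate k) (map forget l) 1ℚ
products≡ k [] = refl
products≡ k (ij ∷ l) = cong₂ _*_ (quotient≡ k ij) (products≡ k l)

products-suc : ∀ x xs l r → products (x ∷ xs) (map suc² l) r ≡ products xs l r
products-suc x xs [] r = refl
products-suc x xs (ij ∷ l) r = cong (quotient xs ij *_) (products-suc x xs l r)

row-quotients : ℤ → ℕ → List ℕ → List ℤ → ℚ → ℚ
row-quotients x d [] xs r = r
row-quotients x d (j ∷ js) xs r = ((entry j xs ℤ.- x) ℚ./ suc (d ℕ.+ j)) * row-quotients x d js xs r

row-quotients≡ : ∀ x xs js r → products (x ∷ xs) (map (λ j → 0 , suc j) js) r ≡ row-quotients x 0 js xs r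
row-quotients≡ x xs [] r = refl
row-quotients≡ x xs (j ∷ js) r = cong (quotient (x ∷ xs) (0 , suc j) *_) (row-quotients≡ x xs js r)

row-quotients-suc : ∀ x d js y ys r → row-quotients x d (map suc js) (y ∷ ys) r ≡ row-quotients x (suc d) js ys r
row-quotients-suc x d [] y ys r = refl
row-quotients-suc x d (j ∷ js) y ys r = cong₂ _*_
  (ℚ./-cong {entry j ys ℤ.- x} {suc (d ℕ.+ suc j)} refl (cong suc (ℕ.+-suc d j)))
  (row-quotients-suc x d js y ys r)

row-quotients≡quotients : ∀ x d xs r → row-quotients x d (indices (length xs)) xs r ≡ quotients d x xs * r
row-quotients≡quotients x d [] r = sym (ℚ.*-identityˡ r)
row-quotients≡quotients x d (y ∷ ys) r = begin
  ((y ℤ.- x) ℚ./ suc (d ℕ.+ 0)) * row-quotients x d (map suc (indices (length ys))) (y ∷ ys) r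
    ≡⟨ cong₂ _*_ (ℚ./-cong {y ℤ.- x} {suc (d ℕ.+ 0)} refl (cong suc (ℕ.+-identityʳ d)))
         (trans (row-quotients-suc x d (indices (length ys)) y ys r) (row-quotients≡quotients x (suc d) ys r)) ⟩
  ((y ℤ.- x) ℚ./ suc d) * (quotients (suc d) x ys * r)
    ≡⟨ ℚ.*-assoc ((y ℤ.- x) ℚ./ suc d) (quotients (suc d) x ys) r ⟨
  quotients d x (y ∷ ys) * r ∎

products≡W : ∀ xs → products xs (index-pairs (length xs)) 1ℚ ≡ W xs
products≡W [] = refl
products≡W (x ∷ xs) = begin
  products (x ∷ xs) (row ++ map suc² (index-pairs n)) 1ℚ
    ≡⟨ List.foldr-++ (λ ij r → quotient (x ∷ xs) ij * r) 1ℚ row (map suc² (index-pairs n)) ⟩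
  products (x ∷ xs) row (products (x ∷ xs) (map suc² (index-pairs n)) 1ℚ)
    ≡⟨ cong (products (x ∷ xs) row) (trans (products-suc x xs (index-pairs n) 1ℚ) (products≡W xs)) ⟩
  products (x ∷ xs) row (W xs)
    ≡⟨ trans (row-quotients≡ x xs (indices n) (W xs)) (row-quotients≡quotients x 0 xs (W xs)) ⟩
  quotients 0 x xs * W xs ∎
  where
  n = length xs
  row = map (λ j → 0 , suc j) (indices n)

α≡αL : ∀ n k → α n k ≡ αL (List.tabulate k)
α≡αL n k = begin
  α n k
    ≡⟨ factors≡ (pairs n) {f = W} base k ⟩
  factors (map forget (pairs n)) W (List.tabulate k)
    ≡⟨ cong (λ l → factors l W (List.tabulate k)) (pairs≡ n) ⟩
  factors (index-pairs n) W (List.tabulate k)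
    ≡⟨ factors≡P n W (List.tabulate k) (List.length-tabulate k) ⟩
  αL (List.tabulate k) ∎
  where
  base : ∀ k → ∏differenceQuotients n k ≡ W (List.tabulate k)
  base k = begin
    ∏differenceQuotients n k
      ≡⟨ products≡ k (pairs n) ⟩
    products (List.tabulate k) (map forget (pairs n)) 1ℚ
      ≡⟨ cong (λ l → products (List.tabulate k) l 1ℚ) (trans (pairs≡ n) (cong index-pairs (sym (List.length-tabulate k)))) ⟩
    products (List.tabulate k) (index-pairs (length (List.tabulate k))) 1ℚ
      ≡⟨ products≡W (List.tabulate k) ⟩
    W (List.tabulate k) ∎

-- Extraction of the coefficients

diff-sum : ∀ s a n (f : Fin n → ℤ → ℚ) x → diff s a (λ x → ∑[ j < n ] f j x) x ≡ ∑[ j < n ] diff s a (f j) x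
diff-sum s a zero f x = diff-Linear.L-zero s a x
diff-sum s a (suc n) f x = trans
  (diff-Linear.L-add s a x (f zero) (λ x → ∑[ j < n ] f (suc j) x))
  (cong (λ z → diff s a (f zero) x + z) (diff-sum s a n (λ j → f (suc j)) x))

sum-zero : ∀ n → ∑[ j < n ] 0ℚ ≡ 0ℚ
sum-zero zero = refl
sum-zero (suc n) = trans (ℚ.+-identityˡ (∑[ j < n ] 0ℚ)) (sum-zero n)

kronecker : ℕ → ℕ → ℚ
kronecker zero zero = 1ℚ
kronecker zero (suc j) = 0ℚ
kronecker (suc a) zero = 0ℚ
kronecker (suc a) (suc j) = kronecker a j

sum-kronecker : ∀ n (c : Fin n → ℚ) a → ∑[ j < n ] (c j * kronecker (toℕ a) (toℕ j)) ≡ c a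
sum-kronecker (suc n) c zero = begin
  c zero * 1ℚ + ∑[ j < n ] (c (suc j) * 0ℚ)
    ≡⟨ cong (λ z → c zero * 1ℚ + z) (trans (sum-cong-≗ (λ j → ℚ.*-zeroʳ (c (suc j)))) (sum-zero n)) ⟩
  c zero * 1ℚ + 0ℚ
    ≡⟨ solve 1 (λ c → c :* con 1ℚ :+ con 0ℚ := c) refl (c zero) ⟩
  c zero ∎
sum-kronecker (suc n) c (suc a) = begin
  c zero * 0ℚ + ∑[ j < n ] (c (suc j) * kronecker (toℕ a) (toℕ j))
    ≡⟨ cong (λ z → c zero * 0ℚ + z) (sum-kronecker n (λ j → c (suc j)) a) ⟩
  c zero * 0ℚ + c (suc a)
    ≡⟨ solve 2 (λ c d → c :* con 0ℚ :+ d := d) refl (c zero) (c (suc a)) ⟩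
  c (suc a) ∎

-- Such a sequence is dual to the powers of id - Eˢ evaluated at `x₀`, so that one such difference
-- isolates one coefficient of an expansion in it.
record Appell (s : Shift) (x₀ : ℤ) (B : ℕ → ℤ → ℚ) : Set where
  field
    constant : ∀ x → B 0 x ≡ 1ℚ
    lower    : ∀ j x → B (suc j) x - B (suc j) (sh s x) ≡ B j x
    base     : ∀ j → B (suc j) x₀ ≡ 0ℚ

  dual : ∀ a j → diff s a (B j) x₀ ≡ kronecker a j
  dual zero zero = constant x₀
  dual zero (suc j) = base j
  dual (suc a) zero = begin
    diff s (suc a) (B 0) x₀                     ≡⟨ diff-suc s a (B 0) x₀ ⟩
    diff s a (λ x → B 0 x - B 0 (sh s x)) x₀    ≡⟨ diff-cong s a (λ x → cong₂ _-_ (constant x) (constant (sh s x))) x₀ ⟩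
    diff s a (λ x → 0ℚ) x₀                      ≡⟨ diff-Linear.L-zero s a x₀ ⟩
    0ℚ                                          ∎
  dual (suc a) (suc j) = begin
    diff s (suc a) (B (suc j)) x₀                             ≡⟨ diff-suc s a (B (suc j)) x₀ ⟩
    diff s a (λ x → B (suc j) x - B (suc j) (sh s x)) x₀      ≡⟨ diff-cong s a (lower j) x₀ ⟩
    diff s a (B j) x₀                                         ≡⟨ dual a j ⟩
    kronecker a j                                             ∎

  extract : ∀ n (c : Fin n → ℚ) a → diff s (toℕ a) (λ x → ∑[ j < n ] (c j * B (toℕ j) x)) x₀ ≡ c a
  extract n c a = begin
    diff s (toℕ a) (λ x → ∑[ j < n ] (c j * B (toℕ j) x)) x₀
      ≡⟨ diff-sum s (toℕ a) n (λ j x → c j * B (toℕ j) x) x₀ ⟩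
    ∑[ j < n ] diff s (toℕ a) (λ x → c j * B (toℕ j) x) x₀
      ≡⟨ sum-cong-≗ (λ j → trans (diff-Linear.L-scale s (toℕ a) x₀ (c j) (B (toℕ j)))
                                 (cong (c j *_) (dual (toℕ a) (toℕ j)))) ⟩
    ∑[ j < n ] (c j * kronecker (toℕ a) (toℕ j))
      ≡⟨ sum-kronecker n c a ⟩
    c a ∎

binomial-zero-above : ∀ j → binomial (+ j) (suc j) ≡ 0ℚ
binomial-zero-above j = trans (absorption (+ j) j)
  (trans (cong (λ z → inv j * (fromℤ z * binomial (+ j) j)) (ℤ.+-inverseʳ (+ j)))
         (solve 2 (λ i b → i :* (con 0ℚ :* b) := con 0ℚ) refl (inv j) (binomial (+ j) j)))

binomial-at-zero : ∀ j → binomial (+ 0) (suc j) ≡ 0ℚ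
binomial-at-zero zero = refl
binomial-at-zero (suc j) = trans (absorption (+ 0) (suc j))
  (trans (cong (λ z → inv (suc j) * (fromℤ (+ 0 ℤ.- + (suc j)) * z)) (binomial-at-zero j))
         (solve 2 (λ i x → i :* (x :* con 0ℚ) := con 0ℚ) refl (inv (suc j)) (fromℤ (+ 0 ℤ.- + (suc j)))))

left-basis : ℕ → ℤ → ℚ
left-basis j x = fromℤ (-1ℤ ℤ.^ (suc j ℕ.+ 1)) * binomial (x ℤ.- + 2) j

-- The sign in the expansion is needed because D is id - E, whereas Pascal's rule speaks of E - id.
left-Appell : Appell up (+ 2) left-basis
left-Appell = record
  { constant = λ x → refl
  ; lower = λ j x → begin
      σ (suc j) * b x (suc j) - σ (suc j) * binomial (ℤ.suc x ℤ.- + 2) (suc j)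
        ≡⟨ cong (λ z → σ (suc j) * b x (suc j) - σ (suc j) * z)
             (trans (cong (λ y → binomial y (suc j)) (ℤ.+-assoc 1ℤ x (ℤ.- + 2))) (pascal (x ℤ.- + 2) j)) ⟩
      σ (suc j) * b x (suc j) - σ (suc j) * (b x (suc j) + b x j)
        ≡⟨ cong (λ z → z * b x (suc j) - z * (b x (suc j) + b x j)) (fromℤ-* -1ℤ (-1ℤ ℤ.^ (suc j ℕ.+ 1))) ⟩
      fromℤ -1ℤ * σ j * b x (suc j) - fromℤ -1ℤ * σ j * (b x (suc j) + b x j)
        ≡⟨ solve 3 (λ s p q → con (- 1ℚ) :* s :* p :- con (- 1ℚ) :* s :* (p :+ q) := s :* q) refl (σ j) (b x (suc j)) (b x j) ⟩
      σ j * b x j ∎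
  ; base = λ j → trans (cong (σ (suc j) *_) (binomial-at-zero j)) (ℚ.*-zeroʳ (σ (suc j)))
  }
  where
  σ : ℕ → ℚ
  σ j = fromℤ (-1ℤ ℤ.^ (suc j ℕ.+ 1))
  b : ℤ → ℕ → ℚ
  b x j = binomial (x ℤ.- + 2) j

module _ (m : ℕ) where

  private
    n : ℕ
    n = 2 ℕ.+ m

  right-basis : ℕ → ℤ → ℚ
  right-basis j x = binomial (x ℤ.- + n ℤ.+ + (suc j)) j

  -- At x = n - 2 the binomial C(x - n + j + 1, j) becomes C(j - 1, j), which is zero for j > 0;
  -- this is the origin of the base point n - 2.
  right-Appell : Appell dn (+ m) right-basis
  right-Appell = record
    { constant = λ x → refl
    ; lower = λ j x → begin
        binomial (x ℤ.- + n ℤ.+ + (2 ℕ.+ j)) (suc j) - binomial (ℤ.pred x ℤ.- + n ℤ.+ + (2 ℕ.+ j)) (suc j)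
          ≡⟨ cong₂ (λ u v → binomial u (suc j) - binomial v (suc j)) (e₁ x (+ n) (+ j)) (e₂ x (+ n) (+ j)) ⟩
        binomial (ℤ.suc (z j x)) (suc j) - binomial (z j x) (suc j)
          ≡⟨ cong (_- binomial (z j x) (suc j)) (pascal (z j x) j) ⟩
        binomial (z j x) (suc j) + binomial (z j x) j - binomial (z j x) (suc j)
          ≡⟨ solve 2 (λ p q → p :+ q :- p := q) refl (binomial (z j x) (suc j)) (binomial (z j x) j) ⟩
        binomial (z j x) j ∎
    ; base = λ j → trans (cong (λ y → binomial y (suc j)) (e₃ (+ m) (+ j))) (binomial-zero-above j)
    }
    where
    open ℤ.+-*-Solver using () renaming (solve to solveℤ; _:+_ to _⊕_; _:-_ to _⊖_; con to κ; _:=_ to _≐_)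
    z : ℕ → ℤ → ℤ
    z j x = x ℤ.- + n ℤ.+ + (suc j)
    e₁ : ∀ x n j → x ℤ.- n ℤ.+ (+ 2 ℤ.+ j) ≡ ℤ.suc (x ℤ.- n ℤ.+ (+ 1 ℤ.+ j))
    e₁ = solveℤ 3 (λ x n j → x ⊖ n ⊕ (κ (+ 2) ⊕ j) ≐ κ 1ℤ ⊕ (x ⊖ n ⊕ (κ (+ 1) ⊕ j))) refl
    e₂ : ∀ x n j → ℤ.pred x ℤ.- n ℤ.+ (+ 2 ℤ.+ j) ≡ x ℤ.- n ℤ.+ (+ 1 ℤ.+ j)
    e₂ = solveℤ 3 (λ x n j → (κ -1ℤ ⊕ x) ⊖ n ⊕ (κ (+ 2) ⊕ j) ≐ x ⊖ n ⊕ (κ (+ 1) ⊕ j)) refl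
    e₃ : ∀ m j → m ℤ.- (+ 2 ℤ.+ m) ℤ.+ (+ 2 ℤ.+ j) ≡ j
    e₃ = solveℤ 2 (λ m j → m ⊖ (κ (+ 2) ⊕ m) ⊕ (κ (+ 2) ⊕ j) ≐ j) refl

  coefficients≡ : ∀ (A : Coefficients n) → IsExpansion n A → ∀ σ ι τ →
    diff up (toℕ σ) (λ a → diff dn (toℕ ι) (λ x → diff dn (toℕ τ) (λ y →
      α n (bottomRow n a x y)) (+ m)) (+ m)) (+ 2) ≡ A σ ι τ
  coefficients≡ A E σ ι τ = begin
    diff up (toℕ σ) (λ a → diff dn (toℕ ι) (λ x → diff dn (toℕ τ) (λ y → α n (bottomRow n a x y)) x₀) x₀) (+ 2)
      ≡⟨ diff-cong up (toℕ σ) (λ a → diff-cong dn (toℕ ι) (λ x → trans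
           (diff-cong dn (toℕ τ) (E a x) x₀) (extract-y a x)) x₀) (+ 2) ⟩
    diff up (toℕ σ) (λ a → diff dn (toℕ ι) (λ x → ∑[ s < n ] ∑[ i < n ] (A s i τ * sg s * b₁ s a * b₂ i x)) x₀) (+ 2)
      ≡⟨ diff-cong up (toℕ σ) extract-x (+ 2) ⟩
    diff up (toℕ σ) (λ a → ∑[ s < n ] (A s ι τ * sg s * b₁ s a)) (+ 2)
      ≡⟨ diff-cong up (toℕ σ) (λ a → sum-cong-≗ (λ s → ℚ.*-assoc (A s ι τ) (sg s) (b₁ s a))) (+ 2) ⟩
    diff up (toℕ σ) (λ a → ∑[ s < n ] (A s ι τ * left-basis (toℕ s) a)) (+ 2)
      ≡⟨ Appell.extract left-Appell n (λ s → A s ι τ) σ ⟩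
    A σ ι τ ∎
    where
    x₀ = + m
    sg : Fin n → ℚ
    sg s = fromℤ (-1ℤ ℤ.^ (pos s ℕ.+ 1))
    b₁ b₂ : Fin n → ℤ → ℚ
    b₁ s a = binomial (a ℤ.- + 2) (toℕ s)
    b₂ i x = right-basis (toℕ i) x
    extract-y : ∀ a x → diff dn (toℕ τ) (λ y → ∑[ s < n ] ∑[ i < n ] ∑[ t < n ]
                  (A s i t * sg s * b₁ s a * b₂ i x * b₂ t y)) x₀ ≡
                ∑[ s < n ] ∑[ i < n ] (A s i τ * sg s * b₁ s a * b₂ i x)
    extract-y a x = trans
      (diff-sum dn (toℕ τ) n (λ s y → ∑[ i < n ] ∑[ t < n ] (A s i t * sg s * b₁ s a * b₂ i x * b₂ t y)) x₀)
      (sum-cong-≗ λ s → trans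
        (diff-sum dn (toℕ τ) n (λ i y → ∑[ t < n ] (A s i t * sg s * b₁ s a * b₂ i x * b₂ t y)) x₀)
        (sum-cong-≗ λ i → Appell.extract right-Appell n (λ t → A s i t * sg s * b₁ s a * b₂ i x) τ))
    extract-x : ∀ a → diff dn (toℕ ι) (λ x → ∑[ s < n ] ∑[ i < n ] (A s i τ * sg s * b₁ s a * b₂ i x)) x₀ ≡
                ∑[ s < n ] (A s ι τ * sg s * b₁ s a)
    extract-x a = trans
      (diff-sum dn (toℕ ι) n (λ s x → ∑[ i < n ] (A s i τ * sg s * b₁ s a * b₂ i x)) x₀)
      (sum-cong-≗ λ s → Appell.extract right-Appell n (λ i → A s i τ * sg s * b₁ s a) ι)

tabulate-tail : ∀ c m x y →
  List.tabulate {n = 2 ℕ.+ m} (λ p → if toℕ p ℕ.≡ᵇ suc m then y else if toℕ p ℕ.≡ᵇ m then x else + (c ℕ.+ toℕ p)) ≡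
  elems c (Vec.replicate m true) ++ x ∷ y ∷ []
tabulate-tail c zero x y = refl
tabulate-tail c (suc m) x y = cong₂ _∷_ (cong +_ (ℕ.+-identityʳ c)) (trans
  (List.tabulate-cong {n = 2 ℕ.+ m} (λ p → cong
    (λ e → if toℕ p ℕ.≡ᵇ suc m then y else if toℕ p ℕ.≡ᵇ m then x else + e) (ℕ.+-suc c (toℕ p))))
  (tabulate-tail (suc c) m x y))

tabulate-bottomRow : ∀ m a x y → List.tabulate (bottomRow (3 ℕ.+ m) a x y) ≡ a ∷ prefix m (x ∷ y ∷ [])
tabulate-bottomRow m a x y = cong (a ∷_) (trans (tabulate-tail 2 m x y) (sym (prefix≡ m (x ∷ y ∷ []))))

size-full : ∀ m → ∣ Vec.replicate m true ∣ₜ ≡ m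
size-full zero = refl
size-full (suc m) = cong suc (size-full m)

size-missing : ∀ m p → p ℕ.≤ m → ∣ missing (suc m) p ∣ₜ ≡ m
size-missing m zero _ = size-full m
size-missing (suc m) (suc p) (ℕ.s≤s q) = cong suc (size-missing m p q)

module _ (m u w : ℕ) where

  private
    n s t : ℕ
    n = 3 ℕ.+ m
    s = 2 ℕ.+ u
    t = 2 ℕ.+ w

  -- For p > m the position i is the last column, where t ≥ 2 forbids a 1 in the first row, or lies
  -- outside the matrix; correspondingly p exceeds the degree in v of the sum of omissions.
  #ASM≡coefficient : ∀ p → fromℤ (+ (#ASM n s (2 ℕ.+ p) t)) ≡ coefficient m u w (+ p)
  #ASM≡coefficient p = trans (#ASM≡triangles (suc m) u w p) (go (p ℕ.<? suc m))
    where
    choose : Bool → ℚ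
    choose b = if b then triangles (2 ℕ.+ m) (suc u) (suc w) (missing (suc m) p) else 0ℚ
    go : Dec (p ℕ.< suc m) → choose (p ℕ.<ᵇ suc m) ≡ coefficient m u w (+ p)
    go (yes p<1+m) = begin
      choose (p ℕ.<ᵇ suc m)
        ≡⟨ cong choose (dec-true (p ℕ.<? suc m) p<1+m) ⟩
      triangles (2 ℕ.+ m) (suc u) (suc w) (missing (suc m) p)
        ≡⟨ triangles≡val (2 ℕ.+ m) (suc u) (suc w) (missing (suc m) p) (cong (2 ℕ.+_) (size-missing m p (ℕ.≤-pred p<1+m))) ⟩
      val (suc u) (suc w) (missing (suc m) p)
        ≡⟨ coefficient≡val m u w p (ℕ.≤-pred p<1+m) ⟨
      coefficient m u w (+ p) ∎
    go (no p≮1+m) = begin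
      choose (p ℕ.<ᵇ suc m)
        ≡⟨ cong choose (dec-false (p ℕ.<? suc m) p≮1+m) ⟩
      0ℚ
        ≡⟨ coefficient-more m u w p (ℕ.≮⇒≥ p≮1+m) ⟨
      coefficient m u w (+ p) ∎

  #ASM≡coefficient₁ : ∀ p → fromℤ (+ (#ASM n s (1 ℕ.+ p) t)) ≡ coefficient m u w (ℤ.pred (+ p))
  #ASM≡coefficient₁ zero = trans (#ASM-1 (suc m) u w) (sym (coefficient-negative m u w 0))
  #ASM≡coefficient₁ (suc p) = #ASM≡coefficient p

  #ASM≡coefficient₀ : ∀ p → fromℤ (+ (#ASM n s p t)) ≡ coefficient m u w (ℤ.pred (ℤ.pred (+ p)))
  #ASM≡coefficient₀ zero = trans (#ASM-0 (suc m) u w) (sym (coefficient-negative m u w 1))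
  #ASM≡coefficient₀ (suc p) = #ASM≡coefficient₁ p

fromℤ-sum : ∀ a b c d e f → fromℤ (a ℤ.+ b ℤ.+ c ℤ.- d ℤ.- e ℤ.- f) ≡
            fromℤ a + fromℤ b + fromℤ c - fromℤ d - fromℤ e - fromℤ f
fromℤ-sum a b c d e f =
  trans (fromℤ-- (a ℤ.+ b ℤ.+ c ℤ.- d ℤ.- e) f) (cong (_- fromℤ f)
  (trans (fromℤ-- (a ℤ.+ b ℤ.+ c ℤ.- d) e) (cong (_- fromℤ e)
  (trans (fromℤ-- (a ℤ.+ b ℤ.+ c) d) (cong (_- fromℤ d)
  (trans (fromℤ-+ (a ℤ.+ b) c) (cong (_+ fromℤ c) (fromℤ-+ a b))))))))

cong₆ : ∀ {a b c d e f a′ b′ c′ d′ e′ f′ : ℚ} → a ≡ a′ → b ≡ b′ → c ≡ c′ → d ≡ d′ → e ≡ e′ → f ≡ f′ →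
        a + b + c - d - e - f ≡ a′ + b′ + c′ - d′ - e′ - f′
cong₆ refl refl refl refl refl refl = refl

-- By `αL-∇`, ∇ in the last variable removes the dependence on k₁, and D then gives zero.
coefficients-2 : ∀ (A : Coefficients 2) → IsExpansion 2 A → ∀ ι → A (suc zero) ι (suc zero) ≡ 0ℚ
coefficients-2 A E ι = begin
  A (suc zero) ι (suc zero)
    ≡⟨ coefficients≡ 0 A E (suc zero) ι (suc zero) ⟨
  diff up 1 (λ a → diff dn (toℕ ι) (λ x → diff dn 1 (λ y → α 2 (bottomRow 2 a x y)) (+ 0)) (+ 0)) (+ 2)
    ≡⟨ diff-cong up 1 (λ a → diff-cong dn (toℕ ι) (λ x → trans
         (diff-cong dn 1 (λ y → α≡αL 2 (bottomRow 2 a x y)) (+ 0))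
         (trans (sym (∇all-∷ (λ ys → αL (a ∷ ys)) (+ 0) [])) (αL-∇ a (+ 0 ∷ [])))) (+ 0)) (+ 2) ⟩
  diff up 1 (λ a → diff dn (toℕ ι) (λ x → αL (+ 0 ∷ [])) (+ 0)) (+ 2)
    ≡⟨ ℚ.+-inverseʳ (diff dn (toℕ ι) (λ x → αL (+ 0 ∷ [])) (+ 0)) ⟩
  0ℚ ∎

-- The first row would need its 1 in one of the two columns, both of which have their 1 further
-- down.
#ASM-2 : ∀ u w i → fromℤ (+ (#ASM 2 (2 ℕ.+ u) i (2 ℕ.+ w))) ≡ 0ℚ
#ASM-2 u w 0 = #ASM-0 0 u w
#ASM-2 u w 1 = #ASM-1 0 u w
#ASM-2 u w (suc (suc p)) = #ASM≡triangles 0 u w p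

theorem1 :
  ∀ (n : ℕ) → 2 ≤ n →
  ∀ (A : Coefficients n) → IsExpansion n A →
  ∀ (σ ι τ : Fin n) →
  let s = pos σ
      i = pos ι
      t = pos τ
  in 2 ≤ s → 2 ≤ t →
     A σ ι τ ≡ fromℤ
       ( + #ASM n (suc s) i t
       ℤ.+ + #ASM n (suc s) i (suc t)
       ℤ.+ + #ASM n s (suc i) t
       ℤ.- + #ASM n (suc s) (suc i) t
       ℤ.- + #ASM n s i (suc t)
       ℤ.- + #ASM n (suc s) (pred i) (suc t) )
theorem1 1 (s≤s ())
theorem1 n 2≤n A E zero ι τ (s≤s ())
theorem1 n 2≤n A E (suc σ) ι zero 2≤s (s≤s ())
theorem1 2 2≤n A E (suc zero) ι (suc zero) 2≤s 2≤t = trans (coefficients-2 A E ι) (sym (trans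
  (fromℤ-sum (k 3 i 2) (k 3 i 3) (k 2 (suc i) 2) (k 3 (suc i) 2) (k 2 i 3) (k 3 (pred i) 3))
  (cong₆ (#ASM-2 1 0 (pos ι)) (#ASM-2 1 1 (pos ι)) (#ASM-2 0 0 (suc (pos ι)))
         (#ASM-2 1 0 (suc (pos ι))) (#ASM-2 0 1 (pos ι)) (#ASM-2 1 1 (toℕ ι)))))
  where
  i : ℕ
  i = pos ι
  k : ℕ → ℕ → ℕ → ℤ
  k s i t = + #ASM 2 s i t
theorem1 (suc (suc (suc m))) 2≤n A E (suc σ) ι (suc τ) 2≤s 2≤t = begin
  A (suc σ) ι (suc τ)
    ≡⟨ coefficients≡ (suc m) A E (suc σ) ι (suc τ) ⟨
  diff up (suc u) (λ a → diff dn p (λ x → diff dn (suc w) (λ y → α (3 ℕ.+ m) (bottomRow (3 ℕ.+ m) a x y)) x₀) x₀) (+ 2)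
    ≡⟨ diff-cong up (suc u) (λ a → diff-cong dn p (λ x → diff-cong dn (suc w) (λ y → trans
         (α≡αL (3 ℕ.+ m) (bottomRow (3 ℕ.+ m) a x y)) (cong αL (tabulate-bottomRow m a x y))) x₀) x₀) (+ 2) ⟩
  diff up (suc u) (λ a → diff dn p (λ x → diff dn (suc w) (λ y → αL (a ∷ prefix m (x ∷ y ∷ []))) x₀) x₀) (+ 2)
    ≡⟨ α-differences m u p w ⟩
  c₃ - c₄ + c₁ - (c₅ - c₂ + c₆)
    ≡⟨ solve 6 (λ c₁ c₂ c₃ c₄ c₅ c₆ → c₃ :- c₄ :+ c₁ :- (c₅ :- c₂ :+ c₆) := c₁ :+ c₂ :+ c₃ :- c₄ :- c₅ :- c₆)
         refl c₁ c₂ c₃ c₄ c₅ c₆ ⟩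
  c₁ + c₂ + c₃ - c₄ - c₅ - c₆
    -- The conventions for s + 1 and t + 1 beyond n require no case distinction, as the three
    -- identities hold for all row numbers from 2 on; those for i - 1 = 0 and i + 1 = n + 1 are
    -- coefficients of v outside the range of degrees.
    ≡⟨ trans (fromℤ-sum (k (suc s) i t) (k (suc s) i (suc t)) (k s (suc i) t)
         (k (suc s) (suc i) t) (k s i (suc t)) (k (suc s) (pred i) (suc t))) (cong₆
         (#ASM≡coefficient₁ m (suc u) w p) (#ASM≡coefficient₁ m (suc u) (suc w) p) (#ASM≡coefficient m u w p)
         (#ASM≡coefficient m (suc u) w p) (#ASM≡coefficient₁ m u (suc w) p) (#ASM≡coefficient₀ m (suc u) (suc w) p)) ⟨
  fromℤ (k (suc s) i t ℤ.+ k (suc s) i (suc t) ℤ.+ k s (suc i) t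
         ℤ.- k (suc s) (suc i) t ℤ.- k s i (suc t) ℤ.- k (suc s) (pred i) (suc t)) ∎
  where
  u p w s i t : ℕ
  u = toℕ σ
  p = toℕ ι
  w = toℕ τ
  s = pos (suc σ)
  i = pos ι
  t = pos (suc τ)
  k : ℕ → ℕ → ℕ → ℤ
  k s i t = + #ASM (3 ℕ.+ m) s i t
  x₀ : ℤ
  x₀ = + (1 ℕ.+ m)
  c₁ c₂ c₃ c₄ c₅ c₆ : ℚ
  c₁ = coefficient m (suc u) w (ℤ.pred (+ p))
  c₂ = coefficient m (suc u) (suc w) (ℤ.pred (+ p))
  c₃ = coefficient m u w (+ p)
  c₄ = coefficient m (suc u) w (+ p)
  c₅ = coefficient m u (suc w) (ℤ.pred (+ p))
  c₆ = coefficient m (suc u) (suc w) (ℤ.pred (ℤ.pred (+ p)))
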